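{- Let $n\ge 2$. Let $\tilde{\mathcal O}_n$ be the class of all oriented adjoints of the cross-polytope $\mathbf{O}_n$ with respect to $\mathcal D_1:=\{Y_i\}_{i\in[n]}\cup\{X_{A'}\}_{A\subseteq[n]}$, and let $\tilde{\mathcal C}_n$ be the class of all oriented cubes over $\mathcal D_1^+:=\{X_{A'}\}_{A\subseteq[n]}$ (where $\mathcal D_1^+$ is identified with $C^n=\{ -1,1\}^n$ via $X_{A'}\leftrightarrow v_A$). Then the correspondence $f:\tilde{\mathcal O}_n\to\tilde{\mathcal C}_n$, $f(\tilde{\mathcal M})=\tilde{\mathcal M}(\mathcal D_1^+)$, which assigns to every oriented adjoint $\tilde{\mathcal M}\in\tilde{\mathcal O}_n$ its restriction to $\mathcal D_1^+$, is (well defined and) a bijection.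
   Context: Signed sets (sign vectors) $X\in\{+,-,0\}^E$ are written $X=(X^+,X^-)$, with $X^0$ the zero set. For an oriented matroid $\mathcal M$ on $E$ and $F\subseteq E$, $\mathcal M(F)$ denotes the restriction of $\mathcal M$ to $F$. Cross-polytope. $[n]=\{1,\dots,n\}$, $[n]'=\{1',\dots,n'\}$ is a disjoint copy of $[n]$, and $A'=\{i':i\in A\}$ for $A\subseteq[n]$. $\mathbf{O}_n$ is the oriented matroid on $[n]\cup[n]'$ of affine dependencies of the points $e_1,\dots,e_n,-e_1,\dots,-e_n$ of $\mathbb{R}^n$ ($i$ corresponds to $e_i$, $i'$ to $-e_i$). It has rank $n+1$, and its signed cocircuits are $\pm X_{A'}$ with $X_{A'}=(([n]\setminus A)\cup A',\emptyset)$ for $A\subseteq[n]$, and $\pm Y_i$ with $Y_i=(\{i\},\{i'\})$ for $i\in[n]$. Adjoint. An (oriented) adjoint of $\mathbf{O}_n$ with respect to $\mathcal D_1$ is an oriented matroid $\tilde{\mathcal M}$ on the ground set $\mathcal D_1$, of rank $n+1$, whose signed cocircuits include, for every $i\in[n]$, the signed sets $\tilde X[i]=(\{X_{A'}\}_{A\subseteq[n]\setminus i}\cup\{Y_i\},\emptyset)$ and $\tilde X[i']=(\{X_{A'\cup i'}\}_{A\subseteq[n]\setminus i},\{Y_i\})$. Cubes. $C^n=\{ -1,1\}^n$. For $A\subseteq[n]$, $v_A\in C^n$ is given by $v_A(i)=-1$ for $i\in A$ and $v_A(i)=1$ for $i\notin A$. For $B\subseteq[n]$ and $v\in C^n$,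 ${}_{ -B}v$ is obtained from $v$ by changing the sign of the coordinates indexed by $B$. The real cube is $\mathbf{Q}_n=\mathrm{Aff}(C^n)$, the oriented matroid of affine dependencies of $C^n$ over $\mathbb{R}$. The signed rectangles are $(\{v,{}_{ -(A\cup B)}v\},\{{}_{ -A}v,{}_{ -B}v\})$ with $v\in C^n$ and $A,B\subseteq[n]$ disjoint and nonempty. The facets are $H_{i+}=\{v\in C^n:v(i)=1\}$, $H_{i- }=\{v\in C^n:v(i)=-1\}$; the skew-facets are $H_{ij+}=\{v\in C^n:v(i)=v(j)\}$, $H_{ij- }=\{v\in C^n:v(i)=-v(j)\}$ ($i\ne j$). An oriented cube over $C^n$ is an oriented matroid on $C^n$ such that all signed rectangles are signed circuits and all signed cocircuits of $\mathbf{Q}_n$ complementary to facets and skew-facets are signed cocircuits. -}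

module Defs where

open import Data.Bool using (if_then_else_)
open import Data.Fin using (Fin)
import Data.Fin as Fin
open import Data.Fin.Subset using (Subset; Nonempty; Empty; _∩_; _∪_)
open import Data.List using (List; []; _∷_; _++_; map; foldr; length)
import Data.List.Membership.Propositional as List
import Data.List.Membership.DecPropositional as DecMembership
open import Data.List.Relation.Unary.Unique.Propositional using (Unique)
open import Data.Nat using (ℕ; zero; suc; _≤_)
open import Data.Product using (Σ; ∃; _×_; _,_; proj₁)
open import Data.Rational using (ℚ; 0ℚ; 1ℚ)
import Data.Rational as ℚ
import Data.Rational.Properties as ℚ
open import Data.Sign using (Sign; opposite)
import Data.Sign as Sign
import Data.Sign.Properties as Sign
open import Data.Sum using (_⊎_; inj₁; inj₂; [_,_]′)
open import Data.Vec using (Vec; zipWith; lookup)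
import Data.Vec as Vec
import Data.Vec.Properties as Vec
open import Function using (_∘_; const)
open import Level using (0ℓ)
open import Relation.Binary.Definitions
  using (DecidableEquality; tri<; tri≈; tri>)
open import Relation.Binary.PropositionalEquality using (_≡_; _≢_; _≗_; refl)
open import Relation.Nullary using (¬_; does)
open import Relation.Nullary.Negation using (contradiction)
open import Relation.Unary using (Pred; _⊆_; _≐_; ∁)
import Relation.Unary as Unary

------------------------------------------------------------------------
-- Signed sets

data Sgn : Set where
  ⊕ ⊖ 𝟘 : Sgn

neg : Sgn → Sgn
neg ⊕ = ⊖
neg ⊖ = ⊕
neg 𝟘 = 𝟘

infixl 7 _·_

_·_ : Sgn → Sgn → Sgn
⊕ · t = t
⊖ · t = neg t
𝟘 · t = 𝟘

-- Signed sets are compared pointwise, by _≗_.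
SignVec : Set → Set
SignVec E = E → Sgn

module _ {E : Set} where

  -ᵥ_ : SignVec E → SignVec E
  (-ᵥ X) e = neg (X e)

  supp : SignVec E → Pred E 0ℓ
  supp X e = X e ≢ 𝟘

  NonZero : Pred (SignVec E) 0ℓ
  NonZero X = ∃ (supp X)

  infix 4 _⊥_

  _⊥_ : SignVec E → SignVec E → Set
  X ⊥ Y = (∀ e → X e · Y e ≡ 𝟘)
        ⊎ (∃ λ e → X e · Y e ≡ ⊕) × (∃ λ e → X e · Y e ≡ ⊖)

  SupportMinimal : Pred (SignVec E) 0ℓ → Pred (SignVec E) 0ℓ
  SupportMinimal V X =
    V X × NonZero X ×
    (∀ Y → V Y → NonZero Y → supp Y ⊆ supp X → supp X ⊆ supp Y)

  -- The signed cocircuits belonging to a family C of signed circuits: the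
  -- signed circuits of the dual, that is, the support-minimal nonzero signed
  -- sets orthogonal to every member of C.
  Cocircuits : Pred (SignVec E) 0ℓ → Pred (SignVec E) 0ℓ
  Cocircuits C = SupportMinimal (λ Y → ∀ X → C X → X ⊥ Y)

------------------------------------------------------------------------
-- Oriented matroids

-- The ground set E is meant to be finite, as all the ground sets below are.
-- A set of signed subsets of E is a decidable predicate invariant under
-- pointwise equality; the other four fields are the signed circuit axioms.
record OrientedMatroid (E : Set) : Set₁ where
  field
    Circuit      : Pred (SignVec E) 0ℓ
    circuit?     : Unary.Decidable Circuit
    resp         : ∀ {X Y} → X ≗ Y → Circuit X → Circuit Y
    nonZero      : ∀ {X} → Circuit X → NonZero X
    symmetric    : ∀ {X} → Circuit X → Circuit (-ᵥ X)
    incomparable : ∀ {X Y} → Circuit X → Circuit Y → supp X ⊆ supp Y →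
                   X ≗ Y ⊎ X ≗ (-ᵥ Y)
    eliminate    : ∀ {X Y} → Circuit X → Circuit Y → ¬ X ≗ (-ᵥ Y) →
                   ∀ e → X e ≡ ⊕ → Y e ≡ ⊖ →
                   ∃ λ Z → Circuit Z × Z e ≡ 𝟘 ×
                     (∀ f → Z f ≡ ⊕ → X f ≡ ⊕ ⊎ Y f ≡ ⊕) ×
                     (∀ f → Z f ≡ ⊖ → X f ≡ ⊖ ⊎ Y f ≡ ⊖)

  Cocircuit : Pred (SignVec E) 0ℓ
  Cocircuit = Cocircuits Circuit

  Independent : Pred (List E) 0ℓ
  Independent B = ∀ X → Circuit X → ¬ (supp X ⊆ (List._∈ B))

  HasRank : ℕ → Set
  HasRank r = (∃ λ B → Unique B × Independent B × length B ≡ r)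
            × (∀ B → Unique B → Independent B → length B ≤ r)

open OrientedMatroid

infix 4 _≋_

_≋_ : {E : Set} → OrientedMatroid E → OrientedMatroid E → Set
M ≋ N = Circuit M ≐ Circuit N

module _ {F G : Set} where

  extend : SignVec F → SignVec (F ⊎ G)
  extend X = [ X , const 𝟘 ]′

  private
    extend-cong : ∀ {X Y} → X ≗ Y → extend X ≗ extend Y
    extend-cong p (inj₁ e) = p e
    extend-cong p (inj₂ _) = refl

    extend-neg : ∀ X → (-ᵥ extend X) ≗ extend (-ᵥ X)
    extend-neg X (inj₁ _) = refl
    extend-neg X (inj₂ _) = refl

    extend-supp : ∀ {X Y} → supp X ⊆ supp Y → supp (extend X) ⊆ supp (extend Y)
    extend-supp s {inj₁ _} = s
    extend-supp s {inj₂ _} = λ p → p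

  -- The restriction M(F) of an oriented matroid on the disjoint union of F
  -- and G: its circuits are the circuits of M whose support lies in F.
  restrict : OrientedMatroid (F ⊎ G) → OrientedMatroid F
  restrict M .Circuit X         = Circuit M (extend X)
  restrict M .circuit? X        = circuit? M (extend X)
  restrict M .resp p            = resp M (extend-cong p)
  restrict M .nonZero c with nonZero M c
  ... | inj₁ e , p              = e , p
  ... | inj₂ _ , p              = contradiction refl p
  restrict M .symmetric c       = resp M (extend-neg _) (symmetric M c)
  restrict M .incomparable {X} {Y} c d s
    with incomparable M c d (λ {e} → extend-supp {X} {Y} s {e})
  ... | inj₁ p                  = inj₁ (p ∘ inj₁)
  ... | inj₂ p                  = inj₂ (p ∘ inj₁)
  restrict M .eliminate {X} {Y} c d X≉-Y e Xe Ye
    with eliminate M c d (λ p → X≉-Y (p ∘ inj₁)) (inj₁ e) Xe Ye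
  ... | Z , z , Ze , pos , min  =
    Z ∘ inj₁ , resp M Z≗ z , Ze , pos ∘ inj₁ , min ∘ inj₁
    where
    zero-on-G : ∀ g → Z (inj₂ g) ≡ 𝟘
    zero-on-G g with Z (inj₂ g) in eq
    ... | 𝟘 = refl
    ... | ⊕ with pos (inj₂ g) eq
    ...   | inj₁ ()
    ...   | inj₂ ()
    zero-on-G g | ⊖ with min (inj₂ g) eq
    ...   | inj₁ ()
    ...   | inj₂ ()

    Z≗ : Z ≗ extend (Z ∘ inj₁)
    Z≗ (inj₁ _) = refl
    Z≗ (inj₂ g) = zero-on-G g

------------------------------------------------------------------------
-- Affine dependencies

sgn : ℚ → Sgn
sgn q with ℚ.<-cmp q 0ℚ
... | tri< _ _ _ = ⊖
... | tri≈ _ _ _ = 𝟘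
... | tri> _ _ _ = ⊕

-- In this module, elems lists every element of E exactly once.
module _ {E : Set} (elems : List E) {d : ℕ} (p : E → Fin d → ℚ) where

  Σₑ : (E → ℚ) → ℚ
  Σₑ f = foldr ℚ._+_ 0ℚ (map f elems)

  IsAffineDependence : (E → ℚ) → Set
  IsAffineDependence c =
    Σₑ c ≡ 0ℚ × (∀ k → Σₑ (λ e → c e ℚ.* p e k) ≡ 0ℚ)

  -- The signed circuits of the oriented matroid of affine dependencies of the
  -- points p e.  As these points are rational, dependencies with rational and
  -- with real coefficients have the same signed circuits.
  AffCircuit : Pred (SignVec E) 0ℓ
  AffCircuit = SupportMinimal
    (λ X → ∃ λ c → IsAffineDependence c × X ≗ sgn ∘ c)

------------------------------------------------------------------------
-- Cubes

-- Cⁿ = {-1,1}ⁿ; the vertex v_A has sign - exactly at the coordinates in A.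
Cube : ℕ → Set
Cube = Vec Sign

vertices : ∀ n → List (Cube n)
vertices zero    = Vec.[] ∷ []
vertices (suc n) = map (Sign.+ Vec.∷_) (vertices n)
                ++ map (Sign.- Vec.∷_) (vertices n)

_≟ᵥ_ : ∀ {n} → DecidableEquality (Cube n)
_≟ᵥ_ = Vec.≡-dec Sign._≟_

±1 : Sign → ℚ
±1 Sign.+ = 1ℚ
±1 Sign.- = ℚ.- 1ℚ

point : ∀ {n} → Cube n → Fin n → ℚ
point v i = ±1 (lookup v i)

-- The signed circuits and signed cocircuits of the real cube Q_n = Aff(Cⁿ).
RealCubeCircuit : ∀ n → Pred (SignVec (Cube n)) 0ℓ
RealCubeCircuit n = AffCircuit (vertices n) point

RealCubeCocircuit : ∀ n → Pred (SignVec (Cube n)) 0ℓ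
RealCubeCocircuit n = Cocircuits (RealCubeCircuit n)

-- flip B v changes the sign of the coordinates of v indexed by B.
flip : ∀ {n} → Subset n → Cube n → Cube n
flip = zipWith (λ b s → if b then opposite s else s)

-- The signed set (P , N), for disjoint P and N.
signedSet : ∀ {n} → List (Cube n) → List (Cube n) → SignVec (Cube n)
signedSet P N w =
  if does (w ∈? P) then ⊕ else
  if does (w ∈? N) then ⊖ else 𝟘
  where open DecMembership _≟ᵥ_ using (_∈?_)

rectangle : ∀ {n} → Cube n → Subset n → Subset n → SignVec (Cube n)
rectangle v A B =
  signedSet (v ∷ flip (A ∪ B) v ∷ []) (flip A v ∷ flip B v ∷ [])

Facet : ∀ {n} → Fin n → Sign → Pred (Cube n) 0ℓ
Facet i s v = lookup v i ≡ s

SkewFacet : ∀ {n} → Fin n → Fin n → Sign → Pred (Cube n) 0ℓ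
SkewFacet i j s v = lookup v i ≡ s Sign.* lookup v j

ComplementaryTo : ∀ {n} → SignVec (Cube n) → Pred (Cube n) 0ℓ → Set
ComplementaryTo X H = supp X ≐ ∁ H

record IsOrientedCube (n : ℕ) (M : OrientedMatroid (Cube n)) : Set where
  field
    rectangles  : ∀ v A B → Nonempty A → Nonempty B → Empty (A ∩ B) →
                  Circuit M (rectangle v A B)
    facets      : ∀ i s X → RealCubeCocircuit n X →
                  ComplementaryTo X (Facet i s) → Cocircuit M X
    skewFacets  : ∀ i j s → i ≢ j → ∀ X → RealCubeCocircuit n X →
                  ComplementaryTo X (SkewFacet i j s) → Cocircuit M X

------------------------------------------------------------------------
-- Adjoints of the cross-polytope

-- The ground set [n] ∪ [n]′ of O_n: inj₁ i is the point e_i, and inj₂ i is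
-- the point i′, that is, -e_i.
Cross : ℕ → Set
Cross n = Fin n ⊎ Fin n

-- D₁ = D₁⁺ ∪ {Y_i}.  Its part D₁⁺ is identified with Cⁿ from the start: for
-- v = v_A, the element inj₁ v is X_{A′}; the element inj₂ i is Y_i.
D₁ : ℕ → Set
D₁ n = Cube n ⊎ Fin n

-- X_{A′} = (([n] ∖ A) ∪ A′ , ∅), where v = v_A.
X[_] : ∀ {n} → Cube n → SignVec (Cross n)
X[ v ] (inj₁ i) with lookup v i
... | Sign.+ = ⊕
... | Sign.- = 𝟘
X[ v ] (inj₂ i) with lookup v i
... | Sign.+ = 𝟘
... | Sign.- = ⊕

-- Y_i = ({i} , {i′}).
Y[_] : ∀ {n} → Fin n → SignVec (Cross n)
Y[ i ] (inj₁ j) = if does (i Fin.≟ j) then ⊕ else 𝟘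
Y[ i ] (inj₂ j) = if does (i Fin.≟ j) then ⊖ else 𝟘

cocircuitOf : ∀ {n} → D₁ n → SignVec (Cross n)
cocircuitOf = [ X[_] , Y[_] ]′

-- For every element e of O_n, the signed subset of D₁ whose sign at a
-- cocircuit D is D(e).  Explicitly,
--   X̃ (inj₁ i) = ({X_{A′} : i ∉ A} ∪ {Y_i} , ∅),
--   X̃ (inj₂ i) = ({X_{A′} : i ∈ A} , {Y_i}).
X̃ : ∀ {n} → Cross n → SignVec (D₁ n)
X̃ e D = cocircuitOf D e

record IsAdjoint (n : ℕ) (M : OrientedMatroid (D₁ n)) : Set where
  field
    rank       : HasRank M (suc n)
    cocircuits : ∀ e → Cocircuit M (X̃ e)

------------------------------------------------------------------------
-- The two classes, each compared by equality of oriented matroids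

OrientedAdjoint : ℕ → Set₁
OrientedAdjoint n = Σ (OrientedMatroid (D₁ n)) (IsAdjoint n)

OrientedCube : ℕ → Set₁
OrientedCube n = Σ (OrientedMatroid (Cube n)) (IsOrientedCube n)

_≈ₐ_ : ∀ {n} → OrientedAdjoint n → OrientedAdjoint n → Set
M ≈ₐ N = proj₁ M ≋ proj₁ N

_≈꜀_ : ∀ {n} → OrientedCube n → OrientedCube n → Set
M ≈꜀ N = proj₁ M ≋ proj₁ N

{-# OPTIONS --safe #-}
module Submission where

-- By the painting lemma, an oriented matroid is determined by its covectors, the
-- sign vectors orthogonal to all circuits.
--
-- In an adjoint, the element Y_i lies on every line spanned by an edge of the
-- cube in direction i: if v(i) = +, the rank and the facets through v make
-- ({v} , {_{-i}v , Y_i}) a circuit.  Therefore the sign of a covector at Y_i is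
-- determined by its restriction to the cube, unless this takes equal nonzero
-- values at the ends of each edge in direction i, and in that case all three
-- signs occur.  Thus the covectors of an adjoint are exactly the sign vectors
-- that are orthogonal to these edge circuits and restrict to covectors of the
-- restriction, and the restriction determines the adjoint.
--
-- Conversely, the rectangles of an oriented cube make the signs prescribed at Y_i
-- by the edges in direction i consistent, and it remains to see that the sign
-- vectors just described admit covector elimination.  The directions are added
-- one by one.  Two covectors with a common zero v behave as if Y_i were parallel or
-- antiparallel to _{-i}v.  Two covectors without common zero are first moved, by
-- bisecting the segments towards a wrong elimination, into the hyperplane of Y_i,
-- where elimination is possible because the facets allow one to straighten its
-- result; a facet then pushes the result off this hyperplane in the required
-- direction.

open import Defs
open import Data.Nat using (ℕ; _≤_)
open import Data.Product using (Σ; _,_)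
open import Function.Structures using (IsBijection)

open import Data.Bool using (true; false; if_then_else_; _∨_)
open import Data.Empty using () renaming (⊥ to Absurd)
open import Data.Fin as Fin using (Fin)
import Data.Fin.Properties as Fin
open import Data.Fin.Subset using (Subset; Nonempty; Empty; _∩_; _∪_; ⁅_⁆)
import Data.Fin.Subset.Properties as Subset
open import Data.List using (List; []; _∷_; _++_; map; foldr; length; filter; concatMap; allFin)
open import Data.List.Membership.Propositional using (_∈_; lose; find)
import Data.List.Membership.DecPropositional as DecMembership
open import Data.List.Membership.Propositional.Properties using (∈-filter⁺; ∈-filter⁻)
import Data.List.Membership.Propositional.Properties as Membership
import Data.List.Properties as List
open import Data.List.Relation.Unary.All as All using (All; []; _∷_)
open import Data.List.Relation.Unary.AllPairs using ([]; _∷_)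
open import Data.List.Relation.Unary.Any as Any using (Any; here; there; any?)
import Data.List.Relation.Unary.Any.Properties as Any
open import Data.List.Relation.Unary.Unique.Propositional using (Unique)
import Data.List.Relation.Unary.Unique.Propositional.Properties as Unique
open import Data.Nat using (zero; suc; _+_; _<_; z≤n; s≤s)
import Data.Nat.Properties as ℕ
open import Data.Product using (∃; _×_; proj₁; proj₂)
open import Data.Rational using (ℚ; 0ℚ; 1ℚ)
import Data.Rational as ℚ
import Data.Rational.Properties as ℚ
open import Data.Rational.Solver using (module +-*-Solver)
open import Data.Sign using (Sign; opposite)
import Data.Sign as Sign
import Data.Sign.Properties as Sign
open import Data.Sum as Sum using (_⊎_; inj₁; inj₂; [_,_]′)
import Data.Sum.Properties as Sum
open import Data.Unit using (⊤; tt)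
open import Data.Vec as Vec using (Vec; lookup; _[_]≔_)
import Data.Vec.Properties as Vec
open import Function using (_∘_; id; const)
open import Level using (0ℓ)
open import Relation.Binary.Definitions using (DecidableEquality; tri<; tri≈; tri>)
open import Relation.Binary.PropositionalEquality hiding (resp; [_])
open import Relation.Nullary using (¬_; Dec; yes; no; does)
open import Relation.Nullary.Decidable
  using (map′; ¬?; _×-dec_; _⊎-dec_; _→-dec_; decidable-stable; True; toWitness; dec-true; dec-false)
open import Relation.Nullary.Negation using (contradiction)
open import Relation.Unary using (Pred; _⊆_; Decidable)

-- Signs and sign vectors

-- The circuit axioms provide only weak elimination, while painting rests on strong elimination. The
-- latter is itself obtained by painting in proper restrictions, by induction on the ground set.
-- Painting is therefore stated for any family with exchange: it is applied to the circuits of such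
-- restrictions, to all circuits, and to families of covectors. Sign vectors are compared pointwise
-- on a finite set, so that all choices can be made by search.
--
-- The obstacle in the converse direction is that an elimination in the cube may force the wrong
-- sign at the new element and then cannot be completed. In this case no end of an edge in that
-- direction is a common zero of the two covectors, so that composing with a facet on the right
-- disturbs no sign that elimination prescribes. This is why covectors, which are closed under
-- composition, are extended rather than circuits.
--
-- The rank of an adjoint is used only by counting: a set is dependent if covectors vanishing on it
-- separate so many further elements that, together with these, it has n + 2 elements. Edges and
-- rectangles are both obtained in this way.

infix 4 _≟ₛ_

_≟ₛ_ : DecidableEquality Sgn
⊕ ≟ₛ ⊕ = yes refl
⊕ ≟ₛ ⊖ = no λ ()
⊕ ≟ₛ 𝟘 = no λ ()
⊖ ≟ₛ ⊕ = no λ ()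
⊖ ≟ₛ ⊖ = yes refl
⊖ ≟ₛ 𝟘 = no λ ()
𝟘 ≟ₛ ⊕ = no λ ()
𝟘 ≟ₛ ⊖ = no λ ()
𝟘 ≟ₛ 𝟘 = yes refl

∀-sign? : {P : Sgn → Set} → (∀ s → Dec (P s)) → Dec (∀ s → P s)
∀-sign? P? = map′
  (λ { (p , q , r) ⊕ → p ; (p , q , r) ⊖ → q ; (p , q , r) 𝟘 → r })
  (λ f → f ⊕ , f ⊖ , f 𝟘)
  (P? ⊕ ×-dec P? ⊖ ×-dec P? 𝟘)

∃-sign? : {P : Sgn → Set} → (∀ s → Dec (P s)) → Dec (∃ P)
∃-sign? P? = map′
  (λ { (inj₁ p) → ⊕ , p ; (inj₂ (inj₁ p)) → ⊖ , p ; (inj₂ (inj₂ p)) → 𝟘 , p })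
  (λ { (⊕ , p) → inj₁ p ; (⊖ , p) → inj₂ (inj₁ p) ; (𝟘 , p) → inj₂ (inj₂ p) })
  (P? ⊕ ⊎-dec P? ⊖ ⊎-dec P? 𝟘)

instance
  dec-⊥ : Dec Absurd
  dec-⊥ = no λ ()

  dec-≡ : ∀ {s t : Sgn} → Dec (s ≡ t)
  dec-≡ {s} {t} = s ≟ₛ t

  dec-× : {A B : Set} {{_ : Dec A}} {{_ : Dec B}} → Dec (A × B)
  dec-× {{A?}} {{B?}} = A? ×-dec B?

  dec-⊎ : {A B : Set} {{_ : Dec A}} {{_ : Dec B}} → Dec (A ⊎ B)
  dec-⊎ {{A?}} {{B?}} = A? ⊎-dec B?

  dec-→ : {A B : Set} {{_ : Dec A}} {{_ : Dec B}} → Dec (A → B)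
  dec-→ {{A?}} {{B?}} = A? →-dec B?

  dec-∀ : {P : Sgn → Set} {{_ : ∀ {s} → Dec (P s)}} → Dec (∀ s → P s)
  dec-∀ {{P?}} = ∀-sign? λ s → P? {s}

  dec-∃ : {P : Sgn → Set} {{_ : ∀ {s} → Dec (P s)}} → Dec (∃ P)
  dec-∃ {{P?}} = ∃-sign? λ s → P? {s}

-- A statement quantifying over finitely many signs is proved by evaluating it.
by-signs : {P : Set} {{P? : Dec P}} {_ : True P?} → P
by-signs {{_}} {holds} = toWitness holds

infixr 6 _▹_

-- Composition of covectors, at a single element.
_▹_ : Sgn → Sgn → Sgn
⊕ ▹ t = ⊕
⊖ ▹ t = ⊖
𝟘 ▹ t = t

-- The elements at which two vectors are opposed form their separation set.
Opposed : Sgn → Sgn → Set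
Opposed s t = s ≢ 𝟘 × s ≡ neg t

opposed? : ∀ s t → Dec (Opposed s t)
opposed? s t = ¬? (s ≟ₛ 𝟘) ×-dec (s ≟ₛ neg t)

infix 4 _≼_ _≼?_

_≼_ : Sgn → Sgn → Set
z ≼ s = z ≡ 𝟘 ⊎ z ≡ s

_≼?_ : ∀ z s → Dec (z ≼ s)
z ≼? s = (z ≟ₛ 𝟘) ⊎-dec (z ≟ₛ s)

OneOf : Sgn → Sgn → Sgn → Set
OneOf z x y = z ≡ 𝟘 ⊎ z ≡ x ⊎ z ≡ y

neg-neg : ∀ s → neg (neg s) ≡ s
neg-neg = by-signs

neg≡𝟘 : ∀ s → neg s ≡ 𝟘 → s ≡ 𝟘
neg≡𝟘 = by-signs

·-neg : ∀ s t → neg s · t ≡ neg (s · t)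
·-neg = by-signs

·-negʳ : ∀ s t → s · neg t ≡ neg (s · t)
·-negʳ = by-signs

·-comm : ∀ s t → s · t ≡ t · s
·-comm = by-signs

·-zeroʳ : ∀ s → s · 𝟘 ≡ 𝟘
·-zeroʳ = by-signs

·-identityʳ : ∀ s → s · ⊕ ≡ s
·-identityʳ = by-signs

·-cancelˡ : ∀ s t → s ≢ 𝟘 → s · t ≡ 𝟘 → t ≡ 𝟘
·-cancelˡ = by-signs

·-self-opposed : ∀ s t → t ≢ 𝟘 → s · t ≡ neg (s · t) → s ≡ 𝟘
·-self-opposed = by-signs

·-self : ∀ s → s ≢ 𝟘 → s · s ≡ ⊕
·-self = by-signs

≼-·-≢⊖ : ∀ s x y → x ≼ s → y ≼ s → x · y ≢ ⊖
≼-·-≢⊖ = by-signs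

▹-neg : ∀ s t → neg (s ▹ t) ≡ neg s ▹ neg t
▹-neg = by-signs

▹-identityʳ : ∀ s → s ▹ 𝟘 ≡ s
▹-identityʳ = by-signs

▹-absorbˡ : ∀ s t → s ≢ 𝟘 → s ▹ t ≡ s
▹-absorbˡ = by-signs

▹≡𝟘 : ∀ s t → s ▹ t ≡ 𝟘 → s ≡ 𝟘 × t ≡ 𝟘
▹≡𝟘 = by-signs

▹-comm : ∀ s t → ¬ Opposed s t → s ▹ t ≡ t ▹ s
▹-comm = by-signs

opposed-sym : ∀ s t → Opposed s t → Opposed t s
opposed-sym = by-signs

opposed-up-to-sign : ∀ s t → s ≢ 𝟘 → t ≢ 𝟘 → Opposed s t ⊎ Opposed s (neg t)
opposed-up-to-sign = by-signs

unopposed : ∀ s t → s ≢ 𝟘 → t ≢ neg s → ¬ Opposed s t × s ▹ t ≡ s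
unopposed = by-signs

-- A colour prescribes the possible signs of a vector at an element: sg s asks
-- for 𝟘 or s.  The dual colour is the prescription for the covectors that
-- certify that no vector obeys the given colouring.
data Colour : Set where
  sg   : Sgn → Colour
  free : Colour

Obeys : Colour → Sgn → Set
Obeys (sg s) z = z ≼ s
Obeys free   z = ⊤

obeys? : ∀ c z → Dec (Obeys c z)
obeys? (sg s) z = z ≼? s
obeys? free   z = yes tt

dual : Colour → Colour
dual (sg ⊕) = sg ⊕
dual (sg ⊖) = sg ⊖
dual (sg 𝟘) = free
dual free   = sg 𝟘

obeys-𝟘 : ∀ c → Obeys c 𝟘
obeys-𝟘 (sg s) = inj₁ refl
obeys-𝟘 free   = tt

-- Orthogonality then makes every product vanish, so that a vector and a covector obeying dual
-- colourings cannot both have the prescribed nonzero sign at the same element.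
obeys-dual : ∀ c x w → Obeys c x → Obeys (dual c) w → x · w ≢ ⊖
obeys-dual (sg ⊕) x w = ≼-·-≢⊖ ⊕ x w
obeys-dual (sg ⊖) x w = ≼-·-≢⊖ ⊖ x w
obeys-dual (sg 𝟘) x w (inj₁ refl) _ = λ ()
obeys-dual (sg 𝟘) x w (inj₂ refl) _ = λ ()
obeys-dual free x w _ (inj₁ refl) rewrite ·-zeroʳ x = λ ()
obeys-dual free x w _ (inj₂ refl) rewrite ·-zeroʳ x = λ ()

dual-sg : ∀ s → s ≢ 𝟘 → dual (sg s) ≡ sg s
dual-sg ⊕ _ = refl
dual-sg ⊖ _ = refl
dual-sg 𝟘 p = contradiction refl p

obeys-dual-sg : ∀ s x → Obeys (dual (sg s)) x → x · s ≢ ⊖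
obeys-dual-sg s x o = subst (_≢ ⊖) (·-comm s x) (obeys-dual (sg s) s x (inj₂ refl) o)

-- Search over a finite ground set and its sign vectors

module Finite {E : Set} (_≟_ : DecidableEquality E)
              (elements : List E) (complete : ∀ e → e ∈ elements) where

  ∃-element? : {P : E → Set} → (∀ e → Dec (P e)) → Dec (∃ P)
  ∃-element? P? = map′ Any.satisfied (λ { (e , p) → lose (complete e) p }) (any? P? elements)

  ∀-element? : {P : E → Set} → (∀ e → Dec (P e)) → Dec (∀ e → P e)
  ∀-element? P? = map′ (λ a e → All.lookup a (complete e)) (λ f → All.tabulate λ {e} _ → f e)
                       (All.all? P? elements)

  infix 8 _[_≔_]

  _[_≔_] : {A : Set} → (E → A) → E → A → E → A
  (X [ e ≔ s ]) h with h ≟ e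
  ... | yes _ = s
  ... | no  _ = X h

  ≔-same : ∀ {A : Set} (X : E → A) e s → (X [ e ≔ s ]) e ≡ s
  ≔-same X e s with e ≟ e
  ... | yes _  = refl
  ... | no e≢e = contradiction refl e≢e

  ≔-other : ∀ {A : Set} (X : E → A) e s {h} → h ≢ e → (X [ e ≔ s ]) h ≡ X h
  ≔-other X e s {h} h≢e with h ≟ e
  ... | yes h≡e = contradiction h≡e h≢e
  ... | no _    = refl

  private
    signVecs : List E → List (SignVec E)
    signVecs []      = const 𝟘 ∷ []
    signVecs (e ∷ L) = concatMap (λ X → X [ e ≔ ⊕ ] ∷ X [ e ≔ ⊖ ] ∷ X [ e ≔ 𝟘 ] ∷ []) (signVecs L)

    signVecs-complete : ∀ L (X : SignVec E) → Any (λ Y → ∀ e → e ∈ L → Y e ≡ X e) (signVecs L)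
    signVecs-complete []      X = here λ e ()
    signVecs-complete (e ∷ L) X = Any.concatMap⁺ _ (Any.map step (signVecs-complete L X))
      where
      agrees : ∀ {Y s} → (∀ h → h ∈ L → Y h ≡ X h) → X e ≡ s →
               ∀ h → h ∈ e ∷ L → (Y [ e ≔ s ]) h ≡ X h
      agrees p Xe h h∈ with h ≟ e | h∈
      ... | yes refl | _        = sym Xe
      ... | no h≢e   | here h≡e = contradiction h≡e h≢e
      ... | no _     | there h∈L = p h h∈L
      step : ∀ {Y} → (∀ h → h ∈ L → Y h ≡ X h) →
             Any (λ Y → ∀ h → h ∈ e ∷ L → Y h ≡ X h) (Y [ e ≔ ⊕ ] ∷ Y [ e ≔ ⊖ ] ∷ Y [ e ≔ 𝟘 ] ∷ [])
      step p with X e in eq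
      ... | ⊕ = here (agrees p eq)
      ... | ⊖ = there (here (agrees p eq))
      ... | 𝟘 = there (there (here (agrees p eq)))

  Respects : Pred (SignVec E) 0ℓ → Set
  Respects P = ∀ {X Y} → X ≗ Y → P X → P Y

  -- The search meets each sign vector only up to pointwise equality, hence the condition on `P`.
  ∃-signVec? : {P : Pred (SignVec E) 0ℓ} → Respects P → (∀ X → Dec (P X)) → Dec (∃ P)
  ∃-signVec? resp P? = map′ Any.satisfied
    (λ { (X , p) → Any.map (λ eq → resp (λ e → sym (eq e (complete e))) p) (signVecs-complete elements X) })
    (any? P? (signVecs elements))

  ∀-signVec? : {P : Pred (SignVec E) 0ℓ} → Respects P → (∀ X → Dec (P X)) → Dec (∀ X → P X)
  ∀-signVec? {P} resp P? = map′
    (λ ¬∃ X → decidable-stable (P? X) λ ¬p → ¬∃ (X , ¬p))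
    (λ { ∀P (X , ¬p) → ¬p (∀P X) })
    (¬? (∃-signVec? (λ eq ¬p p → ¬p (resp (sym ∘ eq) p)) (¬? ∘ P?)))

  ⊥? : ∀ (X W : SignVec E) → Dec (X ⊥ W)
  ⊥? X W = ∀-element? (λ e → X e · W e ≟ₛ 𝟘)
    ⊎-dec (∃-element? (λ e → X e · W e ≟ₛ ⊕) ×-dec ∃-element? (λ e → X e · W e ≟ₛ ⊖))

-- Orthogonality, exchange families and covector families

module _ {E : Set} where

  ⊥-resp : ∀ {X X′ W W′ : SignVec E} → X ≗ X′ → W ≗ W′ → X ⊥ W → X′ ⊥ W′
  ⊥-resp {X} {X′} {W} {W′} p q = Sum.map
    (λ z e → trans (sym (eq e)) (z e))
    (λ { ((e , a) , (f , b)) → (e , trans (sym (eq e)) a) , (f , trans (sym (eq f)) b) })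
    where
    eq : ∀ e → X e · W e ≡ X′ e · W′ e
    eq e = cong₂ _·_ (p e) (q e)

  ⊥-sym : ∀ (X W : SignVec E) → X ⊥ W → W ⊥ X
  ⊥-sym X W = Sum.map
    (λ z e → trans (·-comm (W e) (X e)) (z e))
    (λ { ((e , a) , (f , b)) →
         (e , trans (·-comm (W e) (X e)) a) , (f , trans (·-comm (W f) (X f)) b) })

  ⊥-negʳ : ∀ (X W : SignVec E) → X ⊥ W → X ⊥ (-ᵥ W)
  ⊥-negʳ X W = Sum.map
    (λ z e → trans (·-negʳ (X e) (W e)) (cong neg (z e)))
    (λ { ((e , a) , (f , b)) →
         (f , trans (·-negʳ (X f) (W f)) (cong neg b)) , (e , trans (·-negʳ (X e) (W e)) (cong neg a)) })

  ⊥-nonneg : ∀ (X W : SignVec E) → X ⊥ W → (∀ h → X h · W h ≢ ⊖) → ∀ h → X h · W h ≡ 𝟘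
  ⊥-nonneg X W (inj₁ z)             _ h = z h
  ⊥-nonneg X W (inj₂ (_ , (f , m))) p h = contradiction m (p f)

  ⊥-nonneg-contra : ∀ (X W : SignVec E) → X ⊥ W → (∀ h → X h · W h ≢ ⊖) →
                    ∀ f → X f · W f ≢ ⊕
  ⊥-nonneg-contra X W o p f f⊕ with () ← trans (sym f⊕) (⊥-nonneg X W o p f)

  -- The positive product at `f` has to be balanced, and `e` is the only place left for a negative
  -- one.
  ⊥-forced : ∀ (X W : SignVec E) → X ⊥ W → ∀ e → (∀ h → h ≢ e → X h · W h ≢ ⊖) →
             ∀ f → X f · W f ≡ ⊕ → X e · W e ≡ ⊖
  ⊥-forced X W (inj₁ z) e p f f⊕ with () ← trans (sym f⊕) (z f)
  ⊥-forced X W (inj₂ (_ , (k , k⊖))) e p f f⊕ = decidable-stable (_ ≟ₛ _) λ e≢⊖ →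
    p k (λ { refl → e≢⊖ k⊖ }) k⊖

  ≗-sym : ∀ {X Y : SignVec E} → X ≗ Y → Y ≗ X
  ≗-sym p = sym ∘ p

  Perp : Pred (SignVec E) 0ℓ → Pred (SignVec E) 0ℓ
  Perp 𝒞 W = ∀ X → 𝒞 X → X ⊥ W

  infixr 6 _▹ᵥ_

  _▹ᵥ_ : SignVec E → SignVec E → SignVec E
  (X ▹ᵥ Y) e = X e ▹ Y e

  -- Strong elimination in a form shared by the circuits, the circuits of a restriction, the vectors
  -- and the covectors of an oriented matroid.
  record IsExchangeFamily (𝒞 : Pred (SignVec E) 0ℓ) : Set where
    field
      resp     : ∀ {X Y} → X ≗ Y → 𝒞 X → 𝒞 Y
      _∈?      : Decidable 𝒞
      negate : ∀ {X} → 𝒞 X → 𝒞 (-ᵥ X)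
      exchange : ∀ {X Y} → 𝒞 X → 𝒞 Y → ∀ e f → Opposed (X e) (Y e) →
                 X f ≢ 𝟘 → Y f ≢ neg (X f) →
                 ∃ λ Z → 𝒞 Z × Z e ≡ 𝟘 × Z f ≡ X f × (∀ h → OneOf (Z h) (X h) (Y h))

  record IsCovectorFamily (𝓛 : Pred (SignVec E) 0ℓ) : Set where
    field
      resp      : ∀ {X Y} → X ≗ Y → 𝓛 X → 𝓛 Y
      _∈?       : Decidable 𝓛
      null      : 𝓛 (const 𝟘)
      negate  : ∀ {X} → 𝓛 X → 𝓛 (-ᵥ X)
      compose   : ∀ {X Y} → 𝓛 X → 𝓛 Y → 𝓛 (X ▹ᵥ Y)
      eliminate : ∀ {X Y} → 𝓛 X → 𝓛 Y → ∀ e → Opposed (X e) (Y e) →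
                  ∃ λ Z → 𝓛 Z × Z e ≡ 𝟘 ×
                    (∀ h → ¬ Opposed (X h) (Y h) → Z h ≡ X h ▹ Y h)

  exchangeFamily : ∀ {𝓛} → IsCovectorFamily 𝓛 → IsExchangeFamily 𝓛
  exchangeFamily {𝓛} isL = record
    { resp = resp ; _∈? = _∈? ; negate = negate ; exchange = ex }
    where
    open IsCovectorFamily isL
    between : ∀ x y z → (¬ Opposed x y → z ≡ x ▹ y) → OneOf z x y
    between = by-signs
    ex : ∀ {X Y} → 𝓛 X → 𝓛 Y → ∀ e f → Opposed (X e) (Y e) →
         X f ≢ 𝟘 → Y f ≢ neg (X f) →
         ∃ λ Z → 𝓛 Z × Z e ≡ 𝟘 × Z f ≡ X f × (∀ h → OneOf (Z h) (X h) (Y h))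
    ex {X} {Y} x y e f op Xf Yf with eliminate x y e op
    ... | Z , z , Ze , off = Z , z , Ze ,
      trans (off f (proj₁ k)) (proj₂ k) , λ h → between (X h) (Y h) (Z h) (off h)
      where k = unopposed (X f) (Y f) Xf Yf

-- The painting lemma

module Painting {E : Set} (_≟_ : DecidableEquality E)
                (elements : List E) (complete : ∀ e → e ∈ elements)
                {𝒞 : Pred (SignVec E) 0ℓ} (exchangeable : IsExchangeFamily 𝒞) where

  open Finite _≟_ elements complete
  open IsExchangeFamily exchangeable

  perp? : ∀ W → Dec (Perp 𝒞 W)
  perp? W = ∀-signVec? (λ eq o x → ⊥-resp eq (λ _ → refl) (o (resp (≗-sym eq) x)))
                       (λ X → (X ∈?) →-dec ⊥? X W)

  -- If orthogonality fails, then all nonzero products have the same sign, which is ⊕ after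
  -- replacing `X` by its negative if necessary.
  perp-intro : ∀ W → (∀ X → 𝒞 X → (∀ h → X h · W h ≢ ⊖) → ∀ f → X f · W f ≢ ⊕) → Perp 𝒞 W
  perp-intro W impossible X x
    with ∃-element? (λ e → X e · W e ≟ₛ ⊕) | ∃-element? (λ e → X e · W e ≟ₛ ⊖)
  ... | yes p | yes m = inj₂ (p , m)
  ... | no ¬p | no ¬m = inj₁ λ e → neither (X e · W e) (λ p → ¬p (e , p)) (λ m → ¬m (e , m))
    where
    neither : ∀ s → s ≢ ⊕ → s ≢ ⊖ → s ≡ 𝟘
    neither = by-signs
  ... | yes (f , p) | no ¬m = contradiction p (impossible X x (λ h m → ¬m (h , m)) f)
  ... | no ¬p | yes (f , m) = contradiction (trans (·-neg (X f) (W f)) (cong neg m))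
    (impossible (-ᵥ X) (negate x) (λ h eq → ¬p (h , flipped (trans (sym (·-neg (X h) (W h))) eq))) f)
    where
    flipped : ∀ {s} → neg s ≡ ⊖ → s ≡ ⊕
    flipped {⊕} _ = refl

  Obeying : (E → Colour) → Pred (SignVec E) 0ℓ
  Obeying c X = ∀ h → Obeys (c h) (X h)

  Primal : (E → Colour) → E → Sgn → Set
  Primal c f s = ∃ λ X → 𝒞 X × Obeying c X × X f ≡ s

  Dual : (E → Colour) → E → Sgn → Set
  Dual c f s = ∃ λ W → Perp 𝒞 W × Obeying (dual ∘ c) W × W f ≡ s

  private
    primal? : ∀ c f s → Dec (Primal c f s)
    primal? c f s = ∃-signVec?
      (λ eq (x , o , Xf) → resp eq x , (λ h → subst (Obeys (c h)) (eq h) (o h)) , trans (sym (eq f)) Xf)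
      (λ X → (X ∈?) ×-dec (∀-element? (λ h → obeys? (c h) (X h)) ×-dec (X f ≟ₛ s)))

    -- W is the signed cocircuit avoiding the flat spanned by the free elements:
    -- it is read off the vectors through f that meet its support in {f , b}.
    module Cocircuit (c : E → Colour) (f : E) (s : Sgn) (s≢𝟘 : s ≢ 𝟘) (cf : c f ≡ sg s)
                     (none : ¬ Primal c f s) where

      -- Maximality of the set of free elements: freeing `b` as well would make the primal problem
      -- solvable. Hence the free elements span a hyperplane avoiding `f`.
      Blocked : E → Set
      Blocked b = c b ≡ sg 𝟘 × Primal (c [ b ≔ free ]) f s

      module _ (classify : ∀ h → h ≡ f ⊎ c h ≡ free ⊎ Blocked h) where

        -- The vector `X` has the sign `s` at `f` and meets the support of the cocircuit at most in
        -- `f` and `h`; orthogonality therefore forces the sign opposite to `X h`.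
        weight : ∀ h → h ≡ f ⊎ c h ≡ free ⊎ Blocked h → Sgn
        weight h (inj₁ _)                      = s
        weight h (inj₂ (inj₁ _))               = 𝟘
        weight h (inj₂ (inj₂ (_ , (X , _))))   = neg (X h)

        W : SignVec E
        W h = weight h (classify h)

        Wf : W f ≡ s
        Wf with classify f
        ... | inj₁ _ = refl
        ... | inj₂ (inj₁ p) with () ← trans (sym cf) p
        ... | inj₂ (inj₂ (p , _)) with refl ← trans (sym cf) p = contradiction refl s≢𝟘

        W-obeys : Obeying (dual ∘ c) W
        W-obeys h with classify h
        ... | inj₁ refl = subst (λ k → Obeys k s) (sym (trans (cong dual cf) (dual-sg s s≢𝟘))) (inj₂ refl)
        ... | inj₂ (inj₁ p) = obeys-𝟘 (dual (c h))
        ... | inj₂ (inj₂ (p , X , _)) = subst (λ k → Obeys (dual k) (neg (X h))) (sym p) tt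

        free⇒W : ∀ h → c h ≡ free → W h ≡ 𝟘
        free⇒W h p with c h | W-obeys h
        free⇒W h refl | free | inj₁ w = w
        free⇒W h refl | free | inj₂ w = w

        blocking : ∀ b → c b ≡ sg 𝟘 → b ≢ f →
                   ∃ λ X → 𝒞 X × X f ≡ s × X b ≢ 𝟘 × W b ≡ neg (X b) ×
                           (∀ h → h ≢ b → Obeys (c h) (X h))
        blocking b cb b≢f with classify b
        ... | inj₁ p = contradiction p b≢f
        ... | inj₂ (inj₁ p) with () ← trans (sym cb) p
        ... | inj₂ (inj₂ (_ , (X , x , o , Xf))) = X , x , Xf ,
            (λ Xb → none (X , x , (λ h → all h (h ≟ b) Xb) , Xf)) , refl , other
          where
          other : ∀ h → h ≢ b → Obeys (c h) (X h)
          other h h≢b = subst (λ k → Obeys k (X h)) (≔-other c b free h≢b) (o h)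
          all : ∀ h → Dec (h ≡ b) → X b ≡ 𝟘 → Obeys (c h) (X h)
          all h (yes refl) Xb = subst (Obeys (c h)) (sym Xb) (obeys-𝟘 (c h))
          all h (no h≢b)   _  = other h h≢b

        private
          null-off : ∀ {h} {X : SignVec E} → c h ≡ sg 𝟘 → Obeys (c h) (X h) → X h ≡ 𝟘
          null-off {h} {X} p o = [ id , id ]′ (subst (λ k → Obeys k (X h)) p o)

          -- The blocking vector of `b` has a negative product with `W` at `b`, while `X` has none,
          -- so the two are opposed at `b`. Eliminating `b` gives `f` the sign `s`, and the blocking
          -- vector brings no other element coloured `sg 𝟘` into the support.
          remove : ∀ {X} → 𝒞 X → (∀ h → X h · W h ≢ ⊖) → X f ≢ neg s →
                   ∀ b → c b ≡ sg 𝟘 → b ≢ f → X b ≢ 𝟘 →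
                   ∃ λ Z → 𝒞 Z × (∀ h → Z h · W h ≢ ⊖) × Z f ≡ s × Z b ≡ 𝟘 ×
                           (∀ h → c h ≡ sg 𝟘 → X h ≡ 𝟘 → Z h ≡ 𝟘)
          remove {X} x nonneg Xf b cb b≢f Xb
            with blocking b cb b≢f
          ... | V , v , Vf , Vb , Wb , o
            with exchange v x b f (opp (V b) (X b) (W b) Vb Xb Wb (nonneg b))
                   (s≢𝟘 ∘ trans (sym Vf)) (λ q → Xf (trans q (cong neg Vf)))
            where
            opp : ∀ v x w → v ≢ 𝟘 → x ≢ 𝟘 → w ≡ neg v → x · w ≢ ⊖ → Opposed v x
            opp = by-signs
          ... | Z , z , Zb , Zf , between = Z , z , nonneg′ , trans Zf Vf , Zb , vanish
            where
            vanishV : ∀ h → h ≢ b → c h ≡ sg 𝟘 → V h ≡ 𝟘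
            vanishV h h≢b ch = null-off {X = V} ch (o h h≢b)
            vanish : ∀ h → c h ≡ sg 𝟘 → X h ≡ 𝟘 → Z h ≡ 𝟘
            vanish h ch Xh with between h
            ... | inj₁ q = q
            ... | inj₂ (inj₂ q) = trans q Xh
            ... | inj₂ (inj₁ q) = trans q (vanishV h (λ { refl → Xb Xh }) ch)
            nonnegV : ∀ h → h ≢ b → V h · W h ≢ ⊖
            nonnegV h h≢b = obeys-dual (c h) (V h) (W h) (o h h≢b) (W-obeys h)
            nonneg′ : ∀ h → Z h · W h ≢ ⊖
            nonneg′ h with h ≟ b
            ... | yes refl rewrite Zb = λ ()
            ... | no h≢b with between h
            ...   | inj₁ q rewrite q = λ ()
            ...   | inj₂ (inj₁ q) rewrite q = nonnegV h h≢b
            ...   | inj₂ (inj₂ q) rewrite q = nonneg h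

          -- Once all elements coloured `sg 𝟘` are removed from the support, a primal solution is
          -- left, and there is none.
          clear : ∀ L X → 𝒞 X → (∀ h → X h · W h ≢ ⊖) → X f ≡ s →
                  (∀ h → c h ≡ sg 𝟘 → h ∈ L ⊎ X h ≡ 𝟘) → Absurd
          clear [] X x _ Xf p = none (X , x , obeying , Xf)
            where
            obeying : Obeying c X
            obeying h with classify h
            ... | inj₁ refl        = subst (λ k → Obeys k (X h)) (sym cf) (inj₂ Xf)
            ... | inj₂ (inj₁ ch)   = subst (λ k → Obeys k (X h)) (sym ch) tt
            ... | inj₂ (inj₂ (ch , _)) with p h ch
            ...   | inj₂ Xh = subst (Obeys (c h)) (sym Xh) (obeys-𝟘 (c h))
          clear (b ∷ L) X x nonneg Xf p = step (classify b)
            where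
            skip : (c b ≡ sg 𝟘 → X b ≡ 𝟘) → Absurd
            skip Xb = clear L X x nonneg Xf λ h ch → drop h ch (p h ch)
              where
              drop : ∀ h → c h ≡ sg 𝟘 → h ∈ b ∷ L ⊎ X h ≡ 𝟘 → h ∈ L ⊎ X h ≡ 𝟘
              drop h ch (inj₁ (here refl)) = inj₂ (Xb ch)
              drop h ch (inj₁ (there q))   = inj₁ q
              drop h ch (inj₂ q)           = inj₂ q
            f-coloured : c f ≢ sg 𝟘
            f-coloured q with refl ← trans (sym cf) q = s≢𝟘 refl
            step : b ≡ f ⊎ c b ≡ free ⊎ Blocked b → Absurd
            step (inj₁ refl) = skip (λ q → contradiction q f-coloured)
            step (inj₂ (inj₁ cb)) = skip λ q → contradiction (trans (sym cb) q) λ ()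
            step (inj₂ (inj₂ (cb , _))) with X b ≟ₛ 𝟘
            ... | yes Xb = skip (const Xb)
            ... | no  Xb with remove x nonneg (λ q → neg-fixed s s≢𝟘 (trans (sym Xf) q)) b cb
                                (λ { refl → f-coloured cb }) Xb
              where
              neg-fixed : ∀ s → s ≢ 𝟘 → s ≢ neg s
              neg-fixed = by-signs
            ...   | Z , z , nonneg′ , Zf , Zb , vanish =
              clear L Z z nonneg′ Zf λ h ch → drop h ch (p h ch)
              where
              drop : ∀ h → c h ≡ sg 𝟘 → h ∈ b ∷ L ⊎ X h ≡ 𝟘 → h ∈ L ⊎ Z h ≡ 𝟘
              drop h ch (inj₁ (here refl)) = inj₂ Zb
              drop h ch (inj₁ (there q))   = inj₁ q
              drop h ch (inj₂ q)           = inj₂ (vanish h ch q)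

          all-remaining : ∀ (X : SignVec E) h → c h ≡ sg 𝟘 → h ∈ elements ⊎ X h ≡ 𝟘
          all-remaining X h _ = inj₁ (complete h)

          impossible : ∀ X → 𝒞 X → (∀ h → X h · W h ≢ ⊖) → ∀ g → X g · W g ≢ ⊕
          impossible X x nonneg g g⊕ = step (g ≟ f) (classify g)
            where
            same : ∀ s x → s ≢ 𝟘 → x · s ≡ ⊕ → x ≡ s
            same = by-signs
            not-neg : ∀ s x → s ≢ 𝟘 → x · s ≢ ⊖ → x ≢ neg s
            not-neg = by-signs
            step : Dec (g ≡ f) → g ≡ f ⊎ c g ≡ free ⊎ Blocked g → Absurd
            step (yes refl) _ = clear elements X x nonneg
              (same s (X g) s≢𝟘 (subst (λ w → X g · w ≡ ⊕) Wf g⊕)) (all-remaining X)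
            step (no g≢f) (inj₁ g≡f) = g≢f g≡f
            step (no g≢f) (inj₂ (inj₁ cg))
              with () ← trans (sym g⊕) (trans (cong (X g ·_) (free⇒W g cg)) (·-zeroʳ (X g)))
            -- `X` may vanish at `f`; removing `g` with its blocking vector brings the sign `s` to
            -- `f`, after which `clear` applies.
            step (no g≢f) (inj₂ (inj₂ (cg , _)))
              with remove x nonneg
                     (not-neg s (X f) s≢𝟘 (subst (λ w → X f · w ≢ ⊖) Wf (nonneg f))) g cg g≢f
                     (λ Xg → contradiction (trans (sym g⊕) (cong (_· W g) Xg)) λ ())
            ... | Z , z , nonneg′ , Zf , _ = clear elements Z z nonneg′ Zf (all-remaining Z)

        cocircuit : Dual c f s
        cocircuit = W , perp-intro W impossible , W-obeys , Wf

    -- Greedily enlarges the set of free elements to a maximal one not spanning f.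
    grow : ∀ L c f s → s ≢ 𝟘 → c f ≡ sg s → ¬ Primal c f s →
           (∀ h → h ≡ f ⊎ c h ≡ free ⊎ (c h ≡ sg 𝟘 × (h ∈ L ⊎ Primal (c [ h ≔ free ]) f s))) →
           Dual c f s
    grow [] c f s s≢𝟘 cf none p = Cocircuit.cocircuit c f s s≢𝟘 cf none λ h →
      Sum.map₂ (Sum.map₂ (λ { (ch , inj₂ q) → ch , q })) (p h)
    grow (b ∷ L) c f s s≢𝟘 cf none p with primal? (c [ b ≔ free ]) f s
    ... | yes q = grow L c f s s≢𝟘 cf none λ h →
      Sum.map₂ (Sum.map₂ (λ (ch , r) → ch , still r)) (p h)
      where
      still : ∀ {h} → h ∈ b ∷ L ⊎ Primal (c [ h ≔ free ]) f s →
              h ∈ L ⊎ Primal (c [ h ≔ free ]) f s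
      still (inj₁ (here refl)) = inj₂ q
      still (inj₁ (there r))   = inj₁ r
      still (inj₂ r)           = inj₂ r
    ... | no ¬q with b ≟ f
    ...   | yes refl = grow L c f s s≢𝟘 cf none still
      where
      still : ∀ h → h ≡ f ⊎ c h ≡ free ⊎ (c h ≡ sg 𝟘 × (h ∈ L ⊎ Primal (c [ h ≔ free ]) f s))
      still h with p h
      ... | inj₁ r = inj₁ r
      ... | inj₂ (inj₁ r) = inj₂ (inj₁ r)
      ... | inj₂ (inj₂ (ch , inj₁ (here refl))) = inj₁ refl
      ... | inj₂ (inj₂ (ch , inj₁ (there r)))   = inj₂ (inj₂ (ch , inj₁ r))
      ... | inj₂ (inj₂ (ch , inj₂ r))           = inj₂ (inj₂ (ch , inj₂ r))
    ...   | no b≢f = weaken (grow L c′ f s s≢𝟘 (trans (≔-other c b free (b≢f ∘ sym)) cf) ¬q still)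
      where
      c′ = c [ b ≔ free ]
      still : ∀ h → h ≡ f ⊎ c′ h ≡ free ⊎ (c′ h ≡ sg 𝟘 × (h ∈ L ⊎ Primal (c′ [ h ≔ free ]) f s))
      still h with h ≟ b | p h
      ... | yes _ | _ = inj₂ (inj₁ refl)
      ... | no _ | inj₁ r = inj₁ r
      ... | no _ | inj₂ (inj₁ r) = inj₂ (inj₁ r)
      ... | no h≢b | inj₂ (inj₂ (ch , inj₁ (here r))) = contradiction r h≢b
      ... | no _   | inj₂ (inj₂ (ch , inj₁ (there r))) = inj₂ (inj₂ (ch , inj₁ r))
      ... | no h≢b | inj₂ (inj₂ (ch , inj₂ (X , x , o , Xf))) = inj₂ (inj₂ (ch , inj₂ (X , x , o′ , Xf)))
        where
        o′ : Obeying (c′ [ h ≔ free ]) X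
        o′ k with k ≟ h | o k
        ... | yes _ | _ = tt
        ... | no _  | r with k ≟ b
        ...   | yes _ = tt
        ...   | no _  = r
      weaken : Dual c′ f s → Dual c f s
      weaken (W , w , o , Wf) = W , w , o′ , Wf
        where
        o′ : Obeying (dual ∘ c) W
        o′ h with h ≟ b | o h
        ... | yes refl | inj₁ r rewrite r = obeys-𝟘 (dual (c h))
        ... | yes refl | inj₂ r rewrite r = obeys-𝟘 (dual (c h))
        ... | no _     | r = r

    signed-or-not : ∀ c → (c ≡ free ⊎ c ≡ sg 𝟘) ⊎ (∃ λ t → t ≢ 𝟘 × c ≡ sg t)
    signed-or-not free   = inj₁ (inj₁ refl)
    signed-or-not (sg ⊕) = inj₂ (⊕ , (λ ()) , refl)
    signed-or-not (sg ⊖) = inj₂ (⊖ , (λ ()) , refl)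
    signed-or-not (sg 𝟘) = inj₁ (inj₂ refl)

    -- Recolouring e by sg 𝟘 and by free, either a solution of one of the two
    -- problems is a solution for c, or the covector of the first and the vector
    -- of the second are both wrong at e, which contradicts their orthogonality.
    reduce : ∀ L c f s → s ≢ 𝟘 → c f ≡ sg s →
             (∀ h → h ≡ f ⊎ (c h ≡ free ⊎ c h ≡ sg 𝟘) ⊎ h ∈ L) →
             Primal c f s ⊎ Dual c f s
    reduce [] c f s s≢𝟘 cf p with primal? c f s
    ... | yes q = inj₁ q
    ... | no ¬q = inj₂ (grow elements c f s s≢𝟘 cf ¬q λ h → ready h (p h))
      where
      ready : ∀ h → h ≡ f ⊎ (c h ≡ free ⊎ c h ≡ sg 𝟘) ⊎ h ∈ [] →
              h ≡ f ⊎ c h ≡ free ⊎ (c h ≡ sg 𝟘 × (h ∈ elements ⊎ Primal (c [ h ≔ free ]) f s))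
      ready h (inj₁ r) = inj₁ r
      ready h (inj₂ (inj₁ (inj₁ r))) = inj₂ (inj₁ r)
      ready h (inj₂ (inj₁ (inj₂ r))) = inj₂ (inj₂ (r , inj₁ (complete h)))
    reduce (e ∷ L) c f s s≢𝟘 cf p with e ≟ f | signed-or-not (c e)
    ... | yes refl | _ = reduce L c f s s≢𝟘 cf λ h → skip h (p h)
      where
      skip : ∀ h → h ≡ f ⊎ (c h ≡ free ⊎ c h ≡ sg 𝟘) ⊎ h ∈ e ∷ L →
             h ≡ f ⊎ (c h ≡ free ⊎ c h ≡ sg 𝟘) ⊎ h ∈ L
      skip h (inj₁ r) = inj₁ r
      skip h (inj₂ (inj₁ r)) = inj₂ (inj₁ r)
      skip h (inj₂ (inj₂ (here r))) = inj₁ r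
      skip h (inj₂ (inj₂ (there r))) = inj₂ (inj₂ r)
    ... | no _ | inj₁ q = reduce L c f s s≢𝟘 cf λ h → skip h (p h)
      where
      skip : ∀ h → h ≡ f ⊎ (c h ≡ free ⊎ c h ≡ sg 𝟘) ⊎ h ∈ e ∷ L →
             h ≡ f ⊎ (c h ≡ free ⊎ c h ≡ sg 𝟘) ⊎ h ∈ L
      skip h (inj₁ r) = inj₁ r
      skip h (inj₂ (inj₁ r)) = inj₂ (inj₁ r)
      skip h (inj₂ (inj₂ (here refl))) = inj₂ (inj₁ q)
      skip h (inj₂ (inj₂ (there r))) = inj₂ (inj₂ r)
    ... | no e≢f | inj₂ (t , t≢𝟘 , ce) = combine
        (reduce L (c [ e ≔ sg 𝟘 ]) f s s≢𝟘 (cf′ (sg 𝟘)) (skip (sg 𝟘) (inj₂ refl)))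
        (reduce L (c [ e ≔ free ]) f s s≢𝟘 (cf′ free) (skip free (inj₁ refl)))
      where
      cf′ : ∀ k → (c [ e ≔ k ]) f ≡ sg s
      cf′ k = trans (≔-other c e k (e≢f ∘ sym)) cf
      skip : ∀ k → k ≡ free ⊎ k ≡ sg 𝟘 →
             ∀ h → h ≡ f ⊎ ((c [ e ≔ k ]) h ≡ free ⊎ (c [ e ≔ k ]) h ≡ sg 𝟘) ⊎ h ∈ L
      skip k kq h with h ≟ e | p h
      ... | yes _ | _ = inj₂ (inj₁ kq)
      ... | no _  | inj₁ r = inj₁ r
      ... | no _  | inj₂ (inj₁ r) = inj₂ (inj₁ r)
      ... | no h≢e | inj₂ (inj₂ (here r)) = contradiction r h≢e
      ... | no _  | inj₂ (inj₂ (there r)) = inj₂ (inj₂ r)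
      off : ∀ {X k} → Obeying (c [ e ≔ k ]) X → ∀ h → h ≢ e → Obeys (c h) (X h)
      off {X} {k} o h h≢e = subst (λ k → Obeys k (X h)) (≔-other c e k h≢e) (o h)
      off-dual : ∀ {W k} → Obeying (dual ∘ (c [ e ≔ k ])) W → ∀ h → h ≢ e → Obeys (dual (c h)) (W h)
      off-dual {W} {k} o h h≢e = subst (λ k → Obeys (dual k) (W h)) (≔-other c e k h≢e) (o h)
      glue : ∀ {P : E → Set} → P e → (∀ h → h ≢ e → P h) → ∀ h → P h
      glue {P} Pe P′ h with h ≟ e
      ... | yes refl = Pe
      ... | no h≢e   = P′ h h≢e
      wrong : ∀ t x w → t ≢ 𝟘 → ¬ x ≼ t → ¬ w ≼ t → x · w ≢ ⊖
      wrong = by-signs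
      combine : Primal (c [ e ≔ sg 𝟘 ]) f s ⊎ Dual (c [ e ≔ sg 𝟘 ]) f s →
                Primal (c [ e ≔ free ]) f s ⊎ Dual (c [ e ≔ free ]) f s →
                Primal c f s ⊎ Dual c f s
      combine (inj₁ (X , x , o , Xf)) _ = inj₁ (X , x , glue {λ h → Obeys (c h) (X h)} at-e (off o) , Xf)
        where
        at-e : Obeys (c e) (X e)
        at-e with subst (λ k → Obeys k (X e)) (≔-same c e (sg 𝟘)) (o e)
        ... | inj₁ r rewrite r = obeys-𝟘 (c e)
        ... | inj₂ r rewrite r = obeys-𝟘 (c e)
      combine _ (inj₂ (W , w , o , Wf)) =
        inj₂ (W , w , glue {λ h → Obeys (dual (c h)) (W h)} at-e (off-dual o) , Wf)
        where
        at-e : Obeys (dual (c e)) (W e)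
        at-e with subst (λ k → Obeys (dual k) (W e)) (≔-same c e free) (o e)
        ... | inj₁ r rewrite r = obeys-𝟘 (dual (c e))
        ... | inj₂ r rewrite r = obeys-𝟘 (dual (c e))
      combine (inj₂ (W , w , oW , Wf)) (inj₁ (X , x , oX , Xf)) with X e ≼? t | W e ≼? t
      ... | yes q | _ = inj₁ (X , x , glue {λ h → Obeys (c h) (X h)}
        (subst (λ k → Obeys k (X e)) (sym ce) q) (off oX) , Xf)
      ... | no _ | yes q = inj₂ (W , w , glue {λ h → Obeys (dual (c h)) (W h)}
        (subst (λ k → Obeys (dual k) (W e)) (sym ce)
          (subst (λ k → Obeys k (W e)) (sym (dual-sg t t≢𝟘)) q)) (off-dual oW) , Wf)
      ... | no ¬q | no ¬r = contradiction f⊕ (⊥-nonneg-contra X W (w X x)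
        (glue {λ h → X h · W h ≢ ⊖} (wrong t (X e) (W e) t≢𝟘 ¬q ¬r)
              (λ h h≢e → obeys-dual (c h) (X h) (W h) (off oX h h≢e) (off-dual oW h h≢e))) f)
        where
        f⊕ : X f · W f ≡ ⊕
        f⊕ rewrite Xf | Wf = ·-self s s≢𝟘

  -- Minty's colouring property for oriented matroids, which here takes the place of Farkas' lemma.
  painting : ∀ c f s → s ≢ 𝟘 → c f ≡ sg s → Primal c f s ⊎ Dual c f s
  painting c f s s≢𝟘 cf = reduce elements c f s s≢𝟘 cf λ h → inj₂ (inj₂ (complete h))

-- Strong circuit elimination

oneOf-≼ : ∀ z x y → ¬ Opposed x y → OneOf z x y → z ≼ x ▹ y
oneOf-≼ = by-signs

module Circuits {E : Set} (_≟_ : DecidableEquality E)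
                (elements : List E) (complete : ∀ e → e ∈ elements)
                (M : OrientedMatroid E) where

  open Finite _≟_ elements complete
  open OrientedMatroid M

  private
    Within : List E → SignVec E → Set
    Within D X = ∀ h → X h ≢ 𝟘 → h ∈ D

    within-oneOf : ∀ {D} {X Y Z : SignVec E} → Within D X → Within D Y →
                   (∀ h → OneOf (Z h) (X h) (Y h)) → Within D Z
    within-oneOf X⊆ Y⊆ between h Zh with between h
    ... | inj₁ q        = contradiction q Zh
    ... | inj₂ (inj₁ q) = X⊆ h (Zh ∘ trans q)
    ... | inj₂ (inj₂ q) = Y⊆ h (Zh ∘ trans q)

    within-neg : ∀ {D X} → Within D X → Within D (-ᵥ X)
    within-neg X⊆ h q = X⊆ h λ Xh → q (cong neg Xh)

    infixl 7 _∖_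

    _∖_ : List E → E → List E
    D ∖ e = filter (λ h → ¬? (h ≟ e)) D

    ∖-shorter : ∀ D e → e ∈ D → length (D ∖ e) < length D
    ∖-shorter D e e∈D = List.filter-notAll (λ h → ¬? (h ≟ e)) D (Any.map (λ { refl h≢e → h≢e refl }) e∈D)

    within-∖ : ∀ {D X e} → Within D X → X e ≡ 𝟘 → Within (D ∖ e) X
    within-∖ X⊆ Xe h Xh = ∈-filter⁺ (λ h → ¬? (h ≟ _)) (X⊆ h Xh) (λ { refl → Xh Xe })

    ∖-zero : ∀ {D X e} → Within (D ∖ e) X → X e ≡ 𝟘
    ∖-zero {D} {X} {e} X⊆ with X e ≟ₛ 𝟘
    ... | yes q = q
    ... | no q  = contradiction refl (proj₂ (∈-filter⁻ (λ h → ¬? (h ≟ e)) {xs = D} (X⊆ e q)))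

    ∖-within : ∀ {D X e} → Within (D ∖ e) X → Within D X
    ∖-within {D} {e = e} X⊆ h Xh = proj₁ (∈-filter⁻ (λ h → ¬? (h ≟ e)) {xs = D} (X⊆ h Xh))

    Exchanged : SignVec E → SignVec E → E → E → Set
    Exchanged X Y e f = ∃ λ Z → Circuit Z × Z e ≡ 𝟘 × Z f ≡ X f × (∀ h → OneOf (Z h) (X h) (Y h))

    Strong : List E → Set
    Strong D = ∀ {X Y} → Circuit X → Circuit Y → Within D X → Within D Y →
               ∀ e f → Opposed (X e) (Y e) → X f ≢ 𝟘 → Y f ≢ neg (X f) → Exchanged X Y e f

    family : ∀ D → Strong D → IsExchangeFamily (λ X → Circuit X × Within D X)
    family D strong = record
      { resp = λ eq (x , X⊆) → resp eq x , λ h q → X⊆ h (q ∘ trans (sym (eq h)))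
      ; _∈? = λ X → circuit? X ×-dec ∀-element? (λ h → ¬? (X h ≟ₛ 𝟘) →-dec any? (h ≟_) D)
      ; negate = λ (x , X⊆) → symmetric x , within-neg X⊆
      ; exchange = λ (x , X⊆) (y , Y⊆) e f op Xf Yf →
          let (Z , z , Ze , Zf , between) = strong x y X⊆ Y⊆ e f op Xf Yf
          in Z , (z , within-oneOf X⊆ Y⊆ between) , Ze , Zf , between
      }

    weak : ∀ {X Y} → Circuit X → Circuit Y → ¬ X ≗ (-ᵥ Y) → ∀ e → Opposed (X e) (Y e) →
           ∃ λ Z → Circuit Z × Z e ≡ 𝟘 × (∀ h → OneOf (Z h) (X h) (Y h))
    weak {X} {Y} x y X≉-Y e (Xe , op) = byCases (X e) (Y e) refl refl Xe op
      where
      between : ∀ (X Y Z : SignVec E) → (∀ f → Z f ≡ ⊕ → X f ≡ ⊕ ⊎ Y f ≡ ⊕) → (∀ f → Z f ≡ ⊖ → X f ≡ ⊖ ⊎ Y f ≡ ⊖) →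
                ∀ h → OneOf (Z h) (X h) (Y h)
      between X Y Z p m h with Z h in eq
      ... | 𝟘 = inj₁ refl
      ... | ⊕ = inj₂ (Sum.map sym sym (p h eq))
      ... | ⊖ = inj₂ (Sum.map sym sym (m h eq))
      swap : ∀ {Z : SignVec E} → (∀ h → OneOf (Z h) (Y h) (X h)) → ∀ h → OneOf (Z h) (X h) (Y h)
      swap b h = Sum.map₂ Sum.swap (b h)
      byCases : ∀ s t → X e ≡ s → Y e ≡ t → s ≢ 𝟘 → s ≡ neg t →
                ∃ λ Z → Circuit Z × Z e ≡ 𝟘 × (∀ h → OneOf (Z h) (X h) (Y h))
      byCases ⊕ ⊖ Xe Ye _ _ with eliminate x y X≉-Y e Xe Ye
      ... | Z , z , Ze , p , m = Z , z , Ze , between X Y Z p m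
      byCases ⊖ ⊕ Xe Ye _ _
        with eliminate y x (λ eq → X≉-Y λ h → trans (sym (neg-neg (X h))) (cong neg (sym (eq h)))) e Ye Xe
      ... | Z , z , Ze , p , m = Z , z , Ze , swap {Z} (between Y X Z p m)
      byCases 𝟘 _ _ _ s≢𝟘 _ = contradiction refl s≢𝟘

    -- An exchange is a vector obeying the colouring that frees the elements at
    -- which X and Y are opposed.  If a covector W of the deletion of e excludes
    -- it, weak elimination gives Z₀ with g in its support outside that of X, and
    -- W extends, away from e and g, to a covector U of the deletion of g.  Now U
    -- takes the sign of Y at e, so that it is not orthogonal to the circuit
    -- obtained by removing g from Y with the help of -Z₀.
    module Step (D : List E) (X Y : SignVec E) (x : Circuit X) (y : Circuit Y)
                (X⊆ : Within D X) (Y⊆ : Within D Y) (e f : E)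
                (op : Opposed (X e) (Y e)) (Xf : X f ≢ 𝟘) (Yf : Y f ≢ neg (X f))
                (smaller : ∀ e → e ∈ D → Strong (D ∖ e))
                (remove : ∀ Z → Circuit Z → Within D Z → Z e ≡ 𝟘 → Z f ≡ 𝟘 →
                          ∀ g → Opposed (Y g) (neg (Z g)) → Exchanged Y (-ᵥ Z) g e) where

      e∈D : e ∈ D
      e∈D = X⊆ e (proj₁ op)

      T : SignVec E
      T = X ▹ᵥ Y

      f-kept : ¬ Opposed (X f) (Y f) × T f ≡ X f
      f-kept = unopposed (X f) (Y f) Xf Yf

      f≢e : f ≢ e
      f≢e refl = proj₁ f-kept op

      c₁ : E → Colour
      c₁ h with opposed? (X h) (Y h)
      ... | yes _ = free
      ... | no _  = sg (T h)

      c₁-f : c₁ f ≡ sg (X f)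
      c₁-f with opposed? (X f) (Y f)
      ... | yes q = contradiction q (proj₁ f-kept)
      ... | no _  = cong sg (proj₂ f-kept)

      c₁-oneOf : ∀ z h → Obeys (c₁ h) z → OneOf z (X h) (Y h)
      c₁-oneOf z h with opposed? (X h) (Y h)
      ... | yes q = λ _ → any-sign z (X h) (Y h) q
        where
        any-sign : ∀ z x y → Opposed x y → OneOf z x y
        any-sign = by-signs
      ... | no _ = one z (X h) (Y h)
        where
        one : ∀ z x y → z ≼ x ▹ y → OneOf z x y
        one = by-signs

      oneOf-c₁ : ∀ z h → OneOf z (X h) (Y h) → Obeys (c₁ h) z
      oneOf-c₁ z h with opposed? (X h) (Y h)
      ... | yes _ = λ _ → tt
      ... | no q  = oneOf-≼ z (X h) (Y h) q

      nonneg : ∀ z w h → OneOf z (X h) (Y h) → Obeys (dual (c₁ h)) w → z · w ≢ ⊖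
      nonneg z w h b o = obeys-dual (c₁ h) z w (oneOf-c₁ z h b) o

      module P₁ = Painting _≟_ elements complete (family (D ∖ e) (smaller e e∈D))

      weakly : ∃ λ Z → Circuit Z × Z e ≡ 𝟘 × (∀ h → OneOf (Z h) (X h) (Y h))
      weakly = weak x y
        (λ eq → Yf (trans (sym (neg-neg (Y f))) (cong neg (sym (eq f))))) e op

      outside : ∀ Z → Circuit Z → Z e ≡ 𝟘 → ∃ λ g → Z g ≢ 𝟘 × X g ≡ 𝟘
      outside Z z Ze with ∃-element? (λ g → ¬? (Z g ≟ₛ 𝟘) ×-dec (X g ≟ₛ 𝟘))
      ... | yes q = q
      ... | no ¬q with incomparable z x (λ {g} Zg Xg → ¬q (g , Zg , Xg))
      ...   | inj₁ eq = contradiction (trans (sym (eq e)) Ze) (proj₁ op)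
      ...   | inj₂ eq = contradiction (neg≡𝟘 (X e) (trans (sym (eq e)) Ze)) (proj₁ op)

      module _ (W : SignVec E) (W⊥ : ∀ Z → Circuit Z × Within (D ∖ e) Z → Z ⊥ W)
               (W-obeys : ∀ h → Obeys (dual (c₁ h)) (W h)) (Wf : W f ≡ X f)
               (Z₀ : SignVec E) (z₀ : Circuit Z₀) (Z₀e : Z₀ e ≡ 𝟘) (Z₀f : Z₀ f ≡ 𝟘)
               (between : ∀ h → OneOf (Z₀ h) (X h) (Y h))
               (g : E) (Z₀g : Z₀ g ≢ 𝟘) (Xg : X g ≡ 𝟘) where

        Z₀⊆ : Within D Z₀
        Z₀⊆ = within-oneOf X⊆ Y⊆ between

        -- `Z₀` avoids `e`, so it is orthogonal to `W`; taking its signs from `X` and `Y`, it has no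
        -- negative product with `W`, so that all products vanish.
        Z₀W : ∀ h → Z₀ h ≢ 𝟘 → W h ≡ 𝟘
        Z₀W h q = ·-cancelˡ (Z₀ h) (W h) q (⊥-nonneg Z₀ W (W⊥ Z₀ (z₀ , within-∖ {D} {Z₀} Z₀⊆ Z₀e))
          (λ k → nonneg (Z₀ k) (W k) k (between k) (W-obeys k)) h)

        c₂ : E → Colour
        c₂ h with h ≟ e | Z₀ h ≟ₛ 𝟘
        ... | yes _ | _     = sg 𝟘
        ... | no _  | no _  = free
        ... | no _  | yes _ = c₁ h

        c₂-f : c₂ f ≡ sg (X f)
        c₂-f with f ≟ e | Z₀ f ≟ₛ 𝟘
        ... | yes q | _     = contradiction q f≢e
        ... | no _  | yes _ = c₁-f
        ... | no _  | no q  = contradiction Z₀f q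

        module P₂ = Painting _≟_ elements complete (family (D ∖ g) (smaller g (Z₀⊆ g Z₀g)))

        -- Such a vector avoids `e`, and `W` vanishes where `c₂` is free; thus `f` would carry an
        -- unbalanced positive product with `W`.
        no-primal : ¬ P₂.Primal c₂ f (X f)
        no-primal (V , (v , V⊆) , V-obeys , Vf) = ⊥-nonneg-contra V W
          (W⊥ V (v , within-∖ {D} {V} (∖-within {D} {V} V⊆) Ve)) VW f
          (trans (cong₂ _·_ Vf Wf) (·-self (X f) Xf))
          where
          Ve : V e ≡ 𝟘
          Ve with e ≟ e | V-obeys e
          ... | yes _ | q = [ id , id ]′ q
          ... | no q  | _ = contradiction refl q
          VW : ∀ h → V h · W h ≢ ⊖
          VW h with h ≟ e | Z₀ h ≟ₛ 𝟘 | V-obeys h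
          ... | yes refl | _ | _ rewrite Ve = λ ()
          ... | no _ | no q | _ rewrite Z₀W h q | ·-zeroʳ (V h) = λ ()
          ... | no _ | yes _ | o = obeys-dual (c₁ h) (V h) (W h) o (W-obeys h)

        no-dual : ¬ P₂.Dual c₂ f (X f)
        no-dual (U , U⊥ , U-obeys , Uf) with remove Z₀ z₀ Z₀⊆ Z₀e Z₀f g Yg
          where
          Yg : Opposed (Y g) (neg (Z₀ g))
          Yg = at (Z₀ g) (X g) (Y g) Z₀g Xg (between g)
            where
            at : ∀ z x y → z ≢ 𝟘 → x ≡ 𝟘 → OneOf z x y → Opposed y (neg z)
            at = by-signs
        ... | Y′ , y′ , Y′g , Y′e , between′ = ⊥-nonneg-contra Y′ U
          (U⊥ Y′ (y′ , within-∖ {D} {Y′} (within-oneOf {D} {Y} {_} {Y′} Y⊆ (within-neg {D} {Z₀} Z₀⊆) between′) Y′g))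
          Y′U e Y′Ue
          where
          UZ₀ : ∀ h → h ≢ e → Z₀ h ≢ 𝟘 → U h ≡ 𝟘
          UZ₀ h h≢e q with h ≟ e | Z₀ h ≟ₛ 𝟘 | U-obeys h
          ... | yes r | _ | _ = contradiction r h≢e
          ... | no _ | no _ | o = [ id , id ]′ o
          ... | no _ | yes r | _ = contradiction r q
          U-obeys₁ : ∀ h → h ≢ e → Obeys (dual (c₁ h)) (U h)
          U-obeys₁ h h≢e with h ≟ e | Z₀ h ≟ₛ 𝟘 | U-obeys h
          ... | yes r | _ | _ = contradiction r h≢e
          ... | no _ | no _ | inj₁ q rewrite q = obeys-𝟘 (dual (c₁ h))
          ... | no _ | no _ | inj₂ q rewrite q = obeys-𝟘 (dual (c₁ h))
          ... | no _ | yes r | o = o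
          -- `X` avoids `g`, so it is orthogonal to `U`. Its product with `U` is positive at `f` and
          -- can be negative only at `e`.
          XUe : X e · U e ≡ ⊖
          XUe = ⊥-forced X U (U⊥ X (x , within-∖ {D} {X} X⊆ Xg)) e
            (λ h h≢e → nonneg (X h) (U h) h (inj₂ (inj₁ refl)) (U-obeys₁ h h≢e)) f
            (trans (cong (X f ·_) Uf) (·-self (X f) Xf))
          Y′Ue : Y′ e · U e ≡ ⊕
          Y′Ue rewrite Y′e = flip-sign (X e) (Y e) (U e) op XUe
            where
            flip-sign : ∀ x y u → Opposed x y → x · u ≡ ⊖ → y · u ≡ ⊕
            flip-sign = by-signs
          Y′U : ∀ h → Y′ h · U h ≢ ⊖
          Y′U h with h ≟ e
          ... | yes refl rewrite Y′Ue = λ ()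
          ... | no h≢e with Z₀ h ≟ₛ 𝟘
          ...   | no q rewrite UZ₀ h h≢e q | ·-zeroʳ (Y′ h) = λ ()
          ...   | yes q = nonneg (Y′ h) (U h) h (weaken (between′ h)) (U-obeys₁ h h≢e)
            where
            weaken : OneOf (Y′ h) (Y h) (neg (Z₀ h)) → OneOf (Y′ h) (X h) (Y h)
            weaken (inj₁ r) = inj₁ r
            weaken (inj₂ (inj₁ r)) = inj₂ (inj₂ r)
            weaken (inj₂ (inj₂ r)) = inj₁ (trans r (cong neg q))

        impossible : Absurd
        impossible = [ no-primal , no-dual ]′ (P₂.painting c₂ f (X f) Xf c₂-f)

      exchanged : Exchanged X Y e f
      exchanged with P₁.painting c₁ f (X f) Xf c₁-f
      ... | inj₁ (Z , (z , Z⊆) , Z-obeys , Zf) =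
        Z , z , ∖-zero {D} {Z} Z⊆ , Zf , λ h → c₁-oneOf (Z h) h (Z-obeys h)
      ... | inj₂ (W , W⊥ , W-obeys , Wf) with weakly
      ...   | Z , z , Ze , between with Z f ≟ₛ X f
      ...     | yes Zf = Z , z , Ze , Zf , between
      ...     | no Zf with outside Z z Ze
      ...       | g , Zg , Xg = contradiction
        (impossible W W⊥ W-obeys Wf Z z Ze (lost (Z f) (X f) (Y f) Zf Xf Yf (between f)) between g Zg Xg)
        λ ()
        where
        lost : ∀ z x y → z ≢ x → x ≢ 𝟘 → y ≢ neg x → OneOf z x y → z ≡ 𝟘
        lost = by-signs

    -- Induction on the length of `D`: painting in the restrictions to `D` without one element, as
    -- used in `Step`, needs strong elimination there.
    strong : ∀ k D → length D ≤ k → Strong D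
    strong zero    []      _ _ _ X⊆ _ _ f _ Xf _ with () ← X⊆ f Xf
    strong (suc k) D len = general
      where
      smaller : ∀ e → e ∈ D → Strong (D ∖ e)
      smaller e e∈D = strong k (D ∖ e) (ℕ.≤-pred (ℕ.≤-trans (∖-shorter D e e∈D) len))

      neg-kept : ∀ y z → y ≢ 𝟘 → z ≡ 𝟘 → neg z ≢ neg y
      neg-kept = by-signs

      -- If `Y` avoids `f`, the removal that `Step` asks for takes place without `f`, where
      -- induction applies. In the general case it has to preserve the sign of `Y` at `e`, where `Z`
      -- vanishes, and this is the special case with other names.
      special : ∀ {X Y} → Circuit X → Circuit Y → Within D X → Within D Y →
                ∀ e f → Opposed (X e) (Y e) → X f ≢ 𝟘 → Y f ≡ 𝟘 → Exchanged X Y e f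
      special {X} {Y} x y X⊆ Y⊆ e f op Xf Yf =
        Step.exchanged D X Y x y X⊆ Y⊆ e f op Xf (λ q → Xf (neg≡𝟘 (X f) (trans (sym q) Yf))) smaller remove
        where
        remove : ∀ Z → Circuit Z → Within D Z → Z e ≡ 𝟘 → Z f ≡ 𝟘 →
                 ∀ g → Opposed (Y g) (neg (Z g)) → Exchanged Y (-ᵥ Z) g e
        remove Z z Z⊆ Ze Zf g op′ = smaller f (X⊆ f Xf) y (symmetric z)
          (within-∖ {D} {Y} Y⊆ Yf) (within-neg {D ∖ f} {Z} (within-∖ {D} {Z} Z⊆ Zf)) g e op′ Ye
          (neg-kept (Y e) (Z e) Ye Ze)
          where
          Ye : Y e ≢ 𝟘
          Ye = proj₁ (opposed-sym (X e) (Y e) op)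

      general : Strong D
      general {X} {Y} x y X⊆ Y⊆ e f op Xf Yf =
        Step.exchanged D X Y x y X⊆ Y⊆ e f op Xf Yf smaller remove
        where
        remove : ∀ Z → Circuit Z → Within D Z → Z e ≡ 𝟘 → Z f ≡ 𝟘 →
                 ∀ g → Opposed (Y g) (neg (Z g)) → Exchanged Y (-ᵥ Z) g e
        remove Z z Z⊆ Ze Zf g op′ = special y (symmetric z) Y⊆ (within-neg {D} {Z} Z⊆) g e op′
          (proj₁ (opposed-sym (X e) (Y e) op)) (cong neg Ze)

  circuits : IsExchangeFamily Circuit
  circuits = record
    { resp = resp ; _∈? = circuit? ; negate = symmetric
    ; exchange = λ x y e f → strong (length elements) elements ℕ.≤-refl x y
        (λ h _ → complete h) (λ h _ → complete h) e f
    }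

-- Duality

module Covectors {E : Set} (_≟_ : DecidableEquality E)
                 (elements : List E) (complete : ∀ e → e ∈ elements) where

  open Finite _≟_ elements complete

  module _ {𝓛 : Pred (SignVec E) 0ℓ} (null : 𝓛 (const 𝟘))
           (compose : ∀ {X Y} → 𝓛 X → 𝓛 Y → 𝓛 (X ▹ᵥ Y)) where

    obeys-▹ : ∀ c x y → Obeys c x → Obeys c y → Obeys c (x ▹ y)
    obeys-▹ free   x y _ _ = tt
    obeys-▹ (sg s) x y = conformal s x y
      where
      conformal : ∀ s x y → x ≼ s → y ≼ s → x ▹ y ≼ s
      conformal = by-signs

    -- All the given covectors obey the same colouring, so that composing them destroys no sign
    -- already attained.
    assemble : ∀ (c : E → Colour) →
               (∀ f s → s ≢ 𝟘 → c f ≡ sg s → ∃ λ W → 𝓛 W × (∀ h → Obeys (c h) (W h)) × W f ≡ s) →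
               ∃ λ W → 𝓛 W × (∀ h → Obeys (c h) (W h)) × (∀ f s → c f ≡ sg s → W f ≡ s)
    assemble c hits with go elements
      where
      go : ∀ L → ∃ λ W → 𝓛 W × (∀ h → Obeys (c h) (W h)) × (∀ f s → f ∈ L → s ≢ 𝟘 → c f ≡ sg s → W f ≡ s)
      go [] = const 𝟘 , null , (λ h → obeys-𝟘 (c h)) , λ f s ()
      go (e ∷ L) with go L | c e in ce
      ... | W , w , o , hit | free = W , w , o , hit′
        where
        hit′ : ∀ f s → f ∈ e ∷ L → s ≢ 𝟘 → c f ≡ sg s → W f ≡ s
        hit′ f s (here refl) _ cf with () ← trans (sym ce) cf
        hit′ f s (there f∈L) = hit f s f∈L
      ... | W , w , o , hit | sg t with t ≟ₛ 𝟘
      ...   | yes refl = W , w , o , hit′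
        where
        hit′ : ∀ f s → f ∈ e ∷ L → s ≢ 𝟘 → c f ≡ sg s → W f ≡ s
        hit′ f s (here refl) s≢𝟘 cf with refl ← trans (sym ce) cf = contradiction refl s≢𝟘
        hit′ f s (there f∈L) = hit f s f∈L
      ...   | no t≢𝟘 with hits e t t≢𝟘 ce
      ...     | V , v , o′ , Ve = V ▹ᵥ W , compose v w , (λ h → obeys-▹ (c h) (V h) (W h) (o′ h) (o h)) , hit′
        where
        keepˡ : ∀ v w s → s ≢ 𝟘 → v ≡ s → v ▹ w ≡ s
        keepˡ = by-signs
        keepʳ : ∀ v w s → v ≼ s → w ≡ s → v ▹ w ≡ s
        keepʳ = by-signs
        hit′ : ∀ f s → f ∈ e ∷ L → s ≢ 𝟘 → c f ≡ sg s → (V ▹ᵥ W) f ≡ s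
        hit′ f s (here refl) s≢𝟘 cf with refl ← trans (sym ce) cf = keepˡ (V f) (W f) s s≢𝟘 Ve
        hit′ f s (there f∈L) s≢𝟘 cf = keepʳ (V f) (W f) s
          (subst (λ k → Obeys k (V f)) cf (o′ f)) (hit f s f∈L s≢𝟘 cf)
    ... | W , w , o , hit = W , w , o , hit′
      where
      hit′ : ∀ f s → c f ≡ sg s → W f ≡ s
      hit′ f s cf with s ≟ₛ 𝟘
      ... | yes refl = [ id , id ]′ (subst (λ k → Obeys k (W f)) cf (o f))
      ... | no s≢𝟘   = hit f s (complete f) s≢𝟘 cf

  module _ {𝓛 : Pred (SignVec E) 0ℓ} (covectors : IsCovectorFamily 𝓛) where

    open IsCovectorFamily covectors

    -- A sign vector that is not in 𝓛 cannot be composed of elements of 𝓛, so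
    -- that by painting it fails to be orthogonal to some vector.
    perp-perp : ∀ W → Perp (Perp 𝓛) W → 𝓛 W
    perp-perp W w⊥ with assemble null compose (sg ∘ W) hits
      where
      open Painting _≟_ elements complete (exchangeFamily covectors)
      dual-pos : ∀ s x → s ≢ 𝟘 → x ≡ s → x · s ≡ ⊕
      dual-pos s x s≢𝟘 refl = ·-self s s≢𝟘
      hits : ∀ f s → s ≢ 𝟘 → sg (W f) ≡ sg s → ∃ λ V → 𝓛 V × (∀ h → V h ≼ W h) × V f ≡ s
      hits f _ s≢𝟘 refl with painting (sg ∘ W) f (W f) s≢𝟘 refl
      ... | inj₁ q = q
      ... | inj₂ (X , x , o , Xf) = contradiction (dual-pos (W f) (X f) s≢𝟘 Xf)
        (⊥-nonneg-contra X W (w⊥ X x)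
          (λ h → obeys-dual-sg (W h) (X h) (o h)) f)
    ... | V , v , _ , hit = resp (λ h → hit h (W h) refl) v

  module _ {𝒞 : Pred (SignVec E) 0ℓ} (family : IsExchangeFamily 𝒞) where

    open IsExchangeFamily family
    open Painting _≟_ elements complete family

    -- The dual alternative of painting would be a covector that agrees with `X` at `f` and is
    -- nowhere opposed to it, contrary to orthogonality.
    below : ∀ X → Perp (Perp 𝒞) X → ∀ f → X f ≢ 𝟘 →
            ∃ λ Y → 𝒞 Y × Y f ≡ X f × (∀ h → Y h ≼ X h)
    below X x f Xf with painting (sg ∘ X) f (X f) Xf refl
    ... | inj₁ (Y , y , o , Yf) = Y , y , Yf , o
    ... | inj₂ (W , w , o , Wf) = contradiction (trans (cong (_· X f) Wf) (·-self (X f) Xf))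
      (⊥-nonneg-contra W X (x W w)
        (λ h → obeys-dual-sg (X h) (W h) (o h)) f)

    perp-covectors : IsCovectorFamily (Perp 𝒞)
    perp-covectors = record
      { resp = λ {V} {W} eq w X x → ⊥-resp {X = X} {X} {V} {W} (λ _ → refl) eq (w X x)
      ; _∈? = perp?
      ; null = perp-null
      ; negate = λ {W} w X x → ⊥-negʳ X W (w X x)
      ; compose = λ {V} {W} → perp-▹ {V} {W}
      ; eliminate = λ {V} {W} → perp-eliminate V W
      }
      where
      perp-null : Perp 𝒞 (const 𝟘)
      perp-null X _ = inj₁ λ e → ·-zeroʳ (X e)
      perp-▹ : ∀ {V W} → Perp 𝒞 V → Perp 𝒞 W → Perp 𝒞 (V ▹ᵥ W)
      perp-▹ {V} {W} v w X x with v X x | w X x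
      ... | inj₂ ((e , p) , (f , m)) | _ = inj₂ ((e , keep (X e) (V e) (W e) (λ ()) p) ,
                                                  (f , keep (X f) (V f) (W f) (λ ()) m))
        where
        keep : ∀ x v w {s} → s ≢ 𝟘 → x · v ≡ s → x · (v ▹ w) ≡ s
        keep x v w s≢𝟘 refl = absorb x v w s≢𝟘
          where
          absorb : ∀ x v w → x · v ≢ 𝟘 → x · (v ▹ w) ≡ x · v
          absorb = by-signs
      ... | inj₁ z | w⊥ = Sum.map
          (λ z′ e → trans (skip (X e) (V e) (W e) (z e)) (z′ e))
          (λ ((e , p) , (f , m)) →
            (e , trans (skip (X e) (V e) (W e) (z e)) p) , (f , trans (skip (X f) (V f) (W f) (z f)) m)) w⊥
        where
        skip : ∀ x v w → x · v ≡ 𝟘 → x · (v ▹ w) ≡ x · w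
        skip = by-signs

      module Eliminate (V W : SignVec E) (v : Perp 𝒞 V) (w : Perp 𝒞 W) (e : E)
                       (op : Opposed (V e) (W e)) where

        -- The colouring obeyed by the vectors excluding an elimination of e.
        c : E → Colour
        c h with h ≟ e | opposed? (V h) (W h)
        ... | yes _ | _     = free
        ... | no _  | yes _ = sg 𝟘
        ... | no _  | no _  = dual (sg (V h ▹ W h))

        dual-dual : ∀ s → dual (dual (sg s)) ≡ sg s
        dual-dual ⊕ = refl
        dual-dual ⊖ = refl
        dual-dual 𝟘 = refl

        one-sided : ∀ x v w → ¬ Opposed v w → x · (v ▹ w) ≢ ⊖ → x · v ≢ ⊖ × x · w ≢ ⊖
        one-sided = by-signs

        -- Off `e`, the products of `X` with `V` and with `W` are not negative. A positive one at
        -- `f` must be balanced at `e`; as `V` and `W` are opposed there, the other covector has a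
        -- positive product at `e` that nothing balances.
        no-primal : ∀ f s → s ≢ 𝟘 → dual (c f) ≡ sg s → ¬ Primal c f s
        no-primal f s s≢𝟘 cf (X , x , o , Xf) with target f cf
          where
          target : ∀ f → dual (c f) ≡ sg s → f ≢ e × ¬ Opposed (V f) (W f) × V f ▹ W f ≡ s
          target f cf with f ≟ e | opposed? (V f) (W f)
          target f refl | yes _  | _     = contradiction refl s≢𝟘
          target f ()   | no f≢e | yes _
          target f cf   | no f≢e | no q  = f≢e , q , inj (trans (sym (dual-dual (V f ▹ W f))) cf)
            where
            inj : ∀ {s t} → sg s ≡ sg t → s ≡ t
            inj refl = refl
        ... | f≢e , notop , T = conclude (hit (X f) (V f) (W f) s s≢𝟘 Xf T notop)
          where
          sided : ∀ h → h ≢ e → X h · V h ≢ ⊖ × X h · W h ≢ ⊖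
          sided h h≢e with h ≟ e | opposed? (V h) (W h) | o h
          ... | yes q | _ | _ = contradiction q h≢e
          ... | no _ | yes _ | inj₁ q rewrite q = (λ ()) , (λ ())
          ... | no _ | yes _ | inj₂ q rewrite q = (λ ()) , (λ ())
          ... | no _ | no q | r = one-sided (X h) (V h) (W h) q (obeys-dual-sg (V h ▹ W h) (X h) r)
          hit : ∀ x v w s → s ≢ 𝟘 → x ≡ s → v ▹ w ≡ s → ¬ Opposed v w → x · v ≡ ⊕ ⊎ x · w ≡ ⊕
          hit = by-signs
          opposite-sign : ∀ x v w → Opposed v w → x · v ≡ ⊖ → x · w ≡ ⊕
          opposite-sign = by-signs
          everywhere : ∀ (U : SignVec E) → (∀ h → h ≢ e → X h · U h ≢ ⊖) → X e · U e ≡ ⊕ → ∀ h → X h · U h ≢ ⊖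
          everywhere U p q h with h ≟ e
          ... | yes refl rewrite q = λ ()
          ... | no h≢e = p h h≢e
          conclude : X f · V f ≡ ⊕ ⊎ X f · W f ≡ ⊕ → Absurd
          conclude (inj₁ f⊕) = ⊥-nonneg-contra X W (w X x)
            (everywhere W (λ h q → proj₂ (sided h q)) e⊕) e e⊕
            where
            e⊕ : X e · W e ≡ ⊕
            e⊕ = opposite-sign (X e) (V e) (W e) op
              (⊥-forced X V (v X x) e (λ h q → proj₁ (sided h q)) f f⊕)
          conclude (inj₂ f⊕) = ⊥-nonneg-contra X V (v X x)
            (everywhere V (λ h q → proj₁ (sided h q)) e⊕) e e⊕
            where
            e⊕ : X e · V e ≡ ⊕
            e⊕ = opposite-sign (X e) (W e) (V e) (opposed-sym (V e) (W e) op)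
              (⊥-forced X W (w X x) e (λ h q → proj₂ (sided h q)) f f⊕)

        hits : ∀ f s → s ≢ 𝟘 → dual (c f) ≡ sg s →
               ∃ λ U → Perp 𝒞 U × (∀ h → Obeys (dual (c h)) (U h)) × U f ≡ s
        hits f s s≢𝟘 cf with painting c f s s≢𝟘 (primal-colour (c f) s s≢𝟘 cf)
          where
          primal-colour : ∀ k s → s ≢ 𝟘 → dual k ≡ sg s → k ≡ sg s
          primal-colour (sg ⊕) _ _ refl = refl
          primal-colour (sg ⊖) _ _ refl = refl
          primal-colour free   _ p refl = contradiction refl p
        ... | inj₁ q = contradiction q (no-primal f s s≢𝟘 cf)
        ... | inj₂ q = q

      c-at-e : ∀ V W v w e op → dual (Eliminate.c V W v w e op e) ≡ sg 𝟘
      c-at-e V W v w e op with e ≟ e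
      ... | yes _ = refl
      ... | no q  = contradiction refl q

      perp-eliminate : ∀ V W → Perp 𝒞 V → Perp 𝒞 W → ∀ e → Opposed (V e) (W e) →
                       ∃ λ Z → Perp 𝒞 Z × Z e ≡ 𝟘 × (∀ h → ¬ Opposed (V h) (W h) → Z h ≡ V h ▹ W h)
      perp-eliminate V W v w e op = Z , proj₁ (proj₂ assembled) , hit e 𝟘 (c-at-e V W v w e op) , off
        where
        open Eliminate V W v w e op
        assembled : ∃ λ U → Perp 𝒞 U × (∀ h → Obeys (dual (c h)) (U h)) × (∀ f s → dual (c f) ≡ sg s → U f ≡ s)
        assembled = assemble perp-null (λ {V} {W} → perp-▹ {V} {W}) (dual ∘ c) hits
        Z = proj₁ assembled
        hit = proj₂ (proj₂ (proj₂ assembled))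
        off : ∀ h → ¬ Opposed (V h) (W h) → Z h ≡ V h ▹ W h
        off h q = hit h (V h ▹ W h) colour
          where
          colour : dual (c h) ≡ sg (V h ▹ W h)
          colour with h ≟ e | opposed? (V h) (W h)
          ... | yes refl | _     = contradiction op q
          ... | no _     | yes r = contradiction r q
          ... | no _     | no _  = dual-dual (V h ▹ W h)

-- The oriented matroid of support-minimal vectors

module _ {A : Set} {P Q : Pred A 0ℓ} (P? : Decidable P) (Q? : Decidable Q) (P⊆Q : P ⊆ Q) where

  filter-length-≤ : ∀ xs → length (filter P? xs) ≤ length (filter Q? xs)
  filter-length-≤ [] = z≤n
  filter-length-≤ (x ∷ xs) with P? x | Q? x
  ... | yes _ | yes _ = s≤s (filter-length-≤ xs)
  ... | yes p | no ¬q = contradiction (P⊆Q p) ¬q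
  ... | no _  | yes _ = ℕ.m≤n⇒m≤1+n (filter-length-≤ xs)
  ... | no _  | no _  = filter-length-≤ xs

  filter-length-< : ∀ {x xs} → x ∈ xs → ¬ P x → Q x → length (filter P? xs) < length (filter Q? xs)
  filter-length-< {xs = x ∷ xs} (here refl) ¬p q with P? x | Q? x
  ... | yes p | _     = contradiction p ¬p
  ... | no _  | no ¬q = contradiction q ¬q
  ... | no _  | yes _ = s≤s (filter-length-≤ xs)
  filter-length-< {xs = y ∷ xs} (there x∈xs) ¬p q with P? y | Q? y
  ... | yes _ | yes _ = s≤s (filter-length-< x∈xs ¬p q)
  ... | yes p | no ¬q = contradiction (P⊆Q p) ¬q
  ... | no _  | yes _ = ℕ.m≤n⇒m≤1+n (filter-length-< x∈xs ¬p q)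
  ... | no _  | no _  = filter-length-< x∈xs ¬p q

module Minimal {E : Set} (_≟_ : DecidableEquality E)
               (elements : List E) (complete : ∀ e → e ∈ elements)
               {𝓥 : Pred (SignVec E) 0ℓ} (family : IsExchangeFamily 𝓥) where

  open Finite _≟_ elements complete
  open IsExchangeFamily family

  private
    oppositions : SignVec E → SignVec E → ℕ
    oppositions X Y = length (filter (λ h → opposed? (X h) (Y h)) elements)

    support-size : SignVec E → ℕ
    support-size X = length (filter (λ h → ¬? (X h ≟ₛ 𝟘)) elements)

  nonZero? : ∀ (X : SignVec E) → Dec (NonZero X)
  nonZero? X = ∃-element? λ e → ¬? (X e ≟ₛ 𝟘)

  supp⊆? : ∀ (X Y : SignVec E) → Dec (∀ h → X h ≢ 𝟘 → Y h ≢ 𝟘)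
  supp⊆? X Y = ∀-element? λ h → ¬? (X h ≟ₛ 𝟘) →-dec ¬? (Y h ≟ₛ 𝟘)

  private
    Smaller : SignVec E → SignVec E → Set
    Smaller X Y = 𝓥 Y × NonZero Y × (∀ h → Y h ≢ 𝟘 → X h ≢ 𝟘) × (∃ λ k → X k ≢ 𝟘 × Y k ≡ 𝟘)

    smaller? : ∀ X → Dec (∃ (Smaller X))
    smaller? X = ∃-signVec?
      (λ {Y} {Y′} eq (y , (e , Ye) , ⊆X , (k , Xk , Yk)) → resp eq y , (e , Ye ∘ trans (eq e)) ,
        (λ h q → ⊆X h (q ∘ trans (sym (eq h)))) , (k , Xk , trans (sym (eq k)) Yk))
      (λ Y → (Y ∈?) ×-dec (nonZero? Y ×-dec (supp⊆? Y X ×-dec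
        ∃-element? (λ k → ¬? (X k ≟ₛ 𝟘) ×-dec (Y k ≟ₛ 𝟘)))))

    minimal : ∀ {X} → 𝓥 X → NonZero X → ¬ ∃ (Smaller X) → SupportMinimal 𝓥 X
    minimal {X} x X≢0 ¬smaller = x , X≢0 , λ Y y Y≢0 Y⊆X {h} Xh Yh →
      ¬smaller (Y , y , Y≢0 , (λ k → Y⊆X {k}) , (h , Xh , Yh))

  supportMinimal? : ∀ X → Dec (SupportMinimal 𝓥 X)
  supportMinimal? X with X ∈? | nonZero? X | smaller? X
  ... | no ¬x | _ | _ = no λ (x , _) → ¬x x
  ... | yes _ | no ¬p | _ = no λ (_ , p , _) → ¬p p
  ... | yes x | yes p | no ¬s = yes (minimal x p ¬s)
  ... | yes _ | yes _ | yes (Y , y , Y≢0 , Y⊆X , (k , Xk , Yk)) =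
    no λ (_ , _ , m) → m Y y Y≢0 (λ {h} → Y⊆X h) {k} Xk Yk

  private
    oneOf-supp : ∀ z x y → (y ≢ 𝟘 → x ≢ 𝟘) → OneOf z x y → z ≢ 𝟘 → x ≢ 𝟘
    oneOf-supp = by-signs

    Reduced : SignVec E → E → Set
    Reduced X f = ∃ λ Z → 𝓥 Z × Z f ≡ X f × (∀ h → Z h ≼ X h) × (∃ λ k → X k ≢ 𝟘 × Z k ≡ 𝟘)

    -- Each elimination between `X` and `Y` removes an opposition without creating another, keeps
    -- the sign at `f` and leaves a zero inside the support of `X`. Without oppositions, the result
    -- conforms to `X`.
    reduced : ∀ n {X Y} f → X f ≢ 𝟘 → 𝓥 X → 𝓥 Y → oppositions Y X < n → Y f ≡ X f →
              (∀ h → Y h ≢ 𝟘 → X h ≢ 𝟘) → (∃ λ k → X k ≢ 𝟘 × Y k ≡ 𝟘) → Reduced X f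
    reduced (suc n) {X} {Y} f Xf x y (s≤s lt) Yf Y⊆X hole
      with ∃-element? (λ h → opposed? (Y h) (X h))
    ... | no none = Y , y , Yf , (λ h → conformal (Y h) (X h) (Y⊆X h) (λ op → none (h , op))) , hole
      where
      conformal : ∀ y x → (y ≢ 𝟘 → x ≢ 𝟘) → ¬ Opposed y x → y ≼ x
      conformal = by-signs
    ... | yes (e , op) with exchange x y e f (opposed-sym (Y e) (X e) op) Xf (not-neg (X f) (Y f) Xf Yf)
      where
      not-neg : ∀ x y → x ≢ 𝟘 → y ≡ x → y ≢ neg x
      not-neg = by-signs
    ...   | Z , z , Ze , Zf , between = reduced n f Xf x z
      (ℕ.<-≤-trans (filter-length-< (λ h → opposed? (Z h) (X h)) (λ h → opposed? (Y h) (X h))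
        (λ {h} → inherit (Z h) (X h) (Y h) (between h)) (complete e) (λ (q , _) → q Ze) op) lt)
      Zf (λ h → oneOf-supp (Z h) (X h) (Y h) (Y⊆X h) (between h))
      (e , proj₁ (opposed-sym (Y e) (X e) op) , Ze)
      where
      inherit : ∀ z x y → OneOf z x y → Opposed z x → Opposed y x
      inherit = by-signs

    -- Up to its sign, `Y` either agrees with `X` at `f`, or vanishes at `f` and can be used to
    -- remove `g` from `X` without touching the sign there.
    reduce : ∀ {X} f → X f ≢ 𝟘 → 𝓥 X → ∃ (Smaller X) → Reduced X f
    reduce {X} f Xf x (Y , y , (g , Yg) , Y⊆X , hole) with Y f ≟ₛ 𝟘
    ... | no Yf = [ (λ q → reduced _ f Xf x y ℕ.≤-refl q Y⊆X hole)
                  , (λ q → reduced _ f Xf x (negate y) ℕ.≤-refl q (λ h r → Y⊆X h (r ∘ cong neg))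
                             (proj₁ hole , proj₁ (proj₂ hole) , cong neg (proj₂ (proj₂ hole)))) ]′
                  (agree (Y f) (X f) Yf Xf)
      where
      agree : ∀ y x → y ≢ 𝟘 → x ≢ 𝟘 → y ≡ x ⊎ neg y ≡ x
      agree = by-signs
    ... | yes Yf = [ remove y Yf Y⊆X , remove (negate y) (cong neg Yf) (λ h r → Y⊆X h (r ∘ cong neg)) ]′
                   (opposed-up-to-sign (X g) (Y g) (Y⊆X g Yg) Yg)
      where
      remove : ∀ {Y} → 𝓥 Y → Y f ≡ 𝟘 → (∀ h → Y h ≢ 𝟘 → X h ≢ 𝟘) → Opposed (X g) (Y g) → Reduced X f
      remove {Y} y Yf Y⊆X op with exchange x y g f op Xf (λ q → Xf (neg≡𝟘 (X f) (trans (sym q) Yf)))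
      ... | Z , z , Zg , Zf , between = reduced _ f Xf x z ℕ.≤-refl Zf
        (λ h → oneOf-supp (Z h) (X h) (Y h) (Y⊆X h) (between h)) (g , proj₁ op , Zg)

    minimal-below′ : ∀ n X → support-size X < n → 𝓥 X → ∀ f → X f ≢ 𝟘 →
                     ∃ λ Y → SupportMinimal 𝓥 Y × Y f ≡ X f × (∀ h → Y h ≼ X h)
    minimal-below′ (suc n) X (s≤s lt) x f Xf with smaller? X
    ... | no ¬s = X , minimal x (f , Xf) ¬s , refl , λ h → inj₂ refl
    ... | yes s with reduce f Xf x s
    ...   | Z , z , Zf , Z≼X , (k , Xk , Zk)
      with minimal-below′ n Z (ℕ.<-≤-trans (filter-length-< (λ h → ¬? (Z h ≟ₛ 𝟘)) (λ h → ¬? (X h ≟ₛ 𝟘))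
             (λ {h} → within (Z h) (X h) (Z≼X h)) (complete k) (λ q → q Zk) Xk) lt)
             z f (λ q → Xf (trans (sym Zf) q))
      where
      within : ∀ z x → z ≼ x → z ≢ 𝟘 → x ≢ 𝟘
      within = by-signs
    ...     | Y , y , Yf , Y≼Z = Y , y , trans Yf Zf , λ h → ≼-trans (Y h) (Z h) (X h) (Y≼Z h) (Z≼X h)
      where
      ≼-trans : ∀ y z x → y ≼ z → z ≼ x → y ≼ x
      ≼-trans = by-signs

  minimal-below : ∀ {X} → 𝓥 X → ∀ f → X f ≢ 𝟘 →
                  ∃ λ Y → SupportMinimal 𝓥 Y × Y f ≡ X f × (∀ h → Y h ≼ X h)
  minimal-below {X} = minimal-below′ _ X ℕ.≤-refl

  minimal-incomparable : ∀ {X Y} → SupportMinimal 𝓥 X → SupportMinimal 𝓥 Y → supp X ⊆ supp Y →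
                         X ≗ Y ⊎ X ≗ (-ᵥ Y)
  minimal-incomparable {X} {Y} (x , X≢0 , minX) (y , Y≢0 , minY) X⊆Y
    with ∃-element? (λ e → ¬? (X e ≟ₛ Y e)) | ∃-element? (λ f → ¬? (X f ≟ₛ neg (Y f)))
  ... | no none | _ = inj₁ λ e → decidable-stable (X e ≟ₛ Y e) λ q → none (e , q)
  ... | yes _ | no none = inj₂ λ f → decidable-stable (X f ≟ₛ neg (Y f)) λ q → none (f , q)
  ... | yes (e , Xe≢Ye) | yes (f , Xf≢-Yf) = contradiction Ze
      (minX Z z (f , λ q → proj₁ at-f (trans (sym Zf) q)) (λ {h} → Z⊆X h) {e} (proj₁ op))
    where
    Y⊆X : supp Y ⊆ supp X
    Y⊆X = minY X x X≢0 X⊆Y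
    opposed : ∀ x y → (x ≢ 𝟘 → y ≢ 𝟘) → (y ≢ 𝟘 → x ≢ 𝟘) → x ≢ y → Opposed x y
    opposed = by-signs
    equal : ∀ x y → (x ≢ 𝟘 → y ≢ 𝟘) → (y ≢ 𝟘 → x ≢ 𝟘) → x ≢ neg y → x ≢ 𝟘 × y ≢ neg x
    equal = by-signs
    op = opposed (X e) (Y e) (X⊆Y {e}) (Y⊆X {e}) Xe≢Ye
    at-f = equal (X f) (Y f) (X⊆Y {f}) (Y⊆X {f}) Xf≢-Yf
    exchanged = exchange x y e f op (proj₁ at-f) (proj₂ at-f)
    Z = proj₁ exchanged
    z = proj₁ (proj₂ exchanged)
    Ze = proj₁ (proj₂ (proj₂ exchanged))
    Zf = proj₁ (proj₂ (proj₂ (proj₂ exchanged)))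
    Z⊆X : ∀ h → Z h ≢ 𝟘 → X h ≢ 𝟘
    Z⊆X h q = [ (λ r → contradiction r q)
              , [ (λ r → q ∘ trans r) , (λ r → Y⊆X {h} (q ∘ trans r)) ]′ ]′
              (proj₂ (proj₂ (proj₂ (proj₂ exchanged))) h)

  orientedMatroid : OrientedMatroid E
  orientedMatroid = record
    { Circuit = SupportMinimal 𝓥
    ; circuit? = supportMinimal?
    ; resp = λ {X} {Y} → minimal-resp X Y
    ; nonZero = proj₁ ∘ proj₂
    ; symmetric = λ {X} (x , (e , Xe) , m) → negate x , (e , λ q → Xe (neg≡𝟘 (X e) q)) ,
        λ Y y Y≢0 Y⊆X {h} q → m Y y Y≢0 (λ {k} r Xk → Y⊆X {k} r (cong neg Xk)) {h} (λ Xh → q (cong neg Xh))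
    ; incomparable = minimal-incomparable
    ; eliminate = λ {X} {Y} → minimal-eliminate X Y
    }
    where
    minimal-resp : ∀ X Y → X ≗ Y → SupportMinimal 𝓥 X → SupportMinimal 𝓥 Y
    minimal-resp X Y eq (x , (e , Xe) , m) = resp eq x , (e , Xe ∘ trans (eq e)) ,
      λ Z z Z≢0 Z⊆Y {h} q → m Z z Z≢0 (λ {k} r → Z⊆Y {k} r ∘ trans (sym (eq k))) {h} (q ∘ trans (sym (eq h)))
    minimal-eliminate : ∀ X Y → SupportMinimal 𝓥 X → SupportMinimal 𝓥 Y → ¬ X ≗ (-ᵥ Y) →
      ∀ e → X e ≡ ⊕ → Y e ≡ ⊖ →
      ∃ λ Z → SupportMinimal 𝓥 Z × Z e ≡ 𝟘 ×
        (∀ f → Z f ≡ ⊕ → X f ≡ ⊕ ⊎ Y f ≡ ⊕) ×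
        (∀ f → Z f ≡ ⊖ → X f ≡ ⊖ ⊎ Y f ≡ ⊖)
    minimal-eliminate X Y mx@(x , _) my@(y , _) X≉-Y e Xe Ye
      with ∃-element? (λ f → ¬? (X f ≟ₛ 𝟘) ×-dec (Y f ≟ₛ 𝟘))
    ... | no none with minimal-incomparable mx my (λ {h} Xh Yh → none (h , Xh , Yh))
    ...   | inj₁ eq = contradiction (trans (sym Xe) (trans (eq e) Ye)) λ ()
    ...   | inj₂ eq = contradiction eq X≉-Y
    -- As `Y` vanishes at `f`, the sign of `X` survives there. The result of the exchange is thus
    -- nonzero, and a minimal vector conforming to it inherits its zeros and takes its signs from
    -- `X` and `Y`.
    minimal-eliminate X Y mx@(x , _) my@(y , _) X≉-Y e Xe Ye | yes (f , Xf , Yf)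
      with exchange x y e f (subst₂ Opposed (sym Xe) (sym Ye) ((λ ()) , refl)) Xf
             (λ q → Xf (neg≡𝟘 (X f) (trans (sym q) Yf)))
    ... | Z , z , Ze , Zf , between with minimal-below z f (λ q → Xf (trans (sym Zf) q))
    ...   | V , v , Vf , V≼Z = V , v , at-e (V≼Z e) ,
      (λ h → from-X-or-Y h (λ ())) , (λ h → from-X-or-Y h (λ ()))
      where
      at-e : V e ≼ Z e → V e ≡ 𝟘
      at-e (inj₁ q) = q
      at-e (inj₂ q) = trans q Ze
      from-X-or-Y : ∀ h {s} → s ≢ 𝟘 → V h ≡ s → X h ≡ s ⊎ Y h ≡ s
      from-X-or-Y h {s} s≢𝟘 Vh = source (V h) (Z h) (X h) (Y h) s s≢𝟘 Vh (V≼Z h) (between h)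
        where
        source : ∀ v z x y s → s ≢ 𝟘 → v ≡ s → v ≼ z → OneOf z x y → x ≡ s ⊎ y ≡ s
        source v z x y s s≢𝟘 refl (inj₁ q) _ = contradiction q s≢𝟘
        source v z x y s s≢𝟘 refl (inj₂ refl) (inj₁ q) = contradiction q s≢𝟘
        source v z x y s s≢𝟘 refl (inj₂ refl) (inj₂ q) = Sum.map sym sym q

-- Passing between circuits and covectors

module Duality {E : Set} (_≟_ : DecidableEquality E)
               (elements : List E) (complete : ∀ e → e ∈ elements) where

  open Finite _≟_ elements complete
  open Covectors _≟_ elements complete

  module _ (M : OrientedMatroid E) where

    open OrientedMatroid M
    open Circuits _≟_ elements complete M

    covectors : IsCovectorFamily (Perp Circuit)
    covectors = perp-covectors circuits

    -- By `below`, a vector supported in `X` has a circuit conforming to it, and incomparability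
    -- makes this circuit equal to `X` up to sign.
    circuit⇒minimal : ∀ {X} → Circuit X → SupportMinimal (Perp (Perp Circuit)) X
    circuit⇒minimal {X} x = (λ W w → ⊥-sym X W (w X x)) , nonZero x , minimal
      where
      minimal : ∀ Y → Perp (Perp Circuit) Y → NonZero Y → supp Y ⊆ supp X → supp X ⊆ supp Y
      minimal Y y (f , Yf) Y⊆X with below circuits Y y f Yf
      ... | Z , z , Zf , Z≼Y = λ Xh Yh → Xh (Xh≡𝟘 _ ([ id , (λ r → trans r Yh) ]′ (Z≼Y _)))
        where
        Z⊆X : supp Z ⊆ supp X
        Z⊆X {h} Zh = Y⊆X {h} λ Yh → Zh ([ id , (λ r → trans r Yh) ]′ (Z≼Y h))
        Xh≡𝟘 : ∀ h → Z h ≡ 𝟘 → X h ≡ 𝟘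
        Xh≡𝟘 h Zh with incomparable z x (λ {k} → Z⊆X {k})
        ... | inj₁ eq = trans (sym (eq h)) Zh
        ... | inj₂ eq = neg≡𝟘 (X h) (trans (sym (eq h)) Zh)

    minimal⇒circuit : ∀ {X} → SupportMinimal (Perp (Perp Circuit)) X → Circuit X
    minimal⇒circuit {X} (x , (f , Xf) , minimal) with below circuits X x f Xf
    ... | Y , y , Yf , Y≼X = resp (λ h → equal h (Y≼X h)) y
      where
      X⊆Y : supp X ⊆ supp Y
      X⊆Y = minimal Y (λ W w → ⊥-sym Y W (w Y y)) (f , Xf ∘ trans (sym Yf))
        (λ {h} Yh Xh → Yh ([ id , (λ r → trans r Xh) ]′ (Y≼X h)))
      equal : ∀ h → Y h ≼ X h → Y h ≡ X h
      equal h (inj₂ q) = q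
      equal h (inj₁ q) = trans q (sym (decidable-stable (X h ≟ₛ 𝟘) λ r → X⊆Y {h} r q))

  module _ {𝓛 : Pred (SignVec E) 0ℓ} (isL : IsCovectorFamily 𝓛) where

    private
      vectors : IsExchangeFamily (Perp 𝓛)
      vectors = exchangeFamily (perp-covectors (exchangeFamily isL))

    open Minimal _≟_ elements complete vectors using (minimal-below)

    fromCovectors : OrientedMatroid E
    fromCovectors = Minimal.orientedMatroid _≟_ elements complete vectors

    covector⇒perp : ∀ {W} → 𝓛 W → Perp (OrientedMatroid.Circuit fromCovectors) W
    covector⇒perp {W} w X (x , _) = ⊥-sym W X (x W w)

    -- A vector with one-signed products with `W` would have below it a minimal vector with the same
    -- property. So orthogonality to the circuits implies orthogonality to all vectors, and
    -- `perp-perp` applies.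
    perp⇒covector : ∀ {W} → Perp (OrientedMatroid.Circuit fromCovectors) W → 𝓛 W
    perp⇒covector {W} w = perp-perp isL W (perp-intro W impossible)
      where
      open Painting _≟_ elements complete vectors using (perp-intro)
      impossible : ∀ X → Perp 𝓛 X → (∀ h → X h · W h ≢ ⊖) → ∀ f → X f · W f ≢ ⊕
      impossible X x nonneg f f⊕ with minimal-below x f (λ q → contradiction (trans (sym f⊕) (cong (_· W f) q)) λ ())
      ... | Y , y , Yf , Y≼X = ⊥-nonneg-contra Y W (w Y y) nonneg′ f (trans (cong (_· W f) Yf) f⊕)
        where
        nonneg′ : ∀ h → Y h · W h ≢ ⊖
        nonneg′ h with Y≼X h
        ... | inj₁ q rewrite q = λ ()
        ... | inj₂ q rewrite q = nonneg h

-- Single-element extensions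

-- Adm y s t says that a covector with the signs s, t and y at the elements a, b
-- and p is orthogonal to the signed set ({a} , {b , p}).
Adm : Sgn → Sgn → Sgn → Set
Adm y s t = (s ≡ t × s ≢ 𝟘) ⊎ y ≡ s ▹ neg t

adm? : ∀ y s t → Dec (Adm y s t)
adm? y s t = ((s ≟ₛ t) ×-dec ¬? (s ≟ₛ 𝟘)) ⊎-dec (y ≟ₛ s ▹ neg t)

adm-neg : ∀ y s t → Adm y s t → Adm (neg y) (neg s) (neg t)
adm-neg = by-signs

adm-▹ : ∀ y₁ s₁ t₁ y₂ s₂ t₂ → Adm y₁ s₁ t₁ → Adm y₂ s₂ t₂ → Adm (y₁ ▹ y₂) (s₁ ▹ s₂) (t₁ ▹ t₂)
adm-▹ = by-signs

adm-𝟘⇒≡ : ∀ s t → Adm 𝟘 s t → s ≡ t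
adm-𝟘⇒≡ = by-signs

≡⇒adm-𝟘 : ∀ s t → s ≡ t → Adm 𝟘 s t
≡⇒adm-𝟘 = by-signs

module _ {Ω : Set} (∃Ω? : ∀ {P : Ω → Set} → (∀ w → Dec (P w)) → Dec (∃ P)) where

  -- Either ⊕ is admissible everywhere, or some line excludes it. Such a line admits only one sign,
  -- and comparing it with every other line shows that this sign is admissible there too.
  common-sign : (s t : Ω → Sgn) → (∀ w u → ∃ λ y → Adm y (s w) (t w) × Adm y (s u) (t u)) →
                ∃ λ y → ∀ w → Adm y (s w) (t w)
  common-sign s t pairwise with ∃Ω? (λ w → ¬? (adm? ⊕ (s w) (t w)))
  ... | no none = ⊕ , λ w → decidable-stable (adm? ⊕ (s w) (t w)) λ q → none (w , q)
  ... | yes (w , ¬adm) = _ , λ u → forced (s w) (t w) (s u) (t u)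
      (proj₁ (pairwise w u)) ¬adm (proj₁ (proj₂ (pairwise w u))) (proj₂ (proj₂ (pairwise w u)))
    where
    forced : ∀ s t s′ t′ y → ¬ Adm ⊕ s t → Adm y s t → Adm y s′ t′ → Adm (s ▹ neg t) s′ t′
    forced = by-signs

-- Extension by an element p at which all the lines through a w and b w meet.
-- In the contraction of a w, the element p is antiparallel to b w; the facets Fa
-- and Fb move covectors along p.
module Extension
  {E : Set} (_≟_ : DecidableEquality E) (elements : List E) (complete : ∀ e → e ∈ elements)
  {𝓛 : Pred (SignVec E) 0ℓ} (covectors : IsCovectorFamily 𝓛)
  (p : E) (p-loop : ∀ {W} → 𝓛 W → W p ≡ 𝟘)
  {Ω : Set} (∃Ω? : ∀ {P : Ω → Set} → (∀ w → Dec (P w)) → Dec (∃ P))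
  (a b : Ω → E) (a≢p : ∀ w → a w ≢ p) (b≢p : ∀ w → b w ≢ p)
  (consistent : ∀ {W} → 𝓛 W → ∀ w u → ∃ λ y → Adm y (W (a w)) (W (b w)) × Adm y (W (a u)) (W (b u)))
  (Fa Fb : SignVec E) (fa : 𝓛 Fa) (fb : 𝓛 Fb)
  (Fa-a : ∀ w → Fa (a w) ≡ ⊕) (Fa-b : ∀ w → Fa (b w) ≡ 𝟘)
  (Fb-a : ∀ w → Fb (a w) ≡ 𝟘) (Fb-b : ∀ w → Fb (b w) ≡ ⊕)
  (classify : ∀ h → h ≢ p → (∃ λ w → h ≡ a w) ⊎ (∃ λ w → h ≡ b w) ⊎ (Fa h ≡ 𝟘 × Fb h ≡ 𝟘))
  where

  open Finite _≟_ elements complete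
  open IsCovectorFamily covectors

  AdmAll : Sgn → SignVec E → Set
  AdmAll y Z = ∀ w → Adm y (Z (a w)) (Z (b w))

  -- The ground set already contains `p`, as a loop of `𝓛`; resetting `W` at `p` recovers the
  -- covector that is extended.
  Extended : Pred (SignVec E) 0ℓ
  Extended W = 𝓛 (W [ p ≔ 𝟘 ]) × AdmAll (W p) W

  private
    ∀Ω? : ∀ {P : Ω → Set} → (∀ w → Dec (P w)) → Dec (∀ w → P w)
    ∀Ω? P? = map′ (λ none w → decidable-stable (P? w) λ ¬p → none (w , ¬p))
                  (λ all (w , ¬p) → ¬p (all w)) (¬? (∃Ω? (¬? ∘ P?)))

    extend-sign : ∀ {Z} → 𝓛 Z → ∃ λ y → AdmAll y Z
    extend-sign {Z} z = common-sign ∃Ω? (Z ∘ a) (Z ∘ b) (consistent z)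

    admAll-▹ : ∀ {y₁ y₂ Z₁ Z₂} → AdmAll y₁ Z₁ → AdmAll y₂ Z₂ → AdmAll (y₁ ▹ y₂) (Z₁ ▹ᵥ Z₂)
    admAll-▹ {y₁} {y₂} {Z₁} {Z₂} p q w =
      adm-▹ y₁ (Z₁ (a w)) (Z₁ (b w)) y₂ (Z₂ (a w)) (Z₂ (b w)) (p w) (q w)

    oppositions : SignVec E → SignVec E → ℕ
    oppositions X Y = length (filter (λ h → opposed? (X h) (Y h)) elements)

    Off : SignVec E → SignVec E → SignVec E → Set
    Off Z₁ Z₂ Z = ∀ h → ¬ Opposed (Z₁ h) (Z₂ h) → Z h ≡ Z₁ h ▹ Z₂ h

    -- The segment from Z₁ to Z₂ crosses the hyperplane of p: bisect it.
    cross : ∀ n {Z₁ Z₂} → oppositions Z₁ Z₂ < n → 𝓛 Z₁ → 𝓛 Z₂ → AdmAll ⊕ Z₁ → AdmAll ⊖ Z₂ →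
            ∃ λ A → 𝓛 A × AdmAll 𝟘 A × Off Z₁ Z₂ A
    cross (suc n) {Z₁} {Z₂} (s≤s lt) z₁ z₂ adm₁ adm₂ with ∃-element? (λ h → opposed? (Z₁ h) (Z₂ h))
    -- If the ends are on different sides but nowhere opposed, then their composition takes equal
    -- signs at the two ends of each line, and so lies on the hyperplane.
    ... | no none = Z₁ ▹ᵥ Z₂ , compose z₁ z₂ , both , λ h _ → refl
      where
      meet : ∀ s₁ s₂ t₁ t₂ → ¬ Opposed s₁ s₂ → ¬ Opposed t₁ t₂ → Adm ⊕ s₁ t₁ → Adm ⊖ s₂ t₂ →
             Adm 𝟘 (s₁ ▹ s₂) (t₁ ▹ t₂)
      meet = by-signs
      both : AdmAll 𝟘 (Z₁ ▹ᵥ Z₂)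
      both w = meet (Z₁ (a w)) (Z₂ (a w)) (Z₁ (b w)) (Z₂ (b w))
        (λ q → none (a w , q)) (λ q → none (b w , q)) (adm₁ w) (adm₂ w)
    ... | yes (e , op) with eliminate z₁ z₂ e op
    ...   | U , u , Ue , off with extend-sign u
    ...     | 𝟘 , adm = U , u , adm , off
    -- `U` is on the side of `Z₁` and replaces it. Composing it with `Z₂` keeps that side, while the
    -- zeros of `U`, in particular `e`, are filled with signs that are not opposed to `Z₂`.
    ...     | ⊕ , adm = from-left (cross n (ℕ.<-≤-trans (filter-length-<
        (λ h → opposed? (U h ▹ Z₂ h) (Z₂ h)) (λ h → opposed? (Z₁ h) (Z₂ h))
        (λ {h} → inherit (U h) (Z₁ h) (Z₂ h) (off h)) (complete e)
        (gone (U e) (Z₂ e) Ue) op) lt) (compose u z₂) z₂ (admAll-▹ {⊕} {⊖} {U} {Z₂} adm adm₂) adm₂)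
      where
      inherit : ∀ u z₁ z₂ → (¬ Opposed z₁ z₂ → u ≡ z₁ ▹ z₂) → Opposed (u ▹ z₂) z₂ → Opposed z₁ z₂
      inherit = by-signs
      gone : ∀ u z → u ≡ 𝟘 → ¬ Opposed (u ▹ z) z
      gone = by-signs
      off′ : ∀ x u z₁ z₂ → (¬ Opposed z₁ z₂ → u ≡ z₁ ▹ z₂) →
             (¬ Opposed (u ▹ z₂) z₂ → x ≡ (u ▹ z₂) ▹ z₂) → ¬ Opposed z₁ z₂ → x ≡ z₁ ▹ z₂
      off′ = by-signs
      from-left : (∃ λ A → 𝓛 A × AdmAll 𝟘 A × Off (U ▹ᵥ Z₂) Z₂ A) → ∃ λ A → 𝓛 A × AdmAll 𝟘 A × Off Z₁ Z₂ A
      from-left (A , a , adm , o) = A , a , adm , λ h → off′ (A h) (U h) (Z₁ h) (Z₂ h) (off h) (o h)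
    ...     | ⊖ , adm = from-right (cross n (ℕ.<-≤-trans (filter-length-<
        (λ h → opposed? (Z₁ h) (U h ▹ Z₁ h)) (λ h → opposed? (Z₁ h) (Z₂ h))
        (λ {h} → inherit (U h) (Z₁ h) (Z₂ h) (off h)) (complete e)
        (gone (U e) (Z₁ e) Ue) op) lt) z₁ (compose u z₁) adm₁ (admAll-▹ {⊖} {⊕} {U} {Z₁} adm adm₁))
      where
      inherit : ∀ u z₁ z₂ → (¬ Opposed z₁ z₂ → u ≡ z₁ ▹ z₂) → Opposed z₁ (u ▹ z₁) → Opposed z₁ z₂
      inherit = by-signs
      gone : ∀ u z → u ≡ 𝟘 → ¬ Opposed z (u ▹ z)
      gone = by-signs
      off′ : ∀ x u z₁ z₂ → (¬ Opposed z₁ z₂ → u ≡ z₁ ▹ z₂) →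
             (¬ Opposed z₁ (u ▹ z₁) → x ≡ z₁ ▹ (u ▹ z₁)) → ¬ Opposed z₁ z₂ → x ≡ z₁ ▹ z₂
      off′ = by-signs
      from-right : (∃ λ A → 𝓛 A × AdmAll 𝟘 A × Off Z₁ (U ▹ᵥ Z₁) A) → ∃ λ A → 𝓛 A × AdmAll 𝟘 A × Off Z₁ Z₂ A
      from-right (A , a , adm , o) = A , a , adm , λ h → off′ (A h) (U h) (Z₁ h) (Z₂ h) (off h) (o h)

    Eliminated : Sgn → SignVec E → SignVec E → E → Set
    Eliminated y Z₁ Z₂ e = ∃ λ Z → 𝓛 Z × AdmAll y Z × Z e ≡ 𝟘 × Off Z₁ Z₂ Z

    -- Elimination in 𝓛 yields the right signs off the elements b w; moving the
    -- facet Fb along p, they can be made equal to those at the elements a w.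
    straighten : ∀ {C} → 𝓛 C → ∃ λ A → 𝓛 A × AdmAll 𝟘 A ×
                 (∀ w → A (a w) ≡ C (a w)) × (∀ h → Fb h ≡ 𝟘 → A h ≡ C h)
    -- Whatever `C` is, the sign ⊖ at all `b w` admits ⊕ at `p`, and the sign ⊕ admits ⊖. The two
    -- ends differ only in the support of `Fb`, so that crossing preserves `C` elsewhere.
    straighten {C} c with cross _ {(-ᵥ Fb) ▹ᵥ C} {Fb ▹ᵥ C} ℕ.≤-refl (compose (negate fb) c) (compose fb c)
        (λ w → up (Fb (a w)) (Fb (b w)) (C (a w)) (C (b w)) (Fb-a w) (Fb-b w))
        (λ w → down (Fb (a w)) (Fb (b w)) (C (a w)) (C (b w)) (Fb-a w) (Fb-b w))
      where
      up : ∀ f g s t → f ≡ 𝟘 → g ≡ ⊕ → Adm ⊕ (neg f ▹ s) (neg g ▹ t)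
      up = by-signs
      down : ∀ f g s t → f ≡ 𝟘 → g ≡ ⊕ → Adm ⊖ (f ▹ s) (g ▹ t)
      down = by-signs
    ... | A , a′ , adm , off = A , a′ , adm , (λ w → kept (a w) (Fb-a w)) , kept
      where
      same : ∀ f c x → f ≡ 𝟘 → (¬ Opposed (neg f ▹ c) (f ▹ c) → x ≡ (neg f ▹ c) ▹ (f ▹ c)) → x ≡ c
      same = by-signs
      kept : ∀ h → Fb h ≡ 𝟘 → A h ≡ C h
      kept h q = same (Fb h) (C h) (A h) q (off h)

    -- On the hyperplane of `p`, the signs at `a w` and `b w` agree. Elimination at `b w` can thus
    -- be replaced by elimination at `a w`, whose sign `straighten` preserves, and the signs at the
    -- elements `b w` follow from those at `a w`.
    eliminate-level : ∀ {A B} → 𝓛 A → 𝓛 B → AdmAll 𝟘 A → AdmAll 𝟘 B → ∀ e → Opposed (A e) (B e) →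
                      Eliminated 𝟘 A B e
    eliminate-level {A} {B} x y adm₁ adm₂ e op = result (classify e e≢p)
      where
      e≢p : e ≢ p
      e≢p refl = proj₁ op (p-loop x)
      module _ (e′ : E) (op′ : Opposed (A e′) (B e′))
               (at-e : ∀ (X C : SignVec E) → AdmAll 𝟘 X → (∀ w → X (a w) ≡ C (a w)) → (∀ h → Fb h ≡ 𝟘 → X h ≡ C h) →
                       C e′ ≡ 𝟘 → X e ≡ 𝟘) where
        finish : Eliminated 𝟘 A B e
        finish with eliminate x y e′ op′
        ... | C , c , Ce′ , off with straighten c
        ...   | Z , z , adm , on-a , on-rest = Z , z , adm , at-e Z C adm on-a on-rest Ce′ , off′
          where
          off′ : Off A B Z
          off′ h q with h ≟ p
          ... | yes refl = trans (p-loop z) (sym (cong₂ _▹_ (p-loop x) (p-loop y)))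
          ... | no h≢p with classify h h≢p
          ...   | inj₁ (w , refl) = trans (on-a w) (off (a w) q)
          ...   | inj₂ (inj₂ (_ , Fbh)) = trans (on-rest h Fbh) (off h q)
          ...   | inj₂ (inj₁ (w , refl)) = begin
              Z (b w)           ≡⟨ adm-𝟘⇒≡ (Z (a w)) (Z (b w)) (adm w) ⟨
              Z (a w)           ≡⟨ on-a w ⟩
              C (a w)           ≡⟨ off (a w) (q ∘ subst₂ Opposed eqA eqB) ⟩
              A (a w) ▹ B (a w) ≡⟨ cong₂ _▹_ eqA eqB ⟩
              A (b w) ▹ B (b w) ∎
            where
            open ≡-Reasoning
            eqA = adm-𝟘⇒≡ (A (a w)) (A (b w)) (adm₁ w)
            eqB = adm-𝟘⇒≡ (B (a w)) (B (b w)) (adm₂ w)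
      result : (∃ λ w → e ≡ a w) ⊎ (∃ λ w → e ≡ b w) ⊎ (Fa e ≡ 𝟘 × Fb e ≡ 𝟘) → Eliminated 𝟘 A B e
      result (inj₁ (w , refl)) = finish (a w) op λ X C _ on-a _ q → trans (on-a w) q
      result (inj₂ (inj₂ (_ , Fbe))) = finish e op λ X C _ _ rest q → trans (rest e Fbe) q
      result (inj₂ (inj₁ (w , refl))) = finish (a w)
        (subst₂ Opposed (sym (adm-𝟘⇒≡ (A (a w)) (A (b w)) (adm₁ w))) (sym (adm-𝟘⇒≡ (B (a w)) (B (b w)) (adm₂ w))) op)
        λ X C adm on-a _ q → trans (sym (adm-𝟘⇒≡ (X (a w)) (X (b w)) (adm w))) (trans (on-a w) q)

    level : ∀ {y Z U} → 𝓛 Z → 𝓛 U → AdmAll y Z → AdmAll ⊖ U → y ≢ ⊖ →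
            ∃ λ A → 𝓛 A × AdmAll 𝟘 A ×
                    (∀ h → ¬ Opposed (Z h) (U h) → A h ≡ Z h ⊎ A h ≡ Z h ▹ U h)
    level {𝟘} {Z} z u admZ admU _ = Z , z , admZ , λ h _ → inj₁ refl
    level {⊖} z u admZ admU q = contradiction refl q
    level {⊕} z u admZ admU _ with cross _ ℕ.≤-refl z u admZ admU
    ... | A , x , adm , off = A , x , adm , λ h q → inj₂ (off h q)

    -- If elimination in 𝓛 gives the wrong sign at p, then no element of a line is
    -- a common zero of Z₁ and Z₂: level both, eliminate inside the hyperplane of p
    -- and push the result off this hyperplane by a facet through e.
    module Positive {y₁ y₂ : Sgn} {Z₁ Z₂ : SignVec E} (z₁ : 𝓛 Z₁) (z₂ : 𝓛 Z₂)
                    (adm₁ : AdmAll y₁ Z₁) (adm₂ : AdmAll y₂ Z₂)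
                    (y-op : ¬ Opposed y₁ y₂) (y⊕ : y₁ ▹ y₂ ≡ ⊕) (e : E) (op : Opposed (Z₁ e) (Z₂ e)) where

      e≢p : e ≢ p
      e≢p refl = proj₁ op (p-loop z₁)

      module _ {U : SignVec E} (u : 𝓛 U) (Ue : U e ≡ 𝟘) (off : Off Z₁ Z₂ U)
               (y : Sgn) (y≢⊕ : y ≢ ⊕) (admU : AdmAll y U) where

        -- At a common zero `a w`, the sign at `p` is the opposite of the sign at `b w`, for `Z₁`
        -- and `Z₂` as well as for `U`. Then `U` would have the sign ⊕ at `p`.
        no-common-zero-a : ∀ w → Z₁ (a w) ▹ Z₂ (a w) ≢ 𝟘
        no-common-zero-a w q = y≢⊕ (local y₁ y₂ (Z₁ (b w)) (Z₂ (b w)) (U (b w)) y y-op y⊕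
          (subst (λ s → Adm y₁ s (Z₁ (b w))) (proj₁ zeros) (adm₁ w))
          (subst (λ s → Adm y₂ s (Z₂ (b w))) (proj₂ zeros) (adm₂ w)) (off (b w))
          (subst (λ s → Adm y s (U (b w))) (trans (off (a w) (λ o → proj₁ o (proj₁ zeros))) q) (admU w)))
          where
          zeros = ▹≡𝟘 (Z₁ (a w)) (Z₂ (a w)) q
          local : ∀ y₁ y₂ t₁ t₂ u y → ¬ Opposed y₁ y₂ → y₁ ▹ y₂ ≡ ⊕ → Adm y₁ 𝟘 t₁ → Adm y₂ 𝟘 t₂ →
                  (¬ Opposed t₁ t₂ → u ≡ t₁ ▹ t₂) → Adm y 𝟘 u → y ≡ ⊕
          local = by-signs

        no-common-zero-b : ∀ w → Z₁ (b w) ▹ Z₂ (b w) ≢ 𝟘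
        no-common-zero-b w q = y≢⊕ (local y₁ y₂ (Z₁ (a w)) (Z₂ (a w)) (U (a w)) y y-op y⊕
          (subst (Adm y₁ (Z₁ (a w))) (proj₁ zeros) (adm₁ w))
          (subst (Adm y₂ (Z₂ (a w))) (proj₂ zeros) (adm₂ w)) (off (a w))
          (subst (Adm y (U (a w))) (trans (off (b w) (λ o → proj₁ o (proj₁ zeros))) q) (admU w)))
          where
          zeros = ▹≡𝟘 (Z₁ (b w)) (Z₂ (b w)) q
          local : ∀ y₁ y₂ t₁ t₂ u y → ¬ Opposed y₁ y₂ → y₁ ▹ y₂ ≡ ⊕ → Adm y₁ t₁ 𝟘 → Adm y₂ t₂ 𝟘 →
                  (¬ Opposed t₁ t₂ → u ≡ t₁ ▹ t₂) → Adm y u 𝟘 → y ≡ ⊕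
          local = by-signs

        -- Where elimination prescribes a sign on a line, that sign is nonzero and hides `G`. Off
        -- the lines and at `e` the facet `G` vanishes, so that the composition changes only the
        -- side of the hyperplane.
        push : ∀ G → 𝓛 G → (∀ w → Adm ⊕ (G (a w)) (G (b w)) × G (a w) ≢ G (b w)) → G e ≡ 𝟘 →
               (∀ h → Fa h ≡ 𝟘 → Fb h ≡ 𝟘 → G h ≡ 𝟘) → Eliminated 𝟘 Z₁ Z₂ e → Eliminated ⊕ Z₁ Z₂ e
        push G g G-adm Ge G-rest (C , c , admC , Ce , offC) =
          C ▹ᵥ G , compose c g , (λ w → up (C (a w)) (C (b w)) (G (a w)) (G (b w)) (admC w) (G-adm w)) ,
          trans (cong (_▹ G e) Ce) Ge , off′
          where
          up : ∀ s t g h → Adm 𝟘 s t → Adm ⊕ g h × g ≢ h → Adm ⊕ (s ▹ g) (t ▹ h)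
          up = by-signs
          absorb : ∀ c g x → c ≡ x → x ≢ 𝟘 → c ▹ g ≡ x
          absorb = by-signs
          trivial : ∀ h → G h ≡ 𝟘 → C h ▹ G h ≡ C h
          trivial h q = trans (cong (C h ▹_) q) (▹-identityʳ (C h))
          off′ : Off Z₁ Z₂ (C ▹ᵥ G)
          off′ h q with h ≟ p
          ... | yes refl = trans (trivial p (p-loop g)) (offC p q)
          ... | no h≢p with classify h h≢p
          ...   | inj₁ (w , refl) = absorb (C (a w)) (G (a w)) _ (offC (a w) q) (no-common-zero-a w)
          ...   | inj₂ (inj₁ (w , refl)) = absorb (C (b w)) (G (b w)) _ (offC (b w) q) (no-common-zero-b w)
          ...   | inj₂ (inj₂ (Fah , Fbh)) = trans (trivial h (G-rest h Fah Fbh)) (offC h q)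

        push-off : Eliminated 𝟘 Z₁ Z₂ e → Eliminated ⊕ Z₁ Z₂ e
        push-off = by-facet (classify e e≢p)
          where
          facet-a : Fa e ≡ 𝟘 → Eliminated 𝟘 Z₁ Z₂ e → Eliminated ⊕ Z₁ Z₂ e
          facet-a q = push Fa fa (λ w → subst₂ (λ s t → Adm ⊕ s t × s ≢ t) (sym (Fa-a w)) (sym (Fa-b w)) (inj₂ refl , λ ())) q
            (λ h r _ → r)
          facet-b : Fb e ≡ 𝟘 → Eliminated 𝟘 Z₁ Z₂ e → Eliminated ⊕ Z₁ Z₂ e
          facet-b q = push (-ᵥ Fb) (negate fb)
            (λ w → subst₂ (λ s t → Adm ⊕ (neg s) (neg t) × neg s ≢ neg t) (sym (Fb-a w)) (sym (Fb-b w)) (inj₂ refl , λ ()))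
            (cong neg q) (λ h _ r → cong neg r)
          by-facet : (∃ λ w → e ≡ a w) ⊎ (∃ λ w → e ≡ b w) ⊎ (Fa e ≡ 𝟘 × Fb e ≡ 𝟘) →
                     Eliminated 𝟘 Z₁ Z₂ e → Eliminated ⊕ Z₁ Z₂ e
          by-facet (inj₁ (w , refl))        = facet-b (Fb-a w)
          by-facet (inj₂ (inj₁ (w , refl))) = facet-a (Fa-b w)
          by-facet (inj₂ (inj₂ (q , _)))    = facet-a q

      y₁≢⊖ : y₁ ≢ ⊖
      y₁≢⊖ q = contradiction (trans (sym y⊕) (cong (_▹ y₂) q)) λ ()

      y₂≢⊖ : y₂ ≢ ⊖
      y₂≢⊖ = not y₁ y₂ y-op y⊕
        where
        not : ∀ y₁ y₂ → ¬ Opposed y₁ y₂ → y₁ ▹ y₂ ≡ ⊕ → y₂ ≢ ⊖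
        not = by-signs

      eliminate-positive : Eliminated ⊕ Z₁ Z₂ e
      eliminate-positive with eliminate z₁ z₂ e op
      ... | U , u , Ue , off with extend-sign u
      ...   | ⊕ , admU = U , u , admU , Ue , off
      ...   | 𝟘 , admU = push-off u Ue off 𝟘 (λ ()) admU (U , u , admU , Ue , off)
      ...   | ⊖ , admU with level {y₁} {Z₁} {U} z₁ u adm₁ admU y₁≢⊖ | level {y₂} {Z₂} {U} z₂ u adm₂ admU y₂≢⊖
      ...     | A , x , admA , offA | B , y , admB , offB =
        push-off u Ue off ⊖ (λ ()) admU (leveled (eliminate-level x y admA admB e op′))
        where
        at-e : ∀ z u x → u ≡ 𝟘 → (¬ Opposed z u → x ≡ z ⊎ x ≡ z ▹ u) → x ≡ z
        at-e = by-signs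
        op′ : Opposed (A e) (B e)
        op′ = subst₂ Opposed (sym (at-e (Z₁ e) (U e) (A e) Ue (offA e)))
                             (sym (at-e (Z₂ e) (U e) (B e) Ue (offB e))) op
        combine : ∀ z₁ z₂ u x y → (¬ Opposed z₁ z₂ → u ≡ z₁ ▹ z₂) →
                  (¬ Opposed z₁ u → x ≡ z₁ ⊎ x ≡ z₁ ▹ u) → (¬ Opposed z₂ u → y ≡ z₂ ⊎ y ≡ z₂ ▹ u) →
                  ¬ Opposed z₁ z₂ → ¬ Opposed x y × x ▹ y ≡ z₁ ▹ z₂
        combine = by-signs
        leveled : Eliminated 𝟘 A B e → Eliminated 𝟘 Z₁ Z₂ e
        leveled (C , c , admC , Ce , offC) = C , c , admC , Ce , λ h q →
          let (r , eq) = combine (Z₁ h) (Z₂ h) (U h) (A h) (B h) (off h) (offA h) (offB h) q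
          in trans (offC h r) eq

    neg-opposed : ∀ s t → Opposed s t → Opposed (neg s) (neg t)
    neg-opposed = by-signs

    opposed-neg : ∀ s t → Opposed (neg s) (neg t) → Opposed s t
    opposed-neg = by-signs

    eliminate-signed : ∀ {y₁ y₂ Z₁ Z₂} → 𝓛 Z₁ → 𝓛 Z₂ → AdmAll y₁ Z₁ → AdmAll y₂ Z₂ → ¬ Opposed y₁ y₂ →
                       ∀ y → y₁ ▹ y₂ ≡ y → ∀ e → Opposed (Z₁ e) (Z₂ e) → Eliminated y Z₁ Z₂ e
    eliminate-signed z₁ z₂ adm₁ adm₂ y-op ⊕ eq e op =
      Positive.eliminate-positive z₁ z₂ adm₁ adm₂ y-op eq e op
    eliminate-signed {y₁} {y₂} {Z₁} {Z₂} z₁ z₂ adm₁ adm₂ y-op 𝟘 eq e op =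
      eliminate-level z₁ z₂ (subst (λ y → AdmAll y Z₁) (proj₁ zeros) adm₁)
                            (subst (λ y → AdmAll y Z₂) (proj₂ zeros) adm₂) e op
      where
      zeros = ▹≡𝟘 y₁ y₂ eq
    eliminate-signed {y₁} {y₂} {Z₁} {Z₂} z₁ z₂ adm₁ adm₂ y-op ⊖ eq e op
      with Positive.eliminate-positive {neg y₁} {neg y₂} (negate z₁) (negate z₂)
        (λ w → adm-neg y₁ (Z₁ (a w)) (Z₁ (b w)) (adm₁ w)) (λ w → adm-neg y₂ (Z₂ (a w)) (Z₂ (b w)) (adm₂ w))
        (λ q → y-op (opposed-neg y₁ y₂ q)) (trans (sym (▹-neg y₁ y₂)) (cong neg eq)) e
        (neg-opposed (Z₁ e) (Z₂ e) op)
    ... | Z , z , adm , Ze , off = -ᵥ Z , negate z , (λ w → adm-neg ⊕ (Z (a w)) (Z (b w)) (adm w)) ,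
      cong neg Ze , λ h q → trans (cong neg (off h (λ r → q (opposed-neg (Z₁ h) (Z₂ h) r))))
        (trans (▹-neg (neg (Z₁ h)) (neg (Z₂ h))) (cong₂ _▹_ (neg-neg (Z₁ h)) (neg-neg (Z₂ h))))

    admAll-cong : ∀ {y Z Z′} → (∀ h → h ≢ p → Z h ≡ Z′ h) → AdmAll y Z → AdmAll y Z′
    admAll-cong {y} eq adm w = subst₂ (Adm y) (eq (a w) (a≢p w)) (eq (b w) (b≢p w)) (adm w)

    unloop : ∀ (W : SignVec E) s {h} → h ≢ p → (W [ p ≔ s ]) h ≡ W h
    unloop W s = ≔-other W p s

    pack : ∀ {Z y} → 𝓛 Z → AdmAll y Z → Extended (Z [ p ≔ y ])
    pack {Z} {y} z adm = resp same z ,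
      subst (λ s → AdmAll s (Z [ p ≔ y ])) (sym (≔-same Z p y)) (admAll-cong (λ h q → sym (unloop Z y q)) adm)
      where
      same : Z ≗ (Z [ p ≔ y ]) [ p ≔ 𝟘 ]
      same h with h ≟ p
      ... | yes refl = p-loop z
      ... | no h≢p   = sym (unloop Z y h≢p)

  extended : IsCovectorFamily Extended
  extended = record
    { resp = λ {X} {Y} eq (x , adm) → resp (≔-cong eq) x ,
        subst (λ s → AdmAll s Y) (eq p) (admAll-cong (λ h _ → eq h) adm)
    ; _∈? = λ W → ((W [ p ≔ 𝟘 ]) ∈?) ×-dec ∀Ω? (λ w → adm? (W p) (W (a w)) (W (b w)))
    ; null = resp (λ h → sym (null-≔ h)) null , λ w → inj₂ refl
    ; negate = λ {X} (x , adm) → resp (neg-≔ X) (negate x) , λ w → adm-neg (X p) (X (a w)) (X (b w)) (adm w)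
    ; compose = λ {X} {Y} (x , adm) (y , adm′) → resp (▹-≔ X Y) (compose x y) ,
        admAll-▹ {X p} {Y p} {X} {Y} adm adm′
    ; eliminate = λ {X} {Y} → eliminate′ X Y
    }
    where
    ≔-cong : ∀ {X Y : SignVec E} → X ≗ Y → (X [ p ≔ 𝟘 ]) ≗ (Y [ p ≔ 𝟘 ])
    ≔-cong eq h with h ≟ p
    ... | yes _ = refl
    ... | no _  = eq h
    null-≔ : (const 𝟘 [ p ≔ 𝟘 ]) ≗ const 𝟘
    null-≔ h with h ≟ p
    ... | yes _ = refl
    ... | no _  = refl
    neg-≔ : ∀ X → (-ᵥ (X [ p ≔ 𝟘 ])) ≗ ((-ᵥ X) [ p ≔ 𝟘 ])
    neg-≔ X h with h ≟ p
    ... | yes _ = refl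
    ... | no _  = refl
    ▹-≔ : ∀ X Y → ((X [ p ≔ 𝟘 ]) ▹ᵥ (Y [ p ≔ 𝟘 ])) ≗ ((X ▹ᵥ Y) [ p ≔ 𝟘 ])
    ▹-≔ X Y h with h ≟ p
    ... | yes _ = refl
    ... | no _  = refl
    eliminate′ : ∀ X Y → Extended X → Extended Y → ∀ e → Opposed (X e) (Y e) →
                 ∃ λ Z → Extended Z × Z e ≡ 𝟘 × (∀ h → ¬ Opposed (X h) (Y h) → Z h ≡ X h ▹ Y h)
    eliminate′ X Y (x , admX) (y , admY) e op = byCases (e ≟ p) (opposed? (X p) (Y p))
      where
      X₀ = X [ p ≔ 𝟘 ]
      Y₀ = Y [ p ≔ 𝟘 ]
      Result = ∃ λ Z → Extended Z × Z e ≡ 𝟘 × (∀ h → ¬ Opposed (X h) (Y h) → Z h ≡ X h ▹ Y h)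
      admX₀ : AdmAll (X p) X₀
      admX₀ = admAll-cong (λ h q → sym (unloop X 𝟘 q)) admX
      admY₀ : AdmAll (Y p) Y₀
      admY₀ = admAll-cong (λ h q → sym (unloop Y 𝟘 q)) admY
      off-p : ∀ {Z h} → h ≢ p → Off X₀ Y₀ Z → ¬ Opposed (X h) (Y h) → Z h ≡ X h ▹ Y h
      off-p {Z} {h} h≢p off q = trans
        (off h (q ∘ subst₂ Opposed (unloop X 𝟘 h≢p) (unloop Y 𝟘 h≢p)))
        (cong₂ _▹_ (unloop X 𝟘 h≢p) (unloop Y 𝟘 h≢p))
      op₀ : e ≢ p → Opposed (X₀ e) (Y₀ e)
      op₀ e≢p = subst₂ Opposed (sym (unloop X 𝟘 e≢p)) (sym (unloop Y 𝟘 e≢p)) op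
      result : ∀ {y} → (¬ Opposed (X p) (Y p) → y ≡ X p ▹ Y p) → e ≢ p → Eliminated y X₀ Y₀ e → Result
      result {y} y≡ e≢p (Z , z , adm , Ze , off) = Z [ p ≔ y ] , pack z adm , trans (unloop Z y e≢p) Ze , off′
        where
        off′ : ∀ h → ¬ Opposed (X h) (Y h) → (Z [ p ≔ y ]) h ≡ X h ▹ Y h
        off′ h q with h ≟ p
        ... | yes refl = y≡ q
        ... | no h≢p   = off-p {Z} h≢p off q
      -- Eliminating `p` itself means crossing its hyperplane.
      at-p : Opposed (X p) (Y p) → ∃ λ A → 𝓛 A × AdmAll 𝟘 A × Off X₀ Y₀ A
      at-p op = signs (X p) (Y p) op admX₀ admY₀
        where
        signs : ∀ s t → Opposed s t → AdmAll s X₀ → AdmAll t Y₀ → ∃ λ A → 𝓛 A × AdmAll 𝟘 A × Off X₀ Y₀ A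
        signs ⊕ ⊖ _ admX admY = cross _ ℕ.≤-refl x y admX admY
        signs ⊖ ⊕ _ admX admY with cross _ ℕ.≤-refl y x admY admX
        ... | A , x′ , adm , off = A , x′ , adm , λ h q →
          trans (off h (q ∘ opposed-sym (Y₀ h) (X₀ h))) (sym (▹-comm (X₀ h) (Y₀ h) q))
        signs 𝟘 _ (q , _) _ _ = contradiction refl q
      byCases : Dec (e ≡ p) → Dec (Opposed (X p) (Y p)) → Result
      byCases (yes refl) _ with at-p op
      ... | A , x′ , adm , off = A [ e ≔ 𝟘 ] , pack x′ adm , ≔-same A e 𝟘 , off′
        where
        off′ : ∀ h → ¬ Opposed (X h) (Y h) → (A [ e ≔ 𝟘 ]) h ≡ X h ▹ Y h
        off′ h q with h ≟ e
        ... | yes refl = contradiction op q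
        ... | no h≢e   = off-p {A} h≢e off q
      -- With `X` and `Y` opposed at `p`, no sign is prescribed there, and any admissible one will
      -- do.
      byCases (no e≢p) (yes op-p) with eliminate x y e (op₀ e≢p)
      ... | Z , z , Ze , off with extend-sign z
      ...   | s , adm = result (λ q → contradiction op-p q) e≢p (Z , z , adm , Ze , off)
      byCases (no e≢p) (no ¬op-p) = result (λ _ → refl) e≢p
        (eliminate-signed x y admX₀ admY₀ ¬op-p (X p ▹ Y p) refl e (op₀ e≢p))

-- Rectangles and facets

lookup-ext : ∀ {A : Set} {n} {v w : Vec A n} → (∀ i → lookup v i ≡ lookup w i) → v ≡ w
lookup-ext {v = v} {w} eq = trans (sym (Vec.tabulate∘lookup v)) (trans (Vec.tabulate-cong eq) (Vec.tabulate∘lookup w))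

vertices-complete : ∀ {n} (v : Cube n) → v ∈ vertices n
vertices-complete Vec.[] = here refl
vertices-complete (Sign.+ Vec.∷ v) = Membership.∈-++⁺ˡ (Membership.∈-map⁺ _ (vertices-complete v))
vertices-complete {suc n} (Sign.- Vec.∷ v) =
  Membership.∈-++⁺ʳ (map (Sign.+ Vec.∷_) (vertices n)) (Membership.∈-map⁺ _ (vertices-complete v))

opposite-≢ : ∀ s → opposite s ≢ s
opposite-≢ Sign.+ ()
opposite-≢ Sign.- ()

≢⇒opposite : ∀ {s t} → s ≢ t → s ≡ opposite t
≢⇒opposite {Sign.+} {Sign.+} p = contradiction refl p
≢⇒opposite {Sign.+} {Sign.-} p = refl
≢⇒opposite {Sign.-} {Sign.+} p = refl
≢⇒opposite {Sign.-} {Sign.-} p = contradiction refl p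

lookup-flip : ∀ {n} (B : Subset n) v i →
              lookup (flip B v) i ≡ (if lookup B i then opposite (lookup v i) else lookup v i)
lookup-flip B v i = Vec.lookup-zipWith _ i B v

lookup-flip-in : ∀ {n} (B : Subset n) v {i} → lookup B i ≡ true → lookup (flip B v) i ≡ opposite (lookup v i)
lookup-flip-in B v {i} q = trans (lookup-flip B v i) (cong (if_then opposite (lookup v i) else lookup v i) q)

lookup-flip-out : ∀ {n} (B : Subset n) v {i} → lookup B i ≡ false → lookup (flip B v) i ≡ lookup v i
lookup-flip-out B v {i} q = trans (lookup-flip B v i) (cong (if_then opposite (lookup v i) else lookup v i) q)

lookup-∪ : ∀ {n} (A B : Subset n) i → lookup (A ∪ B) i ≡ lookup A i ∨ lookup B i
lookup-∪ A B i = Vec.lookup-zipWith _ i A B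

path : ∀ {n} (P : Cube n → Set) {v w : Cube n} →
       (∀ u k → lookup v k ≢ lookup w k → P u → P (u [ k ]≔ lookup w k)) → P v → P w
path P {Vec.[]} {Vec.[]} _ p = p
path P {s Vec.∷ v} {t Vec.∷ w} step p = head (s Sign.≟ t)
  (path (P ∘ (s Vec.∷_)) {v} {w} (λ u k → step (s Vec.∷ u) (Fin.suc k)) p)
  where
  head : Dec (s ≡ t) → P (s Vec.∷ w) → P (t Vec.∷ w)
  head (yes refl) q = q
  head (no s≢t)   q = step (s Vec.∷ w) Fin.zero s≢t q

≡-at : ∀ {A : Set} {n} {v w : Vec A n} i → v ≡ w → lookup v i ≡ lookup w i
≡-at i = cong (λ v → lookup v i)

-- The signs of the affine function 1 + s x_i on the cube. The support is the facet with sign `s`;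
-- the zero set is the opposite facet.
facetVec : ∀ {n} → Fin n → Sign → SignVec (Cube n)
facetVec i s v = if does (lookup v i Sign.≟ s) then ⊕ else 𝟘

facetVec-on : ∀ {n} (i : Fin n) s v → lookup v i ≡ s → facetVec i s v ≡ ⊕
facetVec-on i s v q = cong (if_then ⊕ else 𝟘) (dec-true (lookup v i Sign.≟ s) q)

facetVec-off : ∀ {n} (i : Fin n) s v → lookup v i ≢ s → facetVec i s v ≡ 𝟘
facetVec-off i s v q = cong (if_then ⊕ else 𝟘) (dec-false (lookup v i Sign.≟ s) q)

facetVec-supp : ∀ {n} (i : Fin n) s v → facetVec i s v ≢ 𝟘 → lookup v i ≡ s
facetVec-supp i s v q with lookup v i Sign.≟ s
... | yes r = r
... | no _  = contradiction refl q

toSgn : Sign → Sgn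
toSgn Sign.+ = ⊕
toSgn Sign.- = ⊖

toSgn≢𝟘 : ∀ s → toSgn s ≢ 𝟘
toSgn≢𝟘 Sign.+ ()
toSgn≢𝟘 Sign.- ()

-- The signs of the linear function x_i - s x_j, which equals 2 x_i at the vertices off the
-- skew-facet.
skewVec : ∀ {n} → Fin n → Fin n → Sign → SignVec (Cube n)
skewVec i j s v = if does (lookup v i Sign.≟ s Sign.* lookup v j) then 𝟘 else toSgn (lookup v i)

-- The case `p` equal to `q` is included: it says that a single common element is impossible.
two-point : ∀ {E : Set} {X F : SignVec E} → X ⊥ F → ∀ p q → (∀ h → X h · F h ≢ 𝟘 → h ≡ p ⊎ h ≡ q) →
            X p · F p ≡ neg (X q · F q)
two-point (inj₁ z) p q _ = trans (z p) (sym (cong neg (z q)))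
two-point {X = X} {F} (inj₂ ((e , e⊕) , (f , f⊖))) p q only =
  cases (only e (λ r → contradiction (trans (sym e⊕) r) λ ())) (only f (λ r → contradiction (trans (sym f⊖) r) λ ()))
  where
  cases : e ≡ p ⊎ e ≡ q → f ≡ p ⊎ f ≡ q → X p · F p ≡ neg (X q · F q)
  cases (inj₁ refl) (inj₁ refl) = contradiction (trans (sym e⊕) f⊖) λ ()
  cases (inj₁ refl) (inj₂ refl) = trans e⊕ (cong neg (sym f⊖))
  cases (inj₂ refl) (inj₁ refl) = trans f⊖ (cong neg (sym e⊕))
  cases (inj₂ refl) (inj₂ refl) = contradiction (trans (sym e⊕) f⊖) λ ()

module Rectangle {n} (v : Cube n) (A B : Subset n) {a b : Fin n}
                 (Aa : lookup A a ≡ true) (Ba : lookup B a ≡ false)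
                 (Ab : lookup A b ≡ false) (Bb : lookup B b ≡ true) where

  open DecMembership (_≟ᵥ_ {n}) using (_∈?_)

  p₂ q₁ q₂ : Cube n
  p₂ = flip (A ∪ B) v
  q₁ = flip A v
  q₂ = flip B v

  p₂-a : lookup p₂ a ≡ opposite (lookup v a)
  p₂-a = lookup-flip-in (A ∪ B) v (trans (lookup-∪ A B a) (cong₂ _∨_ Aa Ba))
  p₂-b : lookup p₂ b ≡ opposite (lookup v b)
  p₂-b = lookup-flip-in (A ∪ B) v (trans (lookup-∪ A B b) (cong₂ _∨_ Ab Bb))
  q₁-a : lookup q₁ a ≡ opposite (lookup v a)
  q₁-a = lookup-flip-in A v Aa
  q₁-b : lookup q₁ b ≡ lookup v b
  q₁-b = lookup-flip-out A v Ab
  q₂-a : lookup q₂ a ≡ lookup v a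
  q₂-a = lookup-flip-out B v Ba
  q₂-b : lookup q₂ b ≡ opposite (lookup v b)
  q₂-b = lookup-flip-in B v Bb

  q₁≢v : q₁ ≢ v
  q₁≢v q = opposite-≢ (lookup v a) (trans (sym q₁-a) (≡-at a q))
  q₂≢v : q₂ ≢ v
  q₂≢v q = opposite-≢ (lookup v b) (trans (sym q₂-b) (≡-at b q))
  q₁≢p₂ : q₁ ≢ p₂
  q₁≢p₂ q = opposite-≢ (lookup v b) (trans (sym p₂-b) (trans (sym (≡-at b q)) q₁-b))
  q₂≢p₂ : q₂ ≢ p₂
  q₂≢p₂ q = opposite-≢ (lookup v a) (trans (sym p₂-a) (trans (sym (≡-at a q)) q₂-a))

  P N : List (Cube n)
  P = v ∷ p₂ ∷ []
  N = q₁ ∷ q₂ ∷ []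

  R : SignVec (Cube n)
  R = rectangle v A B

  R-P : ∀ {w} → w ∈ P → R w ≡ ⊕
  R-P {w} q = cong (if_then ⊕ else (if does (w ∈? N) then ⊖ else 𝟘)) (dec-true (w ∈? P) q)

  R-N : ∀ {w} → ¬ w ∈ P → w ∈ N → R w ≡ ⊖
  R-N {w} q r = trans (cong (if_then ⊕ else (if does (w ∈? N) then ⊖ else 𝟘)) (dec-false (w ∈? P) q))
    (cong (if_then ⊖ else 𝟘) (dec-true (w ∈? N) r))

  R-𝟘 : ∀ {w} → ¬ w ∈ P → ¬ w ∈ N → R w ≡ 𝟘
  R-𝟘 {w} q r = trans (cong (if_then ⊕ else (if does (w ∈? N) then ⊖ else 𝟘)) (dec-false (w ∈? P) q))
    (cong (if_then ⊖ else 𝟘) (dec-false (w ∈? N) r))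

  q₁∉P : ¬ q₁ ∈ P
  q₁∉P (here q) = q₁≢v q
  q₁∉P (there (here q)) = q₁≢p₂ q
  q₂∉P : ¬ q₂ ∈ P
  q₂∉P (here q) = q₂≢v q
  q₂∉P (there (here q)) = q₂≢p₂ q

  Rv : R v ≡ ⊕
  Rv = R-P (here refl)
  Rp₂ : R p₂ ≡ ⊕
  Rp₂ = R-P (there (here refl))
  Rq₁ : R q₁ ≡ ⊖
  Rq₁ = R-N q₁∉P (here refl)
  Rq₂ : R q₂ ≡ ⊖
  Rq₂ = R-N q₂∉P (there (here refl))

  Corner : Cube n → Set
  Corner w = w ≡ v ⊎ w ≡ p₂ ⊎ w ≡ q₁ ⊎ w ≡ q₂

  corner? : ∀ w → Dec (Corner w)
  corner? w = (w ≟ᵥ v) ⊎-dec ((w ≟ᵥ p₂) ⊎-dec ((w ≟ᵥ q₁) ⊎-dec (w ≟ᵥ q₂)))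

  off-corner : ∀ {w} → ¬ Corner w → R w ≡ 𝟘
  off-corner ¬c = R-𝟘
    (λ { (here q) → ¬c (inj₁ q) ; (there (here q)) → ¬c (inj₂ (inj₁ q)) })
    (λ { (here q) → ¬c (inj₂ (inj₂ (inj₁ q))) ; (there (here q)) → ¬c (inj₂ (inj₂ (inj₂ q))) })

  -- Orthogonality to the facets through a and b forces the signs of X.
  module _ {X : SignVec (Cube n)} (corners : ∀ w → X w ≢ 𝟘 → Corner w)
           (X⊥ : ∀ i s → X ⊥ facetVec i s) where

    private
      opposed-at : ∀ i s p q → p ≢ q → lookup p i ≡ s → lookup q i ≡ s →
                   (∀ w → Corner w → lookup w i ≡ s → w ≡ p ⊎ w ≡ q) → X p ≡ neg (X q)
      opposed-at i s p q _ pi qi only = strip (X p) (X q) _ _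
        (facetVec-on i s p pi) (facetVec-on i s q qi)
        (two-point {X = X} {facetVec i s} (X⊥ i s) p q λ h r →
          only h (corners h (λ Xh → r (cong (_· facetVec i s h) Xh)))
                 (facetVec-supp i s h (λ Fh → r (trans (cong (X h ·_) Fh) (·-zeroʳ (X h))))))
        where
        strip : ∀ x y f g → f ≡ ⊕ → g ≡ ⊕ → x · f ≡ neg (y · g) → x ≡ neg y
        strip = by-signs

      Xq₂ : X v ≡ neg (X q₂)
      Xq₂ = opposed-at a (lookup v a) v q₂ (q₂≢v ∘ sym) refl q₂-a λ where
        w (inj₁ q) _ → inj₁ q
        w (inj₂ (inj₁ refl)) r → contradiction r (λ r → opposite-≢ _ (trans (sym p₂-a) r))
        w (inj₂ (inj₂ (inj₁ refl))) r → contradiction r (λ r → opposite-≢ _ (trans (sym q₁-a) r))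
        w (inj₂ (inj₂ (inj₂ q))) _ → inj₂ q

      Xq₁ : X v ≡ neg (X q₁)
      Xq₁ = opposed-at b (lookup v b) v q₁ (q₁≢v ∘ sym) refl q₁-b λ where
        w (inj₁ q) _ → inj₁ q
        w (inj₂ (inj₁ refl)) r → contradiction r (λ r → opposite-≢ _ (trans (sym p₂-b) r))
        w (inj₂ (inj₂ (inj₁ q))) _ → inj₂ q
        w (inj₂ (inj₂ (inj₂ refl))) r → contradiction r (λ r → opposite-≢ _ (trans (sym q₂-b) r))

      Xp₂ : X q₁ ≡ neg (X p₂)
      Xp₂ = opposed-at a (opposite (lookup v a)) q₁ p₂ q₁≢p₂ q₁-a p₂-a λ where
        w (inj₁ refl) r → contradiction r (λ r → opposite-≢ (lookup v a) (sym r))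
        w (inj₂ (inj₁ q)) _ → inj₂ q
        w (inj₂ (inj₂ (inj₁ q))) _ → inj₁ q
        w (inj₂ (inj₂ (inj₂ refl))) r → contradiction r (λ r → opposite-≢ (lookup v a) (trans (sym r) q₂-a))

      negated : ∀ x q → x ≡ neg q → q ≡ x · ⊖
      negated = by-signs

    scaled : ∀ w → X w ≡ X v · R w
    scaled w with corner? w
    ... | no ¬c = trans (decidable-stable (X w ≟ₛ 𝟘) (λ q → ¬c (corners w q)))
                        (sym (trans (cong (X v ·_) (off-corner ¬c)) (·-zeroʳ (X v))))
    ... | yes (inj₁ refl) = trans (sym (·-identityʳ (X v))) (cong (X v ·_) (sym Rv))
    ... | yes (inj₂ (inj₁ refl)) = trans (twice (X v) (X q₁) (X p₂) Xq₁ Xp₂) (cong (X v ·_) (sym Rp₂))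
      where
      twice : ∀ x q p → x ≡ neg q → q ≡ neg p → p ≡ x · ⊕
      twice = by-signs
    ... | yes (inj₂ (inj₂ (inj₁ refl))) = trans (negated (X v) (X q₁) Xq₁) (cong (X v ·_) (sym Rq₁))
    ... | yes (inj₂ (inj₂ (inj₂ refl))) = trans (negated (X v) (X q₂) Xq₂) (cong (X v ·_) (sym Rq₂))

  -- The rectangle is the difference of two parallel edges, from `v` to `q₁` and from `q₂` to `p₂`.
  -- Orthogonality to it prevents these edges from forcing different signs at their common point at
  -- infinity.
  corner-sum : ∀ {Z} → R ⊥ Z → ∃ λ y → Adm y (Z v) (Z q₁) × Adm y (Z q₂) (Z p₂)
  corner-sum {Z} (inj₁ z) = 𝟘 , inj₂ (zeros (Z v) (Z q₁) (cancel v (z v) (λ q → contradiction (trans (sym Rv) q) λ ()))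
                                                   (cancel q₁ (z q₁) (λ q → contradiction (trans (sym Rq₁) q) λ ()))) ,
                                inj₂ (zeros (Z q₂) (Z p₂) (cancel q₂ (z q₂) (λ q → contradiction (trans (sym Rq₂) q) λ ()))
                                                          (cancel p₂ (z p₂) (λ q → contradiction (trans (sym Rp₂) q) λ ())))
    where
    cancel : ∀ w → R w · Z w ≡ 𝟘 → R w ≢ 𝟘 → Z w ≡ 𝟘
    cancel w p q = ·-cancelˡ (R w) (Z w) q p
    zeros : ∀ s t → s ≡ 𝟘 → t ≡ 𝟘 → 𝟘 ≡ s ▹ neg t
    zeros _ _ refl refl = refl
  corner-sum {Z} (inj₂ ((e , e⊕) , (f , f⊖))) = choose (Z v) (Z q₁) (Z q₂) (Z p₂) (at e (λ ()) e⊕) (at f (λ ()) f⊖)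
    where
    at : ∀ w {s} → s ≢ 𝟘 → R w · Z w ≡ s → Z v ≡ s ⊎ Z q₁ ≡ neg s ⊎ Z q₂ ≡ neg s ⊎ Z p₂ ≡ s
    at w s≢𝟘 eq with corner? w
    ... | no ¬c = contradiction (trans (sym eq) (cong (_· Z w) (off-corner ¬c))) s≢𝟘
    ... | yes (inj₁ refl) = inj₁ (trans (cong (_· Z v) (sym Rv)) eq)
    ... | yes (inj₂ (inj₁ refl)) = inj₂ (inj₂ (inj₂ (trans (cong (_· Z p₂) (sym Rp₂)) eq)))
    ... | yes (inj₂ (inj₂ (inj₁ refl))) =
      inj₂ (inj₁ (trans (sym (neg-neg (Z q₁))) (cong neg (trans (cong (_· Z q₁) (sym Rq₁)) eq))))
    ... | yes (inj₂ (inj₂ (inj₂ refl))) =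
      inj₂ (inj₂ (inj₁ (trans (sym (neg-neg (Z q₂))) (cong neg (trans (cong (_· Z q₂) (sym Rq₂)) eq)))))
    choose : ∀ s t s′ t′ → s ≡ ⊕ ⊎ t ≡ ⊖ ⊎ s′ ≡ ⊖ ⊎ t′ ≡ ⊕ → s ≡ ⊖ ⊎ t ≡ ⊕ ⊎ s′ ≡ ⊕ ⊎ t′ ≡ ⊖ →
             ∃ λ y → Adm y s t × Adm y s′ t′
    choose = by-signs

module _ {n : ℕ} where

  ∃-vertex? : {P : Cube n → Set} → (∀ v → Dec (P v)) → Dec (∃ P)
  ∃-vertex? = Finite.∃-element? _≟ᵥ_ (vertices n) vertices-complete

  _⁺_ _⁻_ : Cube n → Fin n → Cube n
  v ⁺ i = v [ i ]≔ Sign.+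
  v ⁻ i = v [ i ]≔ Sign.-

  -- The rectangles that compare edges in a coordinate direction, for an arbitrary family, since
  -- both the real cube and oriented cubes have them.
  AxisRectangles : (SignVec (Cube n) → Set) → Set
  AxisRectangles 𝒞 = ∀ v i B → Nonempty B → Empty (⁅ i ⁆ ∩ B) → 𝒞 (rectangle v ⁅ i ⁆ B)

  Consistent : SignVec (Cube n) → Set
  Consistent Z = ∀ i w u → ∃ λ y → Adm y (Z (w ⁺ i)) (Z (w ⁻ i)) × Adm y (Z (u ⁺ i)) (Z (u ⁻ i))

  difference : Cube n → Cube n → Subset n
  difference v w = Vec.zipWith (λ s t → if does (s Sign.≟ t) then false else true) v w

  lookup-⁅⁆-other : ∀ (i j : Fin n) → j ≢ i → lookup ⁅ i ⁆ j ≡ false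
  lookup-⁅⁆-other i j j≢i with lookup ⁅ i ⁆ j in eq
  ... | false = refl
  ... | true  = contradiction (Subset.x∈⁅y⁆⇒x≡y i (Vec.lookup⇒[]= j ⁅ i ⁆ eq)) j≢i

  lookup-⁅⁆ : ∀ (i : Fin n) → lookup ⁅ i ⁆ i ≡ true
  lookup-⁅⁆ i = Vec.[]=⇒lookup (Subset.x∈⁅x⁆ i)

  lookup-difference : ∀ v w i → lookup (difference v w) i ≡ (if does (lookup v i Sign.≟ lookup w i) then false else true)
  lookup-difference v w i = Vec.lookup-zipWith _ i v w

  difference-same : ∀ v w {i} → lookup v i ≡ lookup w i → lookup (difference v w) i ≡ false
  difference-same v w {i} q = trans (lookup-difference v w i)
    (cong (if_then false else true) (dec-true (lookup v i Sign.≟ lookup w i) q))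

  difference-other : ∀ v w {i} → lookup v i ≢ lookup w i → lookup (difference v w) i ≡ true
  difference-other v w {i} q = trans (lookup-difference v w i)
    (cong (if_then false else true) (dec-false (lookup v i Sign.≟ lookup w i) q))

  flip-difference : ∀ v w → flip (difference v w) v ≡ w
  flip-difference v w = lookup-ext λ i → at i (lookup v i Sign.≟ lookup w i)
    where
    at : ∀ i → Dec (lookup v i ≡ lookup w i) → lookup (flip (difference v w) v) i ≡ lookup w i
    at i (yes q) = trans (lookup-flip-out (difference v w) v (difference-same v w q)) q
    at i (no q)  = trans (lookup-flip-in (difference v w) v (difference-other v w q))
                         (sym (≢⇒opposite (q ∘ sym)))

  flip-axis : ∀ v i → lookup v i ≡ Sign.+ → flip ⁅ i ⁆ v ≡ v ⁻ i
  flip-axis v i vi = lookup-ext λ j → at j (j Fin.≟ i)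
    where
    at : ∀ j → Dec (j ≡ i) → lookup (flip ⁅ i ⁆ v) j ≡ lookup (v ⁻ i) j
    at j (yes refl) = trans (lookup-flip-in ⁅ i ⁆ v (lookup-⁅⁆ i))
      (trans (cong opposite vi) (sym (Vec.lookup∘update i v Sign.-)))
    at j (no q) = trans (lookup-flip-out ⁅ i ⁆ v (lookup-⁅⁆-other i j q)) (sym (Vec.lookup∘update′ q v Sign.-))

  update-twice : ∀ (v : Cube n) i s t → (v [ i ]≔ s) [ i ]≔ t ≡ v [ i ]≔ t
  update-twice v i s t = Vec.[]≔-idempotent v i

  -- Two different edges in direction `i` are opposite sides of a rectangle, whose other side flips
  -- the coordinates in which they differ.
  consistent : ∀ {𝒞} → AxisRectangles 𝒞 → ∀ {Z} → Perp 𝒞 Z → Consistent Z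
  consistent {𝒞} rectangles {Z} z i w u with (w ⁺ i) ≟ᵥ (u ⁺ i)
  ... | yes eq = Z (w ⁺ i) ▹ neg (Z (w ⁻ i)) , inj₂ refl ,
    subst (λ x → Adm _ (Z x) (Z (u ⁻ i))) eq (subst (λ x → Adm _ _ (Z x)) minus (inj₂ refl))
    where
    minus : w ⁻ i ≡ u ⁻ i
    minus = trans (sym (update-twice w i Sign.+ Sign.-)) (trans (cong (_⁻ i) eq) (update-twice u i Sign.+ Sign.-))
  ... | no w≢u = proj₁ sum , subst (λ x → Adm (proj₁ sum) (Z (w ⁺ i)) (Z x)) q₁≡ (proj₁ (proj₂ sum)) ,
    subst₂ (λ x x′ → Adm (proj₁ sum) (Z x) (Z x′)) (flip-difference (w ⁺ i) (u ⁺ i)) p₂≡ (proj₂ (proj₂ sum))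
    where
    v = w ⁺ i
    B = difference v (u ⁺ i)
    vi : lookup v i ≡ Sign.+
    vi = Vec.lookup∘update i w Sign.+
    differ : ∃ λ b → lookup v b ≢ lookup (u ⁺ i) b
    differ with Fin.any? (λ b → ¬? (lookup v b Sign.≟ lookup (u ⁺ i) b))
    ... | yes q = q
    ... | no none = contradiction (lookup-ext λ b →
      decidable-stable (lookup v b Sign.≟ lookup (u ⁺ i) b) λ q → none (b , q)) w≢u
    b = proj₁ differ
    Bb : lookup B b ≡ true
    Bb = difference-other v (u ⁺ i) (proj₂ differ)
    Bi : lookup B i ≡ false
    Bi = difference-same v (u ⁺ i) (trans vi (sym (Vec.lookup∘update i u Sign.+)))
    b≢i : b ≢ i
    b≢i q = contradiction (trans (sym Bb) (trans (cong (lookup B) q) Bi)) λ ()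
    disjoint : Empty (⁅ i ⁆ ∩ B)
    disjoint (x , x∈) with Subset.x∈p∩q⁻ ⁅ i ⁆ B x∈
    ... | x∈i , x∈B with Subset.x∈⁅y⁆⇒x≡y i x∈i
    ...   | refl = contradiction (trans (sym (Vec.[]=⇒lookup x∈B)) Bi) λ ()
    open Rectangle v ⁅ i ⁆ B (lookup-⁅⁆ i) Bi (lookup-⁅⁆-other i b b≢i) Bb
    sum = corner-sum {Z} (z (rectangle v ⁅ i ⁆ B) (rectangles v i B (b , Vec.lookup⇒[]= b B Bb) disjoint))
    q₁≡ : q₁ ≡ w ⁻ i
    q₁≡ = trans (flip-axis v i vi) (update-twice w i Sign.+ Sign.-)
    p₂≡ : p₂ ≡ u ⁻ i
    p₂≡ = lookup-ext λ j → at j (j Fin.≟ i)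
      where
      at : ∀ j → Dec (j ≡ i) → lookup p₂ j ≡ lookup (u ⁻ i) j
      at j (yes refl) = trans p₂-a (trans (cong opposite vi) (sym (Vec.lookup∘update i u Sign.-)))
      at j (no q) = begin
        lookup p₂ j
          ≡⟨ lookup-flip (⁅ i ⁆ ∪ B) v j ⟩
        (if lookup (⁅ i ⁆ ∪ B) j then opposite (lookup v j) else lookup v j)
          ≡⟨ cong (if_then opposite (lookup v j) else lookup v j) (lookup-∪ ⁅ i ⁆ B j) ⟩
        (if lookup ⁅ i ⁆ j ∨ lookup B j then opposite (lookup v j) else lookup v j)
          ≡⟨ cong (λ x → if x ∨ lookup B j then opposite (lookup v j) else lookup v j) (lookup-⁅⁆-other i j q) ⟩
        (if lookup B j then opposite (lookup v j) else lookup v j)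
          ≡⟨ lookup-flip B v j ⟨
        lookup q₂ j
          ≡⟨ cong (λ x → lookup x j) (flip-difference v (u ⁺ i)) ⟩
        lookup (u ⁺ i) j
          ≡⟨ Vec.lookup∘update′ q u Sign.+ ⟩
        lookup u j
          ≡⟨ Vec.lookup∘update′ q u Sign.- ⟨
        lookup (u ⁻ i) j ∎
        where open ≡-Reasoning

  direction : ∀ {Z} → Consistent Z → ∀ i → ∃ λ y → ∀ w → Adm y (Z (w ⁺ i)) (Z (w ⁻ i))
  direction {Z} cons i = common-sign ∃-vertex? (λ w → Z (w ⁺ i)) (λ w → Z (w ⁻ i)) (cons i)

  at-sign : ∀ (v : Cube n) i {s} → lookup v i ≡ s → v [ i ]≔ s ≡ v
  at-sign v i refl = Vec.[]≔-lookup v i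

  private
    adm-right : ∀ y s t → Adm y s t → t ≡ 𝟘 → s ≡ y
    adm-right = by-signs
    adm-left : ∀ y s t → Adm y s t → s ≡ 𝟘 → t ≡ neg y
    adm-left = by-signs
    ·-⊖ : ∀ y → y · ⊖ ≡ neg y
    ·-⊖ = by-signs

  -- A covector with the zeros of a facet or of a skew-facet is determined by its
  -- sign in a single direction.
  zero-flipped : ∀ {Z : SignVec (Cube n)} {y} i → (∀ w → Adm y (Z (w ⁺ i)) (Z (w ⁻ i))) →
                 ∀ v → Z (v [ i ]≔ opposite (lookup v i)) ≡ 𝟘 → Z v ≡ y · toSgn (lookup v i)
  zero-flipped {Z} {y} i adm v q with lookup v i in eq
  ... | Sign.+ = trans (adm-right y (Z v) _ (subst (λ x → Adm y (Z x) (Z (v ⁻ i))) (at-sign v i eq) (adm v)) q)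
                       (sym (·-identityʳ y))
  ... | Sign.- = trans (adm-left y _ (Z v) (subst (λ x → Adm y (Z (v ⁺ i)) (Z x)) (at-sign v i eq) (adm v)) q)
                       (sym (·-⊖ y))

  like-facet : ∀ {Z} → Consistent Z → ∀ i s → (∀ v → lookup v i ≢ s → Z v ≡ 𝟘) →
               ∃ λ y → ∀ v → Z v ≡ y · facetVec i s v
  like-facet {Z} cons i s off with direction {Z} cons i
  ... | y , adm = y · toSgn s , λ v → at v (lookup v i Sign.≟ s)
    where
    at : ∀ v → Dec (lookup v i ≡ s) → Z v ≡ (y · toSgn s) · facetVec i s v
    at v (no q) = trans (off v q) (sym (trans (cong ((y · toSgn s) ·_) (facetVec-off i s v q)) (·-zeroʳ (y · toSgn s))))
    at v (yes refl) = trans (zero-flipped {Z} i adm v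
        (off _ (λ q → opposite-≢ (lookup v i) (trans (sym (Vec.lookup∘update i v _)) q))))
      (sym (trans (cong ((y · toSgn s) ·_) (facetVec-on i s v refl)) (·-identityʳ (y · toSgn s))))

  like-skew : ∀ {Z} → Consistent Z → ∀ i j s → i ≢ j → (∀ v → lookup v i ≡ s Sign.* lookup v j → Z v ≡ 𝟘) →
              ∃ λ y → ∀ v → Z v ≡ y · skewVec i j s v
  like-skew {Z} cons i j s i≢j on with direction {Z} cons i
  ... | y , adm = y , at
    where
    at : ∀ v → Z v ≡ y · skewVec i j s v
    at v with lookup v i Sign.≟ s Sign.* lookup v j
    ... | yes q = trans (on v q) (sym (·-zeroʳ y))
    ... | no q  = zero-flipped {Z} i adm v (on _ (begin
      lookup (v [ i ]≔ opposite (lookup v i)) i              ≡⟨ Vec.lookup∘update i v _ ⟩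
      opposite (lookup v i)                                  ≡⟨ sym (≢⇒opposite (q ∘ sym)) ⟩
      s Sign.* lookup v j                                    ≡⟨ cong (s Sign.*_) (Vec.lookup∘update′ (i≢j ∘ sym) v _) ⟨
      s Sign.* lookup (v [ i ]≔ opposite (lookup v i)) j     ∎))
      where open ≡-Reasoning

  skewVec-supp : ∀ i j s (v : Cube n) → skewVec i j s v ≢ 𝟘 → lookup v i ≢ s Sign.* lookup v j
  skewVec-supp i j s v q with lookup v i Sign.≟ s Sign.* lookup v j
  ... | yes _ = contradiction refl q
  ... | no r  = r

-- The real cube

sgn-pos : ∀ {q} → 0ℚ ℚ.< q → sgn q ≡ ⊕
sgn-pos {q} 0<q with ℚ.<-cmp q 0ℚ
... | tri< q<0 _ _ = contradiction (ℚ.<-trans 0<q q<0) (ℚ.<-irrefl refl)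
... | tri≈ _ q≡0 _ = contradiction (sym q≡0) (ℚ.<⇒≢ 0<q)
... | tri> _ _ _   = refl

sgn-neg : ∀ {q} → q ℚ.< 0ℚ → sgn q ≡ ⊖
sgn-neg {q} q<0 with ℚ.<-cmp q 0ℚ
... | tri< _ _ _   = refl
... | tri≈ _ q≡0 _ = contradiction q≡0 (ℚ.<⇒≢ q<0)
... | tri> _ _ 0<q = contradiction (ℚ.<-trans 0<q q<0) (ℚ.<-irrefl refl)

sgn-double : ∀ q → sgn (q ℚ.+ q) ≡ sgn q
sgn-double q with ℚ.<-cmp q 0ℚ
... | tri< q<0 _ _  = sgn-neg (ℚ.+-mono-< q<0 q<0)
... | tri≈ _ refl _ = refl
... | tri> _ _ 0<q  = sgn-pos (ℚ.+-mono-< 0<q 0<q)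

module _ {E : Set} where

  sum : List E → (E → ℚ) → ℚ
  sum L f = foldr ℚ._+_ 0ℚ (map f L)

  sum-cong : ∀ L {f g} → f ≗ g → sum L f ≡ sum L g
  sum-cong []      eq = refl
  sum-cong (e ∷ L) eq = cong₂ ℚ._+_ (eq e) (sum-cong L eq)

  sum-+ : ∀ L f g → sum L (λ e → f e ℚ.+ g e) ≡ sum L f ℚ.+ sum L g
  sum-+ []      f g = refl
  sum-+ (e ∷ L) f g = trans (cong (f e ℚ.+ g e ℚ.+_) (sum-+ L f g))
    (solve 4 (λ x y s t → x :+ y :+ (s :+ t) := x :+ s :+ (y :+ t)) refl (f e) (g e) (sum L f) (sum L g))
    where open +-*-Solver

  sum-* : ∀ L k f → sum L (λ e → k ℚ.* f e) ≡ k ℚ.* sum L f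
  sum-* []      k f = sym (ℚ.*-zeroʳ k)
  sum-* (e ∷ L) k f = trans (cong (k ℚ.* f e ℚ.+_) (sum-* L k f)) (sym (ℚ.*-distribˡ-+ k (f e) (sum L f)))

  sum-0 : ∀ L → sum L (const 0ℚ) ≡ 0ℚ
  sum-0 []      = refl
  sum-0 (e ∷ L) = trans (ℚ.+-identityˡ _) (sum-0 L)

  sum-++ : ∀ L L′ f → sum (L ++ L′) f ≡ sum L f ℚ.+ sum L′ f
  sum-++ []      L′ f = sym (ℚ.+-identityˡ _)
  sum-++ (e ∷ L) L′ f = trans (cong (f e ℚ.+_) (sum-++ L L′ f)) (sym (ℚ.+-assoc (f e) (sum L f) (sum L′ f)))

  sum-nonneg : ∀ L {f} → (∀ e → 0ℚ ℚ.≤ f e) → 0ℚ ℚ.≤ sum L f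
  sum-nonneg []      p = ℚ.≤-refl
  sum-nonneg (e ∷ L) p = ℚ.+-mono-≤ (p e) (sum-nonneg L p)

  sum-pos : ∀ {L f} → (∀ e → 0ℚ ℚ.≤ f e) → Any (λ e → 0ℚ ℚ.< f e) L → 0ℚ ℚ.< sum L f
  sum-pos {e ∷ L} p (here q)  = ℚ.+-mono-<-≤ q (sum-nonneg L p)
  sum-pos {e ∷ L} p (there q) = ℚ.+-mono-≤-< (p e) (sum-pos p q)

sum-map : ∀ {E F : Set} (L : List E) (h : E → F) f → sum (map h L) f ≡ sum L (f ∘ h)
sum-map []      h f = refl
sum-map (e ∷ L) h f = cong (f (h e) ℚ.+_) (sum-map L h f)

module _ {E : Set} {L : List E} (complete : ∀ e → e ∈ L) where

  private
    no-sign-change : ∀ f → sum L f ≡ 0ℚ → (∀ e → ¬ f e ℚ.< 0ℚ) → ∀ e → ¬ 0ℚ ℚ.< f e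
    no-sign-change f Σ≡0 nonneg e q = ℚ.<-irrefl (sym Σ≡0)
      (sum-pos (λ e → ℚ.≮⇒≥ (nonneg e)) (Any.map (λ { refl → q }) (complete e)))

  balanced : ∀ f → sum L f ≡ 0ℚ →
             (∀ e → sgn (f e) ≡ 𝟘) ⊎ (∃ λ e → sgn (f e) ≡ ⊕) × (∃ λ e → sgn (f e) ≡ ⊖)
  balanced f Σ≡0 with any? (λ e → 0ℚ ℚ.<? f e) L | any? (λ e → f e ℚ.<? 0ℚ) L
  ... | yes p | yes m = inj₂ ((_ , sgn-pos (proj₂ (Any.satisfied p))) , (_ , sgn-neg (proj₂ (Any.satisfied m))))
  ... | yes p | no ¬m = contradiction (proj₂ (Any.satisfied p))
    (no-sign-change f Σ≡0 (λ e q → ¬m (Any.map (λ { refl → q }) (complete e))) _)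
  ... | no ¬p | yes m = contradiction (ℚ.neg-antimono-< (proj₂ (Any.satisfied m)))
    (no-sign-change (λ e → ℚ.- f e)
      (trans (sum-cong L (λ e → sym (neg-one (f e)))) (trans (sum-* L (ℚ.- 1ℚ) f) (cong (ℚ.- 1ℚ ℚ.*_) Σ≡0)))
      (λ e q → ¬p (Any.map (λ { refl → unneg (f e) (ℚ.neg-antimono-< q) }) (complete e))) _)
    where
    open +-*-Solver
    neg-one : ∀ x → ℚ.- 1ℚ ℚ.* x ≡ ℚ.- x
    neg-one = solve 1 (λ x → :- con 1ℚ :* x := :- x) refl
    unneg : ∀ x → 0ℚ ℚ.< ℚ.- (ℚ.- x) → 0ℚ ℚ.< x
    unneg x = subst (0ℚ ℚ.<_) (solve 1 (λ x → :- (:- x) := x) refl x)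
  ... | no ¬p | no ¬m = inj₁ zero-sign
    where
    zero-sign : ∀ e → sgn (f e) ≡ 𝟘
    zero-sign e with ℚ.<-cmp (f e) 0ℚ
    ... | tri< q _ _ = contradiction (Any.map (λ { refl → q }) (complete e)) ¬m
    ... | tri≈ _ _ _ = refl
    ... | tri> _ _ q = contradiction (Any.map (λ { refl → q }) (complete e)) ¬p

δ : ∀ {n} → Cube n → Cube n → ℚ
δ v w = if does (w ≟ᵥ v) then 1ℚ else 0ℚ

δ-same : ∀ {n} (v : Cube n) → δ v v ≡ 1ℚ
δ-same v = cong (if_then 1ℚ else 0ℚ) (dec-true (v ≟ᵥ v) refl)

δ-other : ∀ {n} (v w : Cube n) → w ≢ v → δ v w ≡ 0ℚ
δ-other v w q = cong (if_then 1ℚ else 0ℚ) (dec-false (w ≟ᵥ v) q)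

sum-δ : ∀ {n} (v : Cube n) (g : Cube n → ℚ) → sum (vertices n) (λ w → δ v w ℚ.* g w) ≡ g v
sum-δ Vec.[] g = solve 1 (λ x → con 1ℚ :* x :+ con 0ℚ := x) refl (g Vec.[])
  where open +-*-Solver
sum-δ {suc n} (s Vec.∷ v) g = begin
  sum (map (Sign.+ Vec.∷_) V ++ map (Sign.- Vec.∷_) V) f
    ≡⟨ sum-++ (map (Sign.+ Vec.∷_) V) _ f ⟩
  sum (map (Sign.+ Vec.∷_) V) f ℚ.+ sum (map (Sign.- Vec.∷_) V) f
    ≡⟨ cong₂ ℚ._+_ (sum-map V _ f) (sum-map V _ f) ⟩
  sum V (λ w → f (Sign.+ Vec.∷ w)) ℚ.+ sum V (λ w → f (Sign.- Vec.∷ w))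
    ≡⟨ byHead s refl ⟩
  g (s Vec.∷ v) ∎
  where
  open ≡-Reasoning
  V = vertices n
  f : Cube (suc n) → ℚ
  f w = δ (s Vec.∷ v) w ℚ.* g w
  same : ∀ w → δ (s Vec.∷ v) (s Vec.∷ w) ≡ δ v w
  same w = byCases (w ≟ᵥ v)
    where
    byCases : Dec (w ≡ v) → δ (s Vec.∷ v) (s Vec.∷ w) ≡ δ v w
    byCases (yes refl) = trans (δ-same (s Vec.∷ v)) (sym (δ-same v))
    byCases (no w≢v)   = trans (δ-other (s Vec.∷ v) (s Vec.∷ w) (λ q → w≢v (cong Vec.tail q))) (sym (δ-other v w w≢v))
  matching : ∀ t → t ≡ s → sum V (λ w → f (t Vec.∷ w)) ≡ g (s Vec.∷ v)
  matching t refl = trans (sum-cong V λ w → cong (ℚ._* g (s Vec.∷ w)) (same w)) (sum-δ v (g ∘ (s Vec.∷_)))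
  vanishing : ∀ t → t ≢ s → sum V (λ w → f (t Vec.∷ w)) ≡ 0ℚ
  vanishing t t≢s = trans (sum-cong V λ w →
      trans (cong (ℚ._* g (t Vec.∷ w)) (δ-other (s Vec.∷ v) (t Vec.∷ w) (λ q → t≢s (cong Vec.head q)))) (ℚ.*-zeroˡ (g (t Vec.∷ w))))
    (sum-0 V)
  byHead : ∀ t → t ≡ s → sum V (λ w → f (Sign.+ Vec.∷ w)) ℚ.+ sum V (λ w → f (Sign.- Vec.∷ w)) ≡ g (s Vec.∷ v)
  byHead Sign.+ q = trans (cong₂ ℚ._+_ (matching Sign.+ q) (vanishing Sign.- (λ r → contradiction (trans q (sym r)) λ ())))
                          (ℚ.+-identityʳ _)
  byHead Sign.- q = trans (cong₂ ℚ._+_ (vanishing Sign.+ (λ r → contradiction (trans q (sym r)) λ ())) (matching Sign.- q))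
                          (ℚ.+-identityˡ _)

·-≢𝟘 : ∀ y s → y · s ≢ 𝟘 → y ≢ 𝟘 × s ≢ 𝟘
·-≢𝟘 = by-signs

≢𝟘-· : ∀ y s → y ≢ 𝟘 → s ≢ 𝟘 → y · s ≢ 𝟘
≢𝟘-· = by-signs

same-support : ∀ {E : Set} {Z F : SignVec E} → (∃ λ y → ∀ v → Z v ≡ y · F v) → NonZero Z → supp F ⊆ supp Z
same-support {Z = Z} {F} (y , eq) (w , Zw) {v} Fv Zv =
  ≢𝟘-· y (F v) (proj₁ (·-≢𝟘 y (F w) (Zw ∘ trans (eq w)))) Fv (trans (sym (eq v)) Zv)

module _ {n : ℕ} where

  private
    V = vertices n

  -- Weighting the coefficients by 1 + s x_i preserves the zero sum. The weight is 2 on the support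
  -- of the facet vector and 0 elsewhere, and a zero sum is either trivial or has terms of both
  -- signs.
  dependence⊥facet : ∀ {c : Cube n → ℚ} → IsAffineDependence V point c → ∀ i s → (sgn ∘ c) ⊥ facetVec i s
  dependence⊥facet {c} (Σc , Σcp) i s = Sum.map
    (λ z e → trans (sym (weighted-sign e)) (z e))
    (λ { ((e , p) , (f , m)) → (e , trans (sym (weighted-sign e)) p) , (f , trans (sym (weighted-sign f)) m) })
    (balanced vertices-complete weighted Σweighted)
    where
    open +-*-Solver
    weighted : Cube n → ℚ
    weighted e = c e ℚ.+ ±1 s ℚ.* (c e ℚ.* point e i)
    Σweighted : sum V weighted ≡ 0ℚ
    Σweighted = trans (sum-+ V c (λ e → ±1 s ℚ.* (c e ℚ.* point e i)))
      (cong₂ ℚ._+_ Σc (trans (sum-* V (±1 s) (λ e → c e ℚ.* point e i)) (trans (cong (±1 s ℚ.*_) (Σcp i)) (ℚ.*-zeroʳ (±1 s)))))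
    coefficient : ∀ s t x → x ℚ.+ ±1 s ℚ.* (x ℚ.* ±1 t) ≡ (if does (t Sign.≟ s) then x ℚ.+ x else 0ℚ)
    coefficient Sign.+ Sign.+ = solve 1 (λ x → x :+ con 1ℚ :* (x :* con 1ℚ) := x :+ x) refl
    coefficient Sign.+ Sign.- = solve 1 (λ x → x :+ con 1ℚ :* (x :* :- con 1ℚ) := con 0ℚ) refl
    coefficient Sign.- Sign.+ = solve 1 (λ x → x :+ :- con 1ℚ :* (x :* con 1ℚ) := con 0ℚ) refl
    coefficient Sign.- Sign.- = solve 1 (λ x → x :+ :- con 1ℚ :* (x :* :- con 1ℚ) := x :+ x) refl
    weighted-sign : ∀ e → sgn (weighted e) ≡ sgn (c e) · facetVec i s e
    weighted-sign e = trans (cong sgn (coefficient s (lookup e i) (c e))) (byCases (does (lookup e i Sign.≟ s)))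
      where
      byCases : ∀ b → sgn (if b then c e ℚ.+ c e else 0ℚ) ≡ sgn (c e) · (if b then ⊕ else 𝟘)
      byCases true  = trans (sgn-double (c e)) (sym (·-identityʳ (sgn (c e))))
      byCases false = sym (·-zeroʳ (sgn (c e)))

  circuit⊥facet : ∀ {X} → RealCubeCircuit n X → ∀ i s → X ⊥ facetVec i s
  circuit⊥facet {X} ((c , dep , eq) , _) i s =
    ⊥-resp {X = sgn ∘ c} {X} {facetVec i s} {facetVec i s} (≗-sym eq) (λ _ → refl) (dependence⊥facet dep i s)

  module _ (v : Cube n) (A B : Subset n) {a b : Fin n}
           (Aa : lookup A a ≡ true) (Bb : lookup B b ≡ true)
           (disjoint : ∀ i → lookup A i ≡ true → lookup B i ≡ false) where

    private
      Ab : lookup A b ≡ false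
      Ab with lookup A b in eq
      ... | false = refl
      ... | true  = contradiction (trans (sym (disjoint b eq)) Bb) λ ()

    open Rectangle v A B Aa (disjoint a Aa) Ab Bb

    private
      c : Cube n → ℚ
      c w = δ v w ℚ.+ δ p₂ w ℚ.- δ q₁ w ℚ.- δ q₂ w

      sum-c : ∀ (g : Cube n → ℚ) → sum V (λ w → c w ℚ.* g w) ≡ g v ℚ.+ g p₂ ℚ.- g q₁ ℚ.- g q₂
      sum-c g = begin
        sum V (λ w → c w ℚ.* g w)
          ≡⟨ sum-cong V (λ w → solve 5 (λ x y z t g → (x :+ y :- z :- t) :* g :=
               x :* g :+ y :* g :+ (:- con 1ℚ :* (z :* g) :+ :- con 1ℚ :* (t :* g))) refl (δ v w) (δ p₂ w) (δ q₁ w) (δ q₂ w) (g w)) ⟩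
        sum V (λ w → δ v w ℚ.* g w ℚ.+ δ p₂ w ℚ.* g w ℚ.+ (ℚ.- 1ℚ ℚ.* (δ q₁ w ℚ.* g w) ℚ.+ ℚ.- 1ℚ ℚ.* (δ q₂ w ℚ.* g w)))
          ≡⟨ trans (sum-+ V _ _) (cong₂ ℚ._+_ (sum-+ V _ _) (sum-+ V _ _)) ⟩
        sum V (λ w → δ v w ℚ.* g w) ℚ.+ sum V (λ w → δ p₂ w ℚ.* g w)
          ℚ.+ (sum V (λ w → ℚ.- 1ℚ ℚ.* (δ q₁ w ℚ.* g w)) ℚ.+ sum V (λ w → ℚ.- 1ℚ ℚ.* (δ q₂ w ℚ.* g w)))
          ≡⟨ cong₂ ℚ._+_ (cong₂ ℚ._+_ (sum-δ v g) (sum-δ p₂ g))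
               (cong₂ ℚ._+_ (negated q₁) (negated q₂)) ⟩
        g v ℚ.+ g p₂ ℚ.+ (ℚ.- 1ℚ ℚ.* g q₁ ℚ.+ ℚ.- 1ℚ ℚ.* g q₂)
          ≡⟨ solve 4 (λ x y z t → x :+ y :+ (:- con 1ℚ :* z :+ :- con 1ℚ :* t) := x :+ y :- z :- t) refl (g v) (g p₂) (g q₁) (g q₂) ⟩
        g v ℚ.+ g p₂ ℚ.- g q₁ ℚ.- g q₂ ∎
        where
        open ≡-Reasoning
        open +-*-Solver
        negated : ∀ q → sum V (λ w → ℚ.- 1ℚ ℚ.* (δ q w ℚ.* g w)) ≡ ℚ.- 1ℚ ℚ.* g q
        negated q = trans (sum-* V (ℚ.- 1ℚ) (λ w → δ q w ℚ.* g w)) (cong (ℚ.- 1ℚ ℚ.*_) (sum-δ q g))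

      coordinates : ∀ k → point v k ℚ.+ point p₂ k ℚ.- point q₁ k ℚ.- point q₂ k ≡ 0ℚ
      coordinates k = trans
        (cong₂ ℚ._-_ (cong₂ ℚ._-_ (cong (λ s → point v k ℚ.+ ±1 s)
                                        (trans (lookup-flip (A ∪ B) v k) (cong (if_then opposite (lookup v k) else lookup v k) (lookup-∪ A B k))))
                                  (cong ±1 (lookup-flip A v k)))
                     (cong ±1 (lookup-flip B v k)))
        (byCases (lookup A k) (lookup B k) (disjoint k))
        where
        open +-*-Solver
        x = ±1 (lookup v k)
        y = ±1 (opposite (lookup v k))
        byCases : ∀ α β → (α ≡ true → β ≡ false) →
                  x ℚ.+ ±1 (if α ∨ β then opposite (lookup v k) else lookup v k)
                    ℚ.- ±1 (if α then opposite (lookup v k) else lookup v k)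
                    ℚ.- ±1 (if β then opposite (lookup v k) else lookup v k) ≡ 0ℚ
        byCases false false _ = solve 1 (λ x → x :+ x :- x :- x := con 0ℚ) refl x
        byCases false true  _ = solve 2 (λ x y → x :+ y :- x :- y := con 0ℚ) refl x y
        byCases true  false _ = solve 2 (λ x y → x :+ y :- y :- x := con 0ℚ) refl x y
        byCases true  true  q = contradiction (q refl) λ ()

      value : ∀ w {x y z t} → δ v w ≡ x → δ p₂ w ≡ y → δ q₁ w ≡ z → δ q₂ w ≡ t →
              c w ≡ x ℚ.+ y ℚ.- z ℚ.- t
      value w refl refl refl refl = refl

      v≢p₂ : v ≢ p₂
      v≢p₂ q = opposite-≢ (lookup v a) (sym (trans (≡-at a q) p₂-a))

      q₁≢q₂ : q₁ ≢ q₂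
      q₁≢q₂ q = opposite-≢ (lookup v a) (trans (sym q₁-a) (trans (≡-at a q) q₂-a))

      R≗sgn : R ≗ sgn ∘ c
      R≗sgn w with corner? w
      ... | no ¬c = trans (off-corner ¬c) (sym (cong sgn (value w
        (δ-other v w (¬c ∘ inj₁)) (δ-other p₂ w (¬c ∘ inj₂ ∘ inj₁))
        (δ-other q₁ w (¬c ∘ inj₂ ∘ inj₂ ∘ inj₁)) (δ-other q₂ w (¬c ∘ inj₂ ∘ inj₂ ∘ inj₂)))))
      ... | yes (inj₁ refl) = trans Rv (sym (cong sgn (value v
        (δ-same v) (δ-other p₂ v v≢p₂) (δ-other q₁ v (q₁≢v ∘ sym)) (δ-other q₂ v (q₂≢v ∘ sym)))))
      ... | yes (inj₂ (inj₁ refl)) = trans Rp₂ (sym (cong sgn (value p₂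
        (δ-other v p₂ (v≢p₂ ∘ sym)) (δ-same p₂) (δ-other q₁ p₂ (q₁≢p₂ ∘ sym)) (δ-other q₂ p₂ (q₂≢p₂ ∘ sym)))))
      ... | yes (inj₂ (inj₂ (inj₁ refl))) = trans Rq₁ (sym (cong sgn (value q₁
        (δ-other v q₁ q₁≢v) (δ-other p₂ q₁ q₁≢p₂) (δ-same q₁) (δ-other q₂ q₁ q₁≢q₂))))
      ... | yes (inj₂ (inj₂ (inj₂ refl))) = trans Rq₂ (sym (cong sgn (value q₂
        (δ-other v q₂ q₂≢v) (δ-other p₂ q₂ q₂≢p₂) (δ-other q₁ q₂ (q₁≢q₂ ∘ sym)) (δ-same q₂))))

    -- For minimality, a dependence supported on the corners is orthogonal to the facets, so that
    -- `scaled` makes it a multiple of the rectangle.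
    real-rectangle : RealCubeCircuit n (rectangle v A B)
    real-rectangle = (c , (Σc , λ k → trans (sum-c (λ w → point w k)) (coordinates k)) , R≗sgn) ,
        (v , λ q → contradiction (trans (sym Rv) q) λ ()) , minimal
      where
      Σc : sum V c ≡ 0ℚ
      Σc = trans (sum-cong V (λ w → sym (ℚ.*-identityʳ (c w)))) (sum-c (const 1ℚ))
      minimal : ∀ Y → (∃ λ c → IsAffineDependence V point c × Y ≗ sgn ∘ c) → NonZero Y → supp Y ⊆ supp R → supp R ⊆ supp Y
      minimal Y (c′ , dep , eq) (w , Yw) Y⊆R {u} Ru Yu = Ru (·-cancelˡ (Y v) (R u) Yv (trans (sym (Y≡ u)) Yu))
        where
        Y≡ : ∀ w → Y w ≡ Y v · R w
        Y≡ = scaled {Y} (λ w q → decidable-stable (corner? w) λ ¬c → Y⊆R {w} q (off-corner ¬c))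
          (λ i s → ⊥-resp {X = sgn ∘ c′} {Y} {facetVec i s} {facetVec i s} (≗-sym eq) (λ _ → refl) (dependence⊥facet dep i s))
        Yv : Y v ≢ 𝟘
        Yv q = Yw (trans (Y≡ w) (cong (_· R w) q))

  real-axis-rectangles : AxisRectangles (RealCubeCircuit n)
  real-axis-rectangles v i B (b , b∈B) disjoint = real-rectangle v ⁅ i ⁆ B {i} {b} (lookup-⁅⁆ i) (Vec.[]=⇒lookup b∈B) outside
    where
    outside : ∀ j → lookup ⁅ i ⁆ j ≡ true → lookup B j ≡ false
    outside j q with lookup B j in eq
    ... | false = refl
    ... | true  = contradiction (j , Subset.x∈p∩q⁺ (Vec.lookup⇒[]= j ⁅ i ⁆ q , Vec.lookup⇒[]= j B eq)) disjoint

  facetVec-minimal : ∀ {𝓛 : Pred (SignVec (Cube n)) 0ℓ} → (∀ {Z} → 𝓛 Z → Consistent Z) → ∀ i s →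
                     ∀ Y → 𝓛 Y → NonZero Y → supp Y ⊆ supp (facetVec i s) → supp (facetVec i s) ⊆ supp Y
  facetVec-minimal consistent i s Y y Y≢0 Y⊆F {v} = same-support {Z = Y} {facetVec i s}
    (like-facet {Z = Y} (consistent y) i s (λ v q → decidable-stable (Y v ≟ₛ 𝟘) λ r → q (facetVec-supp i s v (Y⊆F {v} r)))) Y≢0 {v}

  facet-nonZero : ∀ i s → NonZero (facetVec {n} i s)
  facet-nonZero i s = v , λ q → contradiction (trans (sym (facetVec-on i s v (Vec.lookup∘update i (Vec.replicate n Sign.+) s))) q) λ ()
    where
    v : Cube n
    v = Vec.replicate n Sign.+ [ i ]≔ s

  real-facet : ∀ i s → RealCubeCocircuit n (facetVec i s)
  real-facet i s = (λ X x → circuit⊥facet x i s) , facet-nonZero i s ,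
    facetVec-minimal (λ {Z} z → consistent real-axis-rectangles {Z} z) i s

-- Adjoints restrict to oriented cubes

module Rank {E : Set} (_≟_ : DecidableEquality E)
            (elements : List E) (complete : ∀ e → e ∈ elements)
            (M : OrientedMatroid E) where

  open Finite _≟_ elements complete
  open OrientedMatroid M

  dependent : ∀ B → ¬ Independent B → ∃ λ X → Circuit X × (∀ h → X h ≢ 𝟘 → h ∈ B)
  dependent B ¬indep with ∃-signVec? {λ X → Circuit X × (∀ h → X h ≢ 𝟘 → h ∈ B)}
      (λ eq (x , ⊆B) → resp eq x , λ h q → ⊆B h (q ∘ trans (sym (eq h))))
      (λ X → circuit? X ×-dec ∀-element? (λ h → ¬? (X h ≟ₛ 𝟘) →-dec any? (h ≟_) B))
  ... | yes q = q
  ... | no ¬q = contradiction (λ X x ⊆B → ¬q (X , x , λ h → ⊆B {h})) ¬indep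

  -- A covector that vanishes on B but not at e certifies that e is not spanned by B.
  module _ {J : Set} (w : J → E) (D : J → SignVec E) (covector : ∀ j → Perp Circuit (D j))
           (diagonal : ∀ j → D j (w j) ≢ 𝟘) (off-diagonal : ∀ j k → k ≢ j → D j (w k) ≡ 𝟘)
           (base : List E) (on-base : ∀ j e → e ∈ base → D j e ≡ 𝟘)
           (independent : Independent base) (unique : Unique base) where

    flag : ∀ js → Unique js → Independent (map w js ++ base) × Unique (map w js ++ base)
    flag [] _ = independent , unique
    flag (j ∷ js) (j∉js ∷ u) = indep , All.tabulate fresh ∷ proj₂ (flag js u)
      where
      rest = map w js ++ base
      vanishes : ∀ {e} → e ∈ rest → D j e ≡ 𝟘
      vanishes {e} e∈ with Membership.∈-++⁻ (map w js) e∈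
      ... | inj₂ q = on-base j e q
      ... | inj₁ q with Membership.∈-map⁻ w q
      ...   | k , k∈js , refl = off-diagonal j k λ { refl → All.lookup j∉js k∈js refl }
      fresh : ∀ {e} → e ∈ rest → w j ≢ e
      fresh e∈ refl = diagonal j (vanishes e∈)
      indep : Independent (w j ∷ rest)
      indep X x X⊆ = proj₁ (flag js u) X x λ {h} Xh → drop h Xh (X⊆ {h} Xh)
        where
        only : ∀ h → X h · D j h ≢ 𝟘 → h ≡ w j ⊎ h ≡ w j
        only h q with X h ≟ₛ 𝟘
        ... | yes Xh = contradiction (cong (_· D j h) Xh) q
        ... | no Xh with X⊆ {h} Xh
        ...   | here h≡  = inj₁ h≡
        ...   | there h∈ = contradiction (trans (cong (X h ·_) (vanishes h∈)) (·-zeroʳ (X h))) q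
        Xw : X (w j) ≡ 𝟘
        Xw = ·-self-opposed (X (w j)) (D j (w j)) (diagonal j)
          (two-point {X = X} {D j} (covector j X x) (w j) (w j) only)
        drop : ∀ h → X h ≢ 𝟘 → h ∈ w j ∷ rest → h ∈ rest
        drop h Xh (here refl) = contradiction Xw Xh
        drop h Xh (there q)   = q

  module _ {m : ℕ} (w : Fin m → E) (D : Fin m → SignVec E) (covector : ∀ j → Perp Circuit (D j))
           (diagonal : ∀ j → D j (w j) ≢ 𝟘) (off-diagonal : ∀ j k → k ≢ j → D j (w k) ≡ 𝟘)
           (base : List E) (on-base : ∀ j e → e ∈ base → D j e ≡ 𝟘) (unique : Unique base) where

    flag-independent : Independent base →
      ∃ λ B → Unique B × Independent B × length B ≡ m + length base
    flag-independent independent =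
      map w (allFin m) ++ base , proj₂ extended , proj₁ extended , (begin
        length (map w (allFin m) ++ base)       ≡⟨ List.length-++ (map w (allFin m)) ⟩
        length (map w (allFin m)) + length base ≡⟨ cong (_+ length base) (trans (List.length-map w (allFin m)) (List.length-tabulate id)) ⟩
        m + length base                         ∎)
      where
      open ≡-Reasoning
      extended = flag w D covector diagonal off-diagonal base on-base independent unique (allFin m) (Unique.allFin⁺ m)

    -- If `base` were independent, the `m` separated elements would extend it to an independent set
    -- exceeding the rank.
    flag-dependent : ∀ {r} → HasRank r → r < m + length base →
                     ∃ λ X → Circuit X × (∀ h → X h ≢ 𝟘 → h ∈ base)
    flag-dependent (_ , bound) r< = dependent base λ independent →
      let (B , u , i , len) = flag-independent independent
      in ℕ.<⇒≱ r< (subst (_≤ _) len (bound B u i))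

avoid-one : ∀ {n} (i : Fin n) → ∃ λ m → n ≡ suc m ×
            ∃ λ (ι : Fin m → Fin n) → (∀ j → ι j ≢ i) × (∀ j k → ι j ≡ ι k → j ≡ k)
avoid-one {suc m} i = m , refl , Fin.punchIn i , Fin.punchInᵢ≢i i , Fin.punchIn-injective i

avoid-two : ∀ {n} {a b : Fin n} → a ≢ b → ∃ λ m → n ≡ suc (suc m) ×
            ∃ λ (ι : Fin m → Fin n) → (∀ j → ι j ≢ a) × (∀ j → ι j ≢ b) × (∀ j k → ι j ≡ ι k → j ≡ k)
avoid-two {suc n} {a} {b} a≢b with avoid-one (Fin.punchOut a≢b)
... | m , refl , ι , ι≢ , ι-injective = m , refl , Fin.punchIn a ∘ ι , (λ j → Fin.punchInᵢ≢i a (ι j)) ,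
  (λ j q → ι≢ j (Fin.punchIn-injective a (ι j) (Fin.punchOut a≢b) (trans q (sym (Fin.punchIn-punchOut a≢b))))) ,
  (λ j k q → ι-injective j k (Fin.punchIn-injective a (ι j) (ι k) q))

module D₁-finite (n : ℕ) where

  _≟ᴰ_ : DecidableEquality (D₁ n)
  _≟ᴰ_ = Sum.≡-dec _≟ᵥ_ Fin._≟_

  elements : List (D₁ n)
  elements = map inj₁ (vertices n) ++ map inj₂ (allFin n)

  complete : ∀ e → e ∈ elements
  complete (inj₁ v) = Membership.∈-++⁺ˡ (Membership.∈-map⁺ inj₁ (vertices-complete v))
  complete (inj₂ i) = Membership.∈-++⁺ʳ (map inj₁ (vertices n)) (Membership.∈-map⁺ inj₂ (Membership.∈-allFin i))

  -- The cocircuit of the adjoint given by the point e_i or -e_i of O_n; on the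
  -- cube it is complementary to the facet on which the i-th sign is opposite to s.
  side : Fin n → Sign → SignVec (D₁ n)
  side i Sign.+ = X̃ (inj₁ i)
  side i Sign.- = X̃ (inj₂ i)

  side-cube : ∀ i s v → side i s (inj₁ v) ≡ facetVec i s v
  side-cube i Sign.+ v with lookup v i
  ... | Sign.+ = refl
  ... | Sign.- = refl
  side-cube i Sign.- v with lookup v i
  ... | Sign.+ = refl
  ... | Sign.- = refl

  side-self : ∀ i s → side i s (inj₂ i) ≡ toSgn s
  side-self i Sign.+ = cong (if_then ⊕ else 𝟘) (dec-true (i Fin.≟ i) refl)
  side-self i Sign.- = cong (if_then ⊖ else 𝟘) (dec-true (i Fin.≟ i) refl)

  side-other : ∀ i s {j} → j ≢ i → side i s (inj₂ j) ≡ 𝟘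
  side-other i Sign.+ {j} q = cong (if_then ⊕ else 𝟘) (dec-false (j Fin.≟ i) q)
  side-other i Sign.- {j} q = cong (if_then ⊖ else 𝟘) (dec-false (j Fin.≟ i) q)

  side-on : ∀ i s v → lookup v i ≡ s → side i s (inj₁ v) ≡ ⊕
  side-on i s v q = trans (side-cube i s v) (facetVec-on i s v q)

  side-off : ∀ i s v → lookup v i ≢ s → side i s (inj₁ v) ≡ 𝟘
  side-off i s v q = trans (side-cube i s v) (facetVec-off i s v q)

  -- Orthogonality to the edge circuits, which have v⁺ on one side and v⁻ and Y_i on the other.
  Edges : SignVec (D₁ n) → Set
  Edges W = ∀ i v → Adm (W (inj₂ i)) (W (inj₁ (v ⁺ i))) (W (inj₁ (v ⁻ i)))

  towards : ∀ (v : Cube n) k → D₁ n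
  towards v k = inj₁ (v [ k ]≔ opposite (lookup v k))

  -- This covector vanishes on the facet through `v` and is nonzero at `towards v k`; it separates
  -- this neighbour of `v` from `v` and all other neighbours.
  away : ∀ (v : Cube n) k → SignVec (D₁ n)
  away v k = side k (opposite (lookup v k))

  away-zero : ∀ (v : Cube n) {k} u → lookup u k ≡ lookup v k → away v k (inj₁ u) ≡ 𝟘
  away-zero v {k} u q = side-off k _ u λ r → opposite-≢ (lookup v k) (trans (sym r) q)

  away-diagonal : ∀ v k → away v k (towards v k) ≢ 𝟘
  away-diagonal v k q = contradiction (trans (sym (side-on k _ (v [ k ]≔ opposite (lookup v k)) (Vec.lookup∘update k v (opposite (lookup v k))))) q) λ ()

module _ {F G : Set} where

  ⊥-restrict : ∀ {X W : SignVec (F ⊎ G)} → (∀ g → X (inj₂ g) ≡ 𝟘) → X ⊥ W → (X ∘ inj₁) ⊥ (W ∘ inj₁)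
  ⊥-restrict X₂ (inj₁ z) = inj₁ (z ∘ inj₁)
  ⊥-restrict {X} {W} X₂ (inj₂ ((e , p) , (f , m))) = inj₂ (left e (λ ()) p , left f (λ ()) m)
    where
    left : ∀ e {s} → s ≢ 𝟘 → X e · W e ≡ s → ∃ λ e → X (inj₁ e) · W (inj₁ e) ≡ s
    left (inj₁ e) _ q = e , q
    left (inj₂ g) s≢𝟘 q = contradiction (trans (sym q) (cong (_· W (inj₂ g)) (X₂ g))) s≢𝟘

  perp-restrict : ∀ (M : OrientedMatroid (F ⊎ G)) {W} → Perp (OrientedMatroid.Circuit M) W →
                  Perp (OrientedMatroid.Circuit (restrict M)) (W ∘ inj₁)
  perp-restrict M {W} w X x = ⊥-restrict {extend X} {W} (λ _ → refl) (w (extend X) x)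

level-step : ∀ {n} (Z : SignVec (Cube n)) {k} u t → Z (u ⁺ k) ≡ Z (u ⁻ k) → Z (u [ k ]≔ t) ≡ Z u
level-step Z {k} u t eq = trans (toPlus t) (sym (trans (cong Z (sym (Vec.[]≔-lookup u k))) (toPlus (lookup u k))))
  where
  toPlus : ∀ t → Z (u [ k ]≔ t) ≡ Z (u ⁺ k)
  toPlus Sign.+ = refl
  toPlus Sign.- = sym eq

module Adjoint (n : ℕ) (M : OrientedMatroid (D₁ n)) (adjoint : IsAdjoint n M) where

  open D₁-finite n
  open OrientedMatroid M
  open IsAdjoint adjoint
  open Rank _≟ᴰ_ elements complete M

  covectorFamily : IsCovectorFamily (Perp Circuit)
  covectorFamily = Duality.covectors _≟ᴰ_ elements complete M

  side-covector : ∀ i s → Perp Circuit (side i s)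
  side-covector i Sign.+ = proj₁ (cocircuits (inj₁ i))
  side-covector i Sign.- = proj₁ (cocircuits (inj₂ i))

  -- The neighbours of `v` in the other n - 1 directions are separated from the three elements.
  -- Independence would yield n + 2 elements, one more than the rank.
  edge-dependent : ∀ i v → ∃ λ X → Circuit X × (∀ h → X h ≢ 𝟘 → h ∈ inj₁ (v ⁺ i) ∷ inj₁ (v ⁻ i) ∷ inj₂ i ∷ [])
  edge-dependent i v with avoid-one i
  ... | m , n≡ , ι , ι≢i , ι-injective = flag-dependent
      (λ j → towards v (ι j)) (λ j → away v (ι j)) (λ j → side-covector (ι j) (opposite (lookup v (ι j))))
      (λ j → away-diagonal v (ι j))
      (λ j k k≢j → away-zero v _ (Vec.lookup∘update′ (λ q → k≢j (ι-injective k j (sym q))) v _))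
      (inj₁ (v ⁺ i) ∷ inj₁ (v ⁻ i) ∷ inj₂ i ∷ []) on-base unique rank
      (subst (λ n → suc (suc n) ≤ m + 3) (sym n≡) (ℕ.≤-reflexive (ℕ.+-comm 3 m)))
    where
    on-base : ∀ j e → e ∈ inj₁ (v ⁺ i) ∷ inj₁ (v ⁻ i) ∷ inj₂ i ∷ [] → away v (ι j) e ≡ 𝟘
    on-base j _ (here refl)                 = away-zero v _ (Vec.lookup∘update′ (ι≢i j) v _)
    on-base j _ (there (here refl))         = away-zero v _ (Vec.lookup∘update′ (ι≢i j) v _)
    on-base j _ (there (there (here refl))) = side-other (ι j) (opposite (lookup v (ι j))) (ι≢i j ∘ sym)
    distinct : inj₁ {B = Fin n} (v ⁺ i) ≢ inj₁ (v ⁻ i)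
    distinct q = contradiction (trans (sym (Vec.lookup∘update i v Sign.+))
      (trans (≡-at i (Sum.inj₁-injective q)) (Vec.lookup∘update i v Sign.-))) λ ()
    unique : Unique (inj₁ (v ⁺ i) ∷ inj₁ (v ⁻ i) ∷ inj₂ i ∷ [])
    unique = (distinct ∷ (λ ()) ∷ []) ∷ ((λ ()) ∷ []) ∷ [] ∷ []

  -- Each of the two sides in direction `i` meets the triple in Y_i and one vertex. Orthogonality to
  -- them fixes the dependence up to sign: one sign at v⁺, the opposite sign at v⁻ and Y_i.
  edges : ∀ {W} → Perp Circuit W → Edges W
  edges {W} w i v with edge-dependent i v
  ... | X , x , X⊆ = admissible (X a) (X b) (X y) (W a) (W b) (W y) X-a X-b nonzero (orthogonal (w X x))
    where
    a b y : D₁ n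
    a = inj₁ (v ⁺ i)
    b = inj₁ (v ⁻ i)
    y = inj₂ i
    Triple : D₁ n → Set
    Triple h = h ∈ a ∷ b ∷ y ∷ []
    product-in : ∀ {U} h → X h · U h ≢ 𝟘 → Triple h
    product-in {U} h q = X⊆ h (λ Xh → q (cong (_· U h) Xh))
    plus : lookup (v ⁺ i) i ≡ Sign.+
    plus = Vec.lookup∘update i v Sign.+
    minus : lookup (v ⁻ i) i ≡ Sign.-
    minus = Vec.lookup∘update i v Sign.-
    strip : ∀ x y f g → f ≡ ⊕ → g ≢ 𝟘 → x · f ≡ neg (y · g) → x ≡ neg (y · g)
    strip = by-signs
    X-a : X a ≡ neg (X y · ⊕)
    X-a = subst (λ g → X a ≡ neg (X y · g)) (side-self i Sign.+)
      (strip (X a) (X y) _ _ (side-on i Sign.+ (v ⁺ i) plus)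
        (λ q → contradiction (trans (sym (side-self i Sign.+)) q) λ ())
        (two-point {X = X} {side i Sign.+} (side-covector i Sign.+ X x) a y only))
      where
      only : ∀ h → X h · side i Sign.+ h ≢ 𝟘 → h ≡ a ⊎ h ≡ y
      only h q with product-in {side i Sign.+} h q
      ... | here r                  = inj₁ r
      ... | there (there (here r))  = inj₂ r
      ... | there (here refl)       = contradiction (trans (cong (X b ·_) (side-off i Sign.+ (v ⁻ i)
        (λ r → contradiction (trans (sym minus) r) λ ()))) (·-zeroʳ (X b))) q
    X-b : X b ≡ neg (X y · ⊖)
    X-b = subst (λ g → X b ≡ neg (X y · g)) (side-self i Sign.-)
      (strip (X b) (X y) _ _ (side-on i Sign.- (v ⁻ i) minus)
        (λ q → contradiction (trans (sym (side-self i Sign.-)) q) λ ())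
        (two-point {X = X} {side i Sign.-} (side-covector i Sign.- X x) b y only))
      where
      only : ∀ h → X h · side i Sign.- h ≢ 𝟘 → h ≡ b ⊎ h ≡ y
      only h q with product-in {side i Sign.-} h q
      ... | there (here r)          = inj₁ r
      ... | there (there (here r))  = inj₂ r
      ... | here refl               = contradiction (trans (cong (X a ·_) (side-off i Sign.- (v ⁺ i)
        (λ r → contradiction (trans (sym plus) r) λ ()))) (·-zeroʳ (X a))) q
    nonzero : X a ≢ 𝟘 ⊎ X b ≢ 𝟘 ⊎ X y ≢ 𝟘
    nonzero with nonZero x
    ... | h , Xh with X⊆ h Xh
    ...   | here refl                 = inj₁ Xh
    ...   | there (here refl)         = inj₂ (inj₁ Xh)
    ...   | there (there (here refl)) = inj₂ (inj₂ Xh)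
    Balanced : Sgn → Sgn → Sgn → Set
    Balanced α β η = (α ≡ 𝟘 × β ≡ 𝟘 × η ≡ 𝟘) ⊎ (α ≡ ⊕ ⊎ β ≡ ⊕ ⊎ η ≡ ⊕) × (α ≡ ⊖ ⊎ β ≡ ⊖ ⊎ η ≡ ⊖)
    orthogonal : X ⊥ W → Balanced (X a · W a) (X b · W b) (X y · W y)
    orthogonal (inj₁ z) = inj₁ (z a , z b , z y)
    orthogonal (inj₂ ((e , p) , (f , m))) = inj₂ (at e (λ ()) p , at f (λ ()) m)
      where
      at : ∀ h {s} → s ≢ 𝟘 → X h · W h ≡ s → X a · W a ≡ s ⊎ X b · W b ≡ s ⊎ X y · W y ≡ s
      at h s≢𝟘 q with product-in {W} h (s≢𝟘 ∘ trans (sym q))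
      ... | here refl                 = inj₁ q
      ... | there (here refl)         = inj₂ (inj₁ q)
      ... | there (there (here refl)) = inj₂ (inj₂ q)
    admissible : ∀ xa xb xy wa wb wy → xa ≡ neg (xy · ⊕) → xb ≡ neg (xy · ⊖) →
                 xa ≢ 𝟘 ⊎ xb ≢ 𝟘 ⊎ xy ≢ 𝟘 →
                 Balanced (xa · wa) (xb · wb) (xy · wy) → Adm wy wa wb
    admissible = by-signs

module AdjointRestriction (n : ℕ) (M : OrientedMatroid (D₁ n)) (adjoint : IsAdjoint n M) where

  open D₁-finite n
  open OrientedMatroid M
  open IsAdjoint adjoint
  open Rank _≟ᴰ_ elements complete M
  open Adjoint n M adjoint
  open IsCovectorFamily covectorFamily using () renaming (eliminate to eliminate-covectors; negate to opposite-covector)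

  private
    N = restrict M
    module N = OrientedMatroid N

    *-self : ∀ s → s Sign.* s ≡ Sign.+
    *-self Sign.+ = refl
    *-self Sign.- = refl

    *-opposite : ∀ {s t} → t ≢ s → s Sign.* t ≡ Sign.-
    *-opposite {Sign.+} {Sign.+} q = contradiction refl q
    *-opposite {Sign.+} {Sign.-} q = refl
    *-opposite {Sign.-} {Sign.+} q = refl
    *-opposite {Sign.-} {Sign.-} q = contradiction refl q

  -- Eliminate a vertex between two sides: the result vanishes at all vertices on
  -- both, since its sign in every other direction is 𝟘.
  module _ (i j : Fin n) (s : Sign) (i≢j : i ≢ j) where

    private
      v₀ : Cube n
      v₀ = Vec.replicate n Sign.+ [ j ]≔ s
      v₀-i : lookup v₀ i ≡ Sign.+
      v₀-i = trans (Vec.lookup∘update′ i≢j (Vec.replicate n Sign.+) s) (Vec.lookup-replicate i Sign.+)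
      v₀-j : lookup v₀ j ≡ s
      v₀-j = Vec.lookup∘update j (Vec.replicate n Sign.+) s

    skew-covector : ∃ λ W → Perp Circuit W × (∀ v → W (inj₁ v) ≡ skewVec i j s v)
    skew-covector with eliminate-covectors {side i Sign.+} { -ᵥ side j s}
        (side-covector i Sign.+) (opposite-covector {side j s} (side-covector j s)) (inj₁ v₀) opposed
      where
      opposed : Opposed (side i Sign.+ (inj₁ v₀)) ((-ᵥ side j s) (inj₁ v₀))
      opposed = subst₂ (λ x y → Opposed x (neg y)) (sym (side-on i Sign.+ v₀ v₀-i)) (sym (side-on j s v₀ v₀-j)) ((λ ()) , refl)
    ... | W , w , Wv₀ , off = W , w , λ v → at v (lookup v i) (lookup v j Sign.≟ s) refl
      where
      off-values : ∀ h {x y} → side i Sign.+ h ≡ x → side j s h ≡ y → ¬ Opposed x (neg y) → W h ≡ x ▹ neg y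
      off-values h refl refl = off h
      direction-zero : ∀ k → k ≢ i → k ≢ j → W (inj₂ k) ≡ 𝟘
      direction-zero k k≢i k≢j = off-values (inj₂ k) (side-other i Sign.+ k≢i) (side-other j s k≢j) λ (q , _) → q refl
      skew-zero : ∀ v → lookup v i ≡ s Sign.* lookup v j → skewVec i j s v ≡ 𝟘
      skew-zero v q = decidable-stable (_ ≟ₛ 𝟘) λ r → skewVec-supp i j s v r q
      skew-sign : ∀ v → lookup v i ≢ s Sign.* lookup v j → skewVec i j s v ≡ toSgn (lookup v i)
      skew-sign v q = cong (if_then 𝟘 else toSgn (lookup v i)) (dec-false (lookup v i Sign.≟ s Sign.* lookup v j) q)
      both : ∀ v → lookup v i ≡ Sign.+ → lookup v j ≡ s → W (inj₁ v) ≡ 𝟘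
      both v vi vj = path (λ u → W (inj₁ u) ≡ 𝟘) {v₀} {v} step Wv₀
        where
        step : ∀ u k → lookup v₀ k ≢ lookup v k → W (inj₁ u) ≡ 𝟘 → W (inj₁ (u [ k ]≔ lookup v k)) ≡ 𝟘
        step u k differ = trans (level-step (W ∘ inj₁) u (lookup v k)
          (adm-𝟘⇒≡ _ _ (subst (λ y → Adm y (W (inj₁ (u ⁺ k))) (W (inj₁ (u ⁻ k))))
            (direction-zero k (λ { refl → differ (trans v₀-i (sym vi)) }) (λ { refl → differ (trans v₀-j (sym vj)) }))
            (edges w k u))))
      at : ∀ v t → Dec (lookup v j ≡ s) → lookup v i ≡ t → W (inj₁ v) ≡ skewVec i j s v
      at v Sign.+ (yes vj) vi = trans (both v vi vj)
        (sym (skew-zero v (trans vi (sym (trans (cong (s Sign.*_) vj) (*-self s))))))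
      at v Sign.+ (no vj) vi = trans
        (off-values (inj₁ v) (side-on i Sign.+ v vi) (side-off j s v vj) λ ())
        (sym (trans (skew-sign v (λ q → contradiction (trans (sym vi) (trans q (*-opposite vj))) λ ())) (cong toSgn vi)))
      at v Sign.- (yes vj) vi = trans
        (off-values (inj₁ v) (side-off i Sign.+ v (λ q → contradiction (trans (sym vi) q) λ ())) (side-on j s v vj) λ (q , _) → q refl)
        (sym (trans (skew-sign v (λ q → contradiction (trans (sym vi) (trans q (trans (cong (s Sign.*_) vj) (*-self s)))) λ ())) (cong toSgn vi)))
      at v Sign.- (no vj) vi = trans
        (off-values (inj₁ v) (side-off i Sign.+ v (λ q → contradiction (trans (sym vi) q) λ ())) (side-off j s v vj) λ (q , _) → q refl)
        (sym (skew-zero v (trans vi (sym (*-opposite vj)))))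

  module _ (v : Cube n) (A B : Subset n) {a b : Fin n}
           (Aa : lookup A a ≡ true) (Bb : lookup B b ≡ true)
           (disjoint : ∀ i → lookup A i ≡ true → lookup B i ≡ false) where

    private
      Ab : lookup A b ≡ false
      Ab with lookup A b in eq
      ... | false = refl
      ... | true  = contradiction (trans (sym (disjoint b eq)) Bb) λ ()

    open Rectangle v A B Aa (disjoint a Aa) Ab Bb

    private
      a≢b : a ≢ b
      a≢b refl = contradiction (trans (sym Aa) Ab) λ ()

      base : List (D₁ n)
      base = inj₁ v ∷ inj₁ p₂ ∷ inj₁ q₁ ∷ inj₁ q₂ ∷ []

      base-unique : Unique base
      base-unique =
        ((λ q → opposite-≢ _ (sym (trans (≡-at a (Sum.inj₁-injective q)) p₂-a))) ∷
         (λ q → q₁≢v (sym (Sum.inj₁-injective q))) ∷ (λ q → q₂≢v (sym (Sum.inj₁-injective q))) ∷ []) ∷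
        ((λ q → q₁≢p₂ (sym (Sum.inj₁-injective q))) ∷ (λ q → q₂≢p₂ (sym (Sum.inj₁-injective q))) ∷ []) ∷
        ((λ q → opposite-≢ _ (trans (sym q₁-a) (trans (≡-at a (Sum.inj₁-injective q)) q₂-a))) ∷ []) ∷ [] ∷ []

      -- A covector that vanishes at the corners and at all towards v j, j ∉ {a , b , k},
      -- but not at towards v k: a facet, or a skew-facet pairing k with a or b.
      Separating : Fin n → Set
      Separating k = ∃ λ D → Perp Circuit D × D (towards v k) ≢ 𝟘 ×
        (∀ j → j ≢ k → j ≢ a → j ≢ b → D (towards v j) ≡ 𝟘) × (∀ e → e ∈ base → D e ≡ 𝟘)

      -- The corners flip k if and only if they flip c.
      skew-separating : ∀ k c → k ≢ c → c ≡ a ⊎ c ≡ b → lookup A k ≡ lookup A c → lookup B k ≡ lookup B c → Separating k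
      skew-separating k c k≢c c∈ Akc Bkc with skew-covector k c (lookup v k Sign.* lookup v c) k≢c
      ... | D , d , D≡ = D , d , diagonal , off , on-base
        where
        s = lookup v k Sign.* lookup v c
        v-on : lookup v k ≡ s Sign.* lookup v c
        v-on = on (lookup v k) (lookup v c)
          where
          on : ∀ x y → x ≡ (x Sign.* y) Sign.* y
          on Sign.+ Sign.+ = refl
          on Sign.+ Sign.- = refl
          on Sign.- Sign.+ = refl
          on Sign.- Sign.- = refl
        zero-on : ∀ u → lookup u k ≡ s Sign.* lookup u c → D (inj₁ u) ≡ 𝟘
        zero-on u q = trans (D≡ u) (decidable-stable (_ ≟ₛ 𝟘) λ r → skewVec-supp k c s u r q)
        zero-like : ∀ u → lookup u k ≡ lookup v k → lookup u c ≡ lookup v c → D (inj₁ u) ≡ 𝟘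
        zero-like u q r = zero-on u (trans q (trans v-on (cong (s Sign.*_) (sym r))))
        opposite-* : ∀ s t → opposite (s Sign.* t) ≡ s Sign.* opposite t
        opposite-* Sign.+ t = refl
        opposite-* Sign.- Sign.+ = refl
        opposite-* Sign.- Sign.- = refl
        flipped : ∀ C → lookup C k ≡ lookup C c → D (inj₁ (flip C v)) ≡ 𝟘
        flipped C eq = byCases (lookup C c) refl
          where
          byCases : ∀ x → lookup C c ≡ x → D (inj₁ (flip C v)) ≡ 𝟘
          byCases false Cc = zero-like (flip C v) (lookup-flip-out C v (trans eq Cc)) (lookup-flip-out C v Cc)
          byCases true  Cc = zero-on (flip C v) (trans (lookup-flip-in C v (trans eq Cc))
            (trans (cong opposite v-on) (trans (opposite-* s (lookup v c)) (cong (s Sign.*_) (sym (lookup-flip-in C v Cc))))))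
        diagonal : D (towards v k) ≢ 𝟘
        diagonal q = toSgn≢𝟘 (lookup u k) (trans (sym (trans (D≡ u)
            (cong (if_then 𝟘 else toSgn (lookup u k)) (dec-false (lookup u k Sign.≟ s Sign.* lookup u c) off-skew)))) q)
          where
          u = v [ k ]≔ opposite (lookup v k)
          off-skew : lookup u k ≢ s Sign.* lookup u c
          off-skew q = opposite-≢ (lookup v k) (trans (sym (Vec.lookup∘update k v _)) (trans q
            (trans (cong (s Sign.*_) (Vec.lookup∘update′ (k≢c ∘ sym) v _)) (sym v-on))))
        off : ∀ j → j ≢ k → j ≢ a → j ≢ b → D (towards v j) ≡ 𝟘
        off j j≢k j≢a j≢b = zero-like _ (Vec.lookup∘update′ (j≢k ∘ sym) v _)
          (Vec.lookup∘update′ (λ q → [ j≢a ∘ trans (sym q) , j≢b ∘ trans (sym q) ]′ c∈) v _)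
        on-base : ∀ e → e ∈ base → D e ≡ 𝟘
        on-base _ (here refl)                         = zero-like v refl refl
        on-base _ (there (here refl))                 = flipped (A ∪ B)
          (trans (lookup-∪ A B k) (trans (cong₂ _∨_ Akc Bkc) (sym (lookup-∪ A B c))))
        on-base _ (there (there (here refl)))         = flipped A Akc
        on-base _ (there (there (there (here refl)))) = flipped B Bkc

      separating : ∀ k → k ≢ a → k ≢ b → Separating k
      separating k k≢a k≢b = byCases (lookup A k) (lookup B k) refl refl
        where
        byCases : ∀ x y → lookup A k ≡ x → lookup B k ≡ y → Separating k
        byCases true  _    Ak Bk = skew-separating k a k≢a (inj₁ refl) (trans Ak (sym Aa)) (trans (disjoint k Ak) (sym (disjoint a Aa)))
        byCases false true Ak Bk = skew-separating k b k≢b (inj₂ refl) (trans Ak (sym Ab)) (trans Bk (sym Bb))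
        byCases false false Ak Bk = away v k , side-covector k (opposite (lookup v k)) , away-diagonal v k ,
          (λ j j≢k _ _ → away-zero v _ (Vec.lookup∘update′ (j≢k ∘ sym) v _)) , on-base
          where
          on-base : ∀ e → e ∈ base → away v k e ≡ 𝟘
          on-base _ (here refl)                         = away-zero v v refl
          on-base _ (there (here refl))                 = away-zero v p₂ (lookup-flip-out (A ∪ B) v
            (trans (lookup-∪ A B k) (cong₂ _∨_ Ak Bk)))
          on-base _ (there (there (here refl)))         = away-zero v q₁ (lookup-flip-out A v Ak)
          on-base _ (there (there (there (here refl)))) = away-zero v q₂ (lookup-flip-out B v Bk)

      -- There are n - 2 separated neighbours of `v`; with four independent corners they would make
      -- n + 2 independent elements.
      corners-dependent : ∃ λ X → Circuit X × (∀ h → X h ≢ 𝟘 → h ∈ base)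
      corners-dependent with avoid-two a≢b
      ... | m , n≡ , ι , ι≢a , ι≢b , ι-injective = flag-dependent
          (λ j → towards v (ι j)) (proj₁ ∘ sep) (λ j → proj₁ (proj₂ (sep j)))
          (λ j → proj₁ (proj₂ (proj₂ (sep j))))
          (λ j k k≢j → proj₁ (proj₂ (proj₂ (proj₂ (sep j)))) (ι k) (λ q → k≢j (ι-injective k j q)) (ι≢a k) (ι≢b k))
          base (λ j → proj₂ (proj₂ (proj₂ (proj₂ (sep j))))) base-unique rank
          (subst (λ n → suc (suc n) ≤ m + 4) (sym n≡) (ℕ.≤-reflexive (ℕ.+-comm 4 m)))
        where
        sep : ∀ j → Separating (ι j)
        sep j = separating (ι j) (ι≢a j) (ι≢b j)

    -- The circuit found by counting is supported on the corners and orthogonal to the facets, so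
    -- that it is the rectangle up to sign.
    rectangle-circuit : N.Circuit (rectangle v A B)
    rectangle-circuit with corners-dependent
    ... | X , x , X⊆ = scale (X (inj₁ v)) refl
      where
      X₂ : ∀ i → X (inj₂ i) ≡ 𝟘
      X₂ i = decidable-stable (X (inj₂ i) ≟ₛ 𝟘) λ q → impossible (X⊆ (inj₂ i) q)
        where
        impossible : inj₂ i ∈ base → Absurd
        impossible (there (there (there (here ()))))
      X≗ : X ≗ extend (X ∘ inj₁)
      X≗ (inj₁ _) = refl
      X≗ (inj₂ i) = X₂ i
      corners : ∀ w → X (inj₁ w) ≢ 𝟘 → Corner w
      corners w q with X⊆ (inj₁ w) q
      ... | here refl                         = inj₁ refl
      ... | there (here refl)                 = inj₂ (inj₁ refl)
      ... | there (there (here refl))         = inj₂ (inj₂ (inj₁ refl))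
      ... | there (there (there (here refl))) = inj₂ (inj₂ (inj₂ refl))
      X≡ : ∀ w → X (inj₁ w) ≡ X (inj₁ v) · R w
      X≡ = scaled {X ∘ inj₁} corners λ i s → ⊥-resp {X = X ∘ inj₁} {X ∘ inj₁} {side i s ∘ inj₁} {facetVec i s} (λ _ → refl) (side-cube i s)
        (⊥-restrict {X = X} {side i s} X₂ (side-covector i s X x))
      scale : ∀ y → X (inj₁ v) ≡ y → N.Circuit R
      scale ⊕ q = N.resp (λ w → trans (X≡ w) (cong (_· R w) q)) (resp X≗ x)
      scale ⊖ q = N.resp (λ w → trans (cong neg (trans (X≡ w) (cong (_· R w) q))) (neg-neg (R w)))
        (N.symmetric {X ∘ inj₁} (resp X≗ x))
      scale 𝟘 q with nonZero x
      ... | inj₂ i , Xi = contradiction (X₂ i) Xi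
      ... | inj₁ w , Xw = contradiction (trans (X≡ w) (cong (_· R w) q)) Xw

  rectangles : ∀ v A B → Nonempty A → Nonempty B → Empty (A ∩ B) → N.Circuit (rectangle v A B)
  rectangles v A B (a , a∈A) (b , b∈B) disjoint =
    rectangle-circuit v A B {a} {b} (Vec.[]=⇒lookup a∈A) (Vec.[]=⇒lookup b∈B) outside
    where
    outside : ∀ j → lookup A j ≡ true → lookup B j ≡ false
    outside j q with lookup B j in eq
    ... | false = refl
    ... | true  = contradiction (j , Subset.x∈p∩q⁺ (Vec.lookup⇒[]= j A q , Vec.lookup⇒[]= j B eq)) disjoint

  restricted-consistent : ∀ {Z} → Perp N.Circuit Z → Consistent Z
  restricted-consistent {Z} = consistent
    (λ v i B B≢∅ disjoint → rectangles v ⁅ i ⁆ B (i , Subset.x∈⁅x⁆ i) B≢∅ disjoint) {Z}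

  -- Both the real cube and the restriction have axis rectangles, so that the
  -- shared zero set determines a cocircuit of either up to sign.
  cocircuit-like : ∀ X → RealCubeCocircuit n X → (F : SignVec (Cube n)) → (∃ λ W → Perp Circuit W × (∀ v → W (inj₁ v) ≡ F v)) →
                   (∀ {Z} → Consistent Z → supp Z ⊆ supp X → ∃ λ y → ∀ v → Z v ≡ y · F v) →
                   N.Cocircuit X
  cocircuit-like X (x , X≢0 , _) F (W , w , W≡) like = perp y refl , X≢0 , minimal
    where
    X-consistent : Consistent X
    X-consistent = consistent real-axis-rectangles {X} x
    y = proj₁ (like X-consistent id)
    X≡ : ∀ v → X v ≡ y · F v
    X≡ = proj₂ (like X-consistent id)
    perp : ∀ z → y ≡ z → Perp N.Circuit X
    perp ⊕ q Z z = ⊥-resp {X = Z} {Z} {W ∘ inj₁} {X} (λ _ → refl)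
      (λ v → trans (W≡ v) (sym (trans (X≡ v) (cong (_· F v) q)))) (perp-restrict M {W} w Z z)
    perp ⊖ q Z z = ⊥-resp {X = Z} {Z} {(-ᵥ W) ∘ inj₁} {X} (λ _ → refl)
      (λ v → trans (cong neg (W≡ v)) (sym (trans (X≡ v) (cong (_· F v) q))))
      (perp-restrict M { -ᵥ W} (opposite-covector {W} w) Z z)
    perp 𝟘 q = contradiction (trans (X≡ (proj₁ X≢0)) (cong (_· F (proj₁ X≢0)) q)) (proj₂ X≢0)
    minimal : ∀ Y → Perp N.Circuit Y → NonZero Y → supp Y ⊆ supp X → supp X ⊆ supp Y
    minimal Y y′ Y≢0 Y⊆X {v} Xv = same-support {E = Cube n} {Z = Y} {F}
      (like (restricted-consistent {Y} y′) (λ {h} → Y⊆X {h})) Y≢0 {v}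
      (proj₂ (·-≢𝟘 y (F v) (Xv ∘ trans (X≡ v))))

  isOrientedCube : IsOrientedCube n N
  isOrientedCube = record
    { rectangles = rectangles
    -- The vector whose zero set is the facet with sign `s` is supported on the opposite facet.
    ; facets = λ i s X x (supp⊆ , _) → cocircuit-like X x (facetVec i (opposite s))
        (side i (opposite s) , side-covector i (opposite s) , side-cube i (opposite s))
        λ {Z} cons Z⊆X → like-facet {Z = Z} cons i (opposite s)
          λ v q → decidable-stable (Z v ≟ₛ 𝟘) λ r → q (≢⇒opposite (supp⊆ {v} (Z⊆X {v} r)))
    ; skewFacets = λ i j s i≢j X x (supp⊆ , _) → cocircuit-like X x (skewVec i j s) (skew-covector i j s i≢j)
        λ {Z} cons Z⊆X → like-skew {Z = Z} cons i j s i≢j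
          λ v q → decidable-stable (Z v ≟ₛ 𝟘) λ r → supp⊆ {v} (Z⊆X {v} r) q
    }

-- The restriction determines the adjoint

dual-involutive : ∀ k → dual (dual k) ≡ k
dual-involutive (sg ⊕) = refl
dual-involutive (sg ⊖) = refl
dual-involutive (sg 𝟘) = refl
dual-involutive free   = refl

-- Painting yields a covector for each prescribed sign separately, unless a member of `𝒞` excludes
-- it; `assemble` composes them.
realize : ∀ {E : Set} (_≟_ : DecidableEquality E) (elements : List E) (complete : ∀ e → e ∈ elements)
          {𝒞 : Pred (SignVec E) 0ℓ} → IsExchangeFamily 𝒞 → (k : E → Colour) →
          (∀ X → 𝒞 X → (∀ h → Obeys (dual (k h)) (X h)) → ∀ f s → s ≢ 𝟘 → k f ≡ sg s → X f ≢ s) →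
          ∃ λ W → Perp 𝒞 W × (∀ h → Obeys (k h) (W h)) × (∀ f s → k f ≡ sg s → W f ≡ s)
realize {E} _≟_ elements complete {𝒞} family k excluded =
  assemble null compose k hits
  where
  open Covectors _≟_ elements complete
  open IsCovectorFamily (perp-covectors family)
  open Painting _≟_ elements complete family
  hits : ∀ f s → s ≢ 𝟘 → k f ≡ sg s → ∃ λ W → Perp 𝒞 W × (∀ h → Obeys (k h) (W h)) × W f ≡ s
  hits f s s≢𝟘 kf with painting (dual ∘ k) f s s≢𝟘 (trans (cong dual kf) (dual-sg s s≢𝟘))
  ... | inj₁ (X , x , o , Xf) = contradiction Xf (excluded X x o f s s≢𝟘 kf)
  ... | inj₂ (W , w , o , Wf) = W , w , (λ h → subst (λ k → Obeys k (W h)) (dual-involutive (k h)) (o h)) , Wf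

module CovectorsOfAdjoint (n : ℕ) (M : OrientedMatroid (D₁ n)) (adjoint : IsAdjoint n M) where

  open D₁-finite n
  open OrientedMatroid M
  open Adjoint n M adjoint
  open Circuits _≟ᴰ_ elements complete M
  open IsCovectorFamily covectorFamily using (compose) renaming (negate to opposite-covector; resp to resp-covector)

  private
    module N = OrientedMatroid (restrict M)

    sign-product : ∀ x s → x ≡ s → s ≢ 𝟘 → x · s ≡ ⊕
    sign-product x s refl s≢𝟘 = ·-self s s≢𝟘

    sg-injective : ∀ {s t} → sg s ≡ sg t → s ≡ t
    sg-injective refl = refl

  -- With the directions coloured free, an obstructing circuit vanishes at every Y_i. It is then a
  -- circuit of the restriction, to which `Z` is orthogonal.
  lift : ∀ Z → Perp N.Circuit Z → ∃ λ U → Perp Circuit U × (∀ v → U (inj₁ v) ≡ Z v)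
  lift Z z with realize _≟ᴰ_ elements complete circuits k excluded
    where
    k : D₁ n → Colour
    k = [ sg ∘ Z , const free ]′
    excluded : ∀ X → Circuit X → (∀ h → Obeys (dual (k h)) (X h)) → ∀ f s → s ≢ 𝟘 → k f ≡ sg s → X f ≢ s
    excluded X x o (inj₁ v) s s≢𝟘 refl Xf = ⊥-nonneg-contra (X ∘ inj₁) Z (z (X ∘ inj₁) (resp X≗ x))
      (λ h → obeys-dual-sg (Z h) (X (inj₁ h)) (o (inj₁ h))) v (sign-product (X (inj₁ v)) s Xf s≢𝟘)
      where
      X≗ : X ≗ extend (X ∘ inj₁)
      X≗ (inj₁ _) = refl
      X≗ (inj₂ i) = [ id , id ]′ (o (inj₂ i))
  ... | U , u , _ , hit = U , u , λ v → hit (inj₁ v) (Z v) refl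

  -- If no edge in direction i decides the sign at i, then a covector vanishing
  -- there is obtained from the vertices on one side: a circuit through these and
  -- Y_i would not be orthogonal to the opposite side.
  module _ (U : SignVec (D₁ n)) (u : Perp Circuit U) (i : Fin n)
           (undecided : ∀ v → U (inj₁ (v ⁺ i)) ≡ U (inj₁ (v ⁻ i)) × U (inj₁ (v ⁺ i)) ≢ 𝟘) where

    private
      k : D₁ n → Colour
      k (inj₁ v) = if does (lookup v i Sign.≟ Sign.+) then sg (U (inj₁ v)) else free
      k (inj₂ j) = sg (if does (j Fin.≟ i) then 𝟘 else U (inj₂ j))

      k-plus : ∀ v → lookup v i ≡ Sign.+ → k (inj₁ v) ≡ sg (U (inj₁ v))
      k-plus v q = cong (if_then sg (U (inj₁ v)) else free) (dec-true (lookup v i Sign.≟ Sign.+) q)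

      k-minus : ∀ v → lookup v i ≢ Sign.+ → k (inj₁ v) ≡ free
      k-minus v q = cong (if_then sg (U (inj₁ v)) else free) (dec-false (lookup v i Sign.≟ Sign.+) q)

      k-self : k (inj₂ i) ≡ sg 𝟘
      k-self = cong (λ b → sg (if b then 𝟘 else U (inj₂ i))) (dec-true (i Fin.≟ i) refl)

      k-other : ∀ j → j ≢ i → k (inj₂ j) ≡ sg (U (inj₂ j))
      k-other j q = cong (λ b → sg (if b then 𝟘 else U (inj₂ j))) (dec-false (j Fin.≟ i) q)

      excluded : ∀ X → Circuit X → (∀ h → Obeys (dual (k h)) (X h)) → ∀ f s → s ≢ 𝟘 → k f ≡ sg s → X f ≢ s
      excluded X x o f s s≢𝟘 kf Xf = ⊥-nonneg-contra X U (u X x) nonneg f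
        (sign-product (X f) (U f) (trans Xf (target f kf)) (s≢𝟘 ∘ trans (target f kf)))
        where
        obeys : ∀ h {c} → k h ≡ c → Obeys (dual c) (X h)
        obeys h q = subst (λ c → Obeys (dual c) (X h)) q (o h)
        off-side : ∀ v → lookup v i ≢ Sign.+ → X (inj₁ v) ≡ 𝟘
        off-side v q = [ id , id ]′ (obeys (inj₁ v) (k-minus v q))
        only : ∀ h → X h · side i Sign.- h ≢ 𝟘 → h ≡ inj₂ i ⊎ h ≡ inj₂ i
        only (inj₁ v) q = byCases (lookup v i Sign.≟ Sign.+)
          where
          byCases : Dec (lookup v i ≡ Sign.+) → inj₁ v ≡ inj₂ i ⊎ inj₁ v ≡ inj₂ i
          byCases (yes r) = contradiction (trans (cong (X (inj₁ v) ·_) (side-off i Sign.- v (λ t → contradiction (trans (sym r) t) λ ())))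
                                                 (·-zeroʳ (X (inj₁ v)))) q
          byCases (no r)  = contradiction (cong (_· side i Sign.- (inj₁ v)) (off-side v r)) q
        only (inj₂ j) q = byCases (j Fin.≟ i)
          where
          byCases : Dec (j ≡ i) → inj₂ j ≡ inj₂ i ⊎ inj₂ j ≡ inj₂ i
          byCases (yes refl) = inj₁ refl
          byCases (no r)     = contradiction (trans (cong (X (inj₂ j) ·_) (side-other i Sign.- r)) (·-zeroʳ (X (inj₂ j)))) q
        Xi : X (inj₂ i) ≡ 𝟘
        Xi = ·-self-opposed (X (inj₂ i)) _ (toSgn≢𝟘 Sign.- ∘ trans (sym (side-self i Sign.-)))
          (two-point {X = X} {side i Sign.-} (side-covector i Sign.- X x) (inj₂ i) (inj₂ i) only)
        nonneg : ∀ h → X h · U h ≢ ⊖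
        nonneg (inj₁ v) = byCases (lookup v i Sign.≟ Sign.+)
          where
          byCases : Dec (lookup v i ≡ Sign.+) → X (inj₁ v) · U (inj₁ v) ≢ ⊖
          byCases (yes q) = obeys-dual-sg (U (inj₁ v)) (X (inj₁ v)) (obeys (inj₁ v) (k-plus v q))
          byCases (no q) r = contradiction (trans (sym r) (cong (_· U (inj₁ v)) (off-side v q))) λ ()
        nonneg (inj₂ j) = byCases (j Fin.≟ i)
          where
          byCases : Dec (j ≡ i) → X (inj₂ j) · U (inj₂ j) ≢ ⊖
          byCases (yes refl) r = contradiction (trans (sym r) (cong (_· U (inj₂ i)) Xi)) λ ()
          byCases (no q) = obeys-dual-sg (U (inj₂ j)) (X (inj₂ j)) (obeys (inj₂ j) (k-other j q))
        target : ∀ f → k f ≡ sg s → s ≡ U f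
        target (inj₁ v) kf = byCases (lookup v i Sign.≟ Sign.+)
          where
          byCases : Dec (lookup v i ≡ Sign.+) → s ≡ U (inj₁ v)
          byCases (yes q) = sg-injective (trans (sym kf) (k-plus v q))
          byCases (no q)  = contradiction (trans (sym kf) (k-minus v q)) λ ()
        target (inj₂ j) kf = byCases (j Fin.≟ i)
          where
          byCases : Dec (j ≡ i) → s ≡ U (inj₂ j)
          byCases (yes refl) = contradiction (sg-injective (trans (sym kf) k-self)) s≢𝟘
          byCases (no q)     = sg-injective (trans (sym kf) (k-other j q))

      levelled : ∃ λ V → Perp Circuit V × (∀ v → V (inj₁ v) ≡ U (inj₁ v)) × V (inj₂ i) ≡ 𝟘 ×
                         (∀ j → j ≢ i → V (inj₂ j) ≡ U (inj₂ j))
      levelled with realize _≟ᴰ_ elements complete circuits k excluded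
      ... | V , v , _ , hit = V , v , (λ w → on-cube w (lookup w i) refl) , Vi , λ j q → hit (inj₂ j) _ (k-other j q)
        where
        Vi : V (inj₂ i) ≡ 𝟘
        Vi = hit (inj₂ i) 𝟘 k-self
        on-cube : ∀ w s → lookup w i ≡ s → V (inj₁ w) ≡ U (inj₁ w)
        on-cube w Sign.+ q = hit (inj₁ w) (U (inj₁ w)) (k-plus w q)
        -- The colouring leaves this vertex free, but the sign 𝟘 at Y_i makes `V` constant along its
        -- edge, as `U` is by assumption.
        on-cube w Sign.- q = begin
          V (inj₁ w)        ≡⟨ cong (V ∘ inj₁) (at-sign w i q) ⟨
          V (inj₁ (w ⁻ i))  ≡⟨ adm-𝟘⇒≡ _ _ (subst (λ y → Adm y (V (inj₁ (w ⁺ i))) (V (inj₁ (w ⁻ i)))) Vi (edges v i w)) ⟨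
          V (inj₁ (w ⁺ i))  ≡⟨ on-cube (w ⁺ i) Sign.+ (Vec.lookup∘update i w Sign.+) ⟩
          U (inj₁ (w ⁺ i))  ≡⟨ proj₁ (undecided w) ⟩
          U (inj₁ (w ⁻ i))  ≡⟨ cong (U ∘ inj₁) (at-sign w i q) ⟩
          U (inj₁ w)        ∎
          where open ≡-Reasoning

      nonvanishing : ∀ w → U (inj₁ w) ≢ 𝟘
      nonvanishing w with lookup w i in eq
      ... | Sign.+ = subst (λ x → U (inj₁ x) ≢ 𝟘) (at-sign w i eq) (proj₂ (undecided w))
      ... | Sign.- = subst (λ x → U (inj₁ x) ≢ 𝟘) (at-sign w i eq) (proj₂ (undecided w) ∘ trans (proj₁ (undecided w)))

      -- The levelled covector vanishes nowhere on the cube, and `side i s` vanishes in the other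
      -- directions, so that their composition differs from the former only at Y_i.
      towards-side : ∀ s → ∃ λ V → Perp Circuit V × (∀ v → V (inj₁ v) ≡ U (inj₁ v)) × V (inj₂ i) ≡ toSgn s ×
                                   (∀ j → j ≢ i → V (inj₂ j) ≡ U (inj₂ j))
      towards-side s with levelled
      ... | V , v , on-cube , Vi , rest = V ▹ᵥ side i s , compose {V} {side i s} v (side-covector i s) ,
        (λ w → trans (▹-absorbˡ _ _ (nonvanishing w ∘ trans (sym (on-cube w)))) (on-cube w)) ,
        trans (cong (_▹ side i s (inj₂ i)) Vi) (side-self i s) ,
        λ j q → trans (trans (cong (V (inj₂ j) ▹_) (side-other i s q)) (▹-identityʳ _)) (rest j q)

    resign : ∀ t → ∃ λ V → Perp Circuit V × (∀ v → V (inj₁ v) ≡ U (inj₁ v)) × V (inj₂ i) ≡ t ×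
                           (∀ j → j ≢ i → V (inj₂ j) ≡ U (inj₂ j))
    resign 𝟘 = levelled
    resign ⊕ = towards-side Sign.+
    resign ⊖ = towards-side Sign.-

  module _ {W : SignVec (D₁ n)} (w : Perp N.Circuit (W ∘ inj₁)) (W-edges : Edges W) where

    private
      -- If `U` and `W` differ at Y_i, both signs are admissible, so that no edge in direction `i`
      -- decides; `resign` corrects the sign without disturbing those already settled.
      agreeing : ∀ (is : List (Fin n)) → ∃ λ U → Perp Circuit U × (∀ v → U (inj₁ v) ≡ W (inj₁ v)) ×
                                                  (∀ j → j ∈ is → U (inj₂ j) ≡ W (inj₂ j))
      agreeing [] with lift (W ∘ inj₁) w
      ... | U , u , on-cube = U , u , on-cube , λ j ()
      agreeing (i ∷ is) with agreeing is
      ... | U , u , on-cube , on-is with U (inj₂ i) ≟ₛ W (inj₂ i)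
      ...   | yes Ui = U , u , on-cube , λ { j (here refl) → Ui ; j (there j∈) → on-is j j∈ }
      ...   | no Ui with resign U u i undecided (W (inj₂ i))
        where
        ambiguous : ∀ y y′ s t → y ≢ y′ → Adm y s t → Adm y′ s t → s ≡ t × s ≢ 𝟘
        ambiguous = by-signs
        undecided : ∀ v → U (inj₁ (v ⁺ i)) ≡ U (inj₁ (v ⁻ i)) × U (inj₁ (v ⁺ i)) ≢ 𝟘
        undecided v = ambiguous (U (inj₂ i)) (W (inj₂ i)) _ _ Ui (edges u i v)
          (subst₂ (Adm (W (inj₂ i))) (sym (on-cube (v ⁺ i))) (sym (on-cube (v ⁻ i))) (W-edges i v))
      ...     | V , v , V-cube , Vi , rest = V , v , (λ x → trans (V-cube x) (on-cube x)) , on-is′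
        where
        on-is′ : ∀ j → j ∈ i ∷ is → V (inj₂ j) ≡ W (inj₂ j)
        on-is′ j j∈ with j Fin.≟ i | j∈
        ... | yes refl | _          = Vi
        ... | no q     | here r     = contradiction r q
        ... | no q     | there j∈is = trans (rest j q) (on-is j j∈is)

    edges⇒covector : Perp Circuit W
    edges⇒covector with agreeing (allFin n)
    ... | U , u , on-cube , on-directions = resp-covector {U} {W} same u
      where
      same : U ≗ W
      same (inj₁ v) = on-cube v
      same (inj₂ j) = on-directions j (Membership.∈-allFin j)

module _ {E : Set} where

  perp-antitone : ∀ {𝒜 ℬ : Pred (SignVec E) 0ℓ} → 𝒜 ⊆ ℬ → Perp ℬ ⊆ Perp 𝒜
  perp-antitone 𝒜⊆ℬ w X x = w X (𝒜⊆ℬ x)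

  supportMinimal-cong : ∀ {𝒜 ℬ : Pred (SignVec E) 0ℓ} → 𝒜 ⊆ ℬ → ℬ ⊆ 𝒜 → SupportMinimal 𝒜 ⊆ SupportMinimal ℬ
  supportMinimal-cong 𝒜⊆ℬ ℬ⊆𝒜 (x , X≢0 , m) = 𝒜⊆ℬ x , X≢0 , λ Y y → m Y (ℬ⊆𝒜 y)

restrict-reflects-⊆ : ∀ {n} {M N : OrientedMatroid (D₁ n)} → IsAdjoint n M → IsAdjoint n N →
                      restrict M ≋ restrict N → OrientedMatroid.Circuit M ⊆ OrientedMatroid.Circuit N
restrict-reflects-⊆ {n} {M} {N} adjM adjN (M⊆N , N⊆M) {X} x =
  minimal⇒circuit N {X} (supportMinimal-cong {𝒜 = Perp (Perp M.Circuit)} {Perp (Perp N.Circuit)}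
    (perp-antitone {𝒜 = Perp N.Circuit} {Perp M.Circuit} N⇒M)
    (perp-antitone {𝒜 = Perp M.Circuit} {Perp N.Circuit} M⇒N) {X} (circuit⇒minimal M {X} x))
  where
  open D₁-finite n
  open Duality _≟ᴰ_ elements complete
  module M = OrientedMatroid M
  module N = OrientedMatroid N
  M⇒N : Perp M.Circuit ⊆ Perp N.Circuit
  M⇒N {W} w = CovectorsOfAdjoint.edges⇒covector n N adjN {W}
    (λ Z z → perp-restrict M {W} w Z (N⊆M {Z} z)) (Adjoint.edges n M adjM {W} w)
  N⇒M : Perp N.Circuit ⊆ Perp M.Circuit
  N⇒M {W} w = CovectorsOfAdjoint.edges⇒covector n M adjM {W}
    (λ Z z → perp-restrict N {W} w Z (M⊆N {Z} z)) (Adjoint.edges n N adjN {W} w)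

-- Every oriented cube extends to an adjoint

module _ {E : Set} (_≟_ : DecidableEquality E) where

  private
    infixl 7 _∖_

    _∖_ : List E → E → List E
    S ∖ s = filter (λ h → ¬? (h ≟ s)) S

    -- For a family of covectors this is contraction of `s`.
    vanishing-at : ∀ {𝒱 : Pred (SignVec E) 0ℓ} → IsExchangeFamily 𝒱 → ∀ s → IsExchangeFamily (λ W → 𝒱 W × W s ≡ 𝟘)
    vanishing-at family s = record
      { resp = λ eq (x , xs) → resp eq x , trans (sym (eq s)) xs
      ; _∈? = λ W → (W ∈?) ×-dec (W s ≟ₛ 𝟘)
      ; negate = λ (x , xs) → negate x , cong neg xs
      ; exchange = λ (x , xs) (y , ys) e f op Xf Yf →
          let (Z , z , Ze , Zf , between) = exchange x y e f op Xf Yf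
          in Z , (z , [ id , [ (λ q → trans q xs) , (λ q → trans q ys) ]′ ]′ (between s)) , Ze , Zf , between
      }
      where open IsExchangeFamily family

  -- Gaussian elimination on the covectors dual to B, with pivots in S.
  dual-family-bound : ∀ B S {𝒱 : Pred (SignVec E) 0ℓ} → IsExchangeFamily 𝒱 →
    (∀ W → 𝒱 W → (∀ s → s ∈ S → W s ≡ 𝟘) → ∀ h → W h ≡ 𝟘) → Unique B →
    (∀ b → b ∈ B → ∃ λ W → 𝒱 W × W b ≢ 𝟘 × (∀ e → e ∈ B → e ≢ b → W e ≡ 𝟘)) → length B ≤ length S
  dual-family-bound [] S family spanning unique dual = z≤n
  dual-family-bound (b ∷ B) S {𝒱} family spanning (b∉B ∷ unique) dual
    with dual b (here refl)
  ... | D , d , Db , D-off with any? (λ s → ¬? (D s ≟ₛ 𝟘)) S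
  ...   | no none = contradiction
    (spanning D d (λ s s∈ → decidable-stable (D s ≟ₛ 𝟘) λ q → none (Any.map (λ { refl → q }) s∈)) b) Db
  ...   | yes some with find some
  ...     | s , s∈S , Ds = ℕ.≤-trans
      (s≤s (dual-family-bound B (S ∖ s) (vanishing-at family s) spanning′ unique dual′))
      (List.filter-notAll (λ h → ¬? (h ≟ s)) S (Any.map (λ { refl q → q refl }) s∈S))
    where
    open IsExchangeFamily family
    spanning′ : ∀ W → 𝒱 W × W s ≡ 𝟘 → (∀ t → t ∈ S ∖ s → W t ≡ 𝟘) → ∀ h → W h ≡ 𝟘
    spanning′ W (w , Ws) vanish = spanning W w at
      where
      at : ∀ t → t ∈ S → W t ≡ 𝟘
      at t t∈S with t ≟ s
      ... | yes refl = Ws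
      ... | no t≢s   = vanish t (∈-filter⁺ (λ h → ¬? (h ≟ s)) t∈S t≢s)
    dual′ : ∀ c → c ∈ B → ∃ λ W → (𝒱 W × W s ≡ 𝟘) × W c ≢ 𝟘 × (∀ e → e ∈ B → e ≢ c → W e ≡ 𝟘)
    dual′ c c∈B with dual c (there c∈B)
    ... | W , w , Wc , W-off with W s ≟ₛ 𝟘
    ...   | yes Ws = W , (w , Ws) , Wc , λ e e∈B → W-off e (there e∈B)
    ...   | no Ws = [ pivot d D-zero , pivot (negate d) (λ e e∈B → cong neg (D-zero e e∈B)) ]′ (opposed-up-to-sign (W s) (D s) Ws Ds)
      where
      D-zero : ∀ e → e ∈ B → D e ≡ 𝟘
      D-zero e e∈B = D-off e (there e∈B) λ { refl → All.lookup b∉B e∈B refl }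
      pivot : ∀ {D} → 𝒱 D → (∀ e → e ∈ B → D e ≡ 𝟘) → Opposed (W s) (D s) →
              ∃ λ W → (𝒱 W × W s ≡ 𝟘) × W c ≢ 𝟘 × (∀ e → e ∈ B → e ≢ c → W e ≡ 𝟘)
      pivot {D} d D-zero op with exchange w d s c op Wc (λ q → Wc (neg≡𝟘 (W c) (trans (sym q) (D-zero c c∈B))))
      ... | Z , z , Zs , Zc , between = Z , (z , Zs) , (λ q → Wc (trans (sym Zc) q)) , λ e e∈B e≢c →
        [ id , [ (λ q → trans q (W-off e (there e∈B) e≢c)) , (λ q → trans q (D-zero e e∈B)) ]′ ]′ (between e)

  module _ (elements : List E) (complete : ∀ e → e ∈ elements) (M : OrientedMatroid E) where

    open OrientedMatroid M
    open Circuits _≟_ elements complete M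
    open Painting _≟_ elements complete circuits
    open Covectors _≟_ elements complete

    -- For an independent `B`, painting yields for each element of `B` a covector that vanishes on
    -- the rest of `B` but not at it. Such a dual family cannot be larger than a spanning set.
    rank-bound : ∀ S → (∀ W → Perp Circuit W → (∀ s → s ∈ S → W s ≡ 𝟘) → ∀ h → W h ≡ 𝟘) →
                 ∀ B → Unique B → Independent B → length B ≤ length S
    rank-bound S spanning B unique independent =
      dual-family-bound B S (exchangeFamily (perp-covectors circuits)) spanning unique dual-covector
      where
      dual-covector : ∀ b → b ∈ B → ∃ λ W → Perp Circuit W × W b ≢ 𝟘 × (∀ e → e ∈ B → e ≢ b → W e ≡ 𝟘)
      dual-covector b b∈B with painting c b ⊕ (λ ()) c-b
        where
        c : E → Colour
        c h with h ≟ b | any? (h ≟_) B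
        ... | yes _ | _     = sg ⊕
        ... | no _  | yes _ = free
        ... | no _  | no _  = sg 𝟘
        c-b : c b ≡ sg ⊕
        c-b with b ≟ b
        ... | yes _ = refl
        ... | no q  = contradiction refl q
      ... | inj₁ (X , x , o , _) = contradiction (λ {h} → within h) (independent X x)
        where
        within : ∀ h → X h ≢ 𝟘 → h ∈ B
        within h q with h ≟ b | any? (h ≟_) B | o h
        ... | yes refl | _ | _ = b∈B
        ... | no _ | yes r | _ = r
        ... | no _ | no _ | inj₁ r = contradiction r q
        ... | no _ | no _ | inj₂ r = contradiction r q
      ... | inj₂ (W , w , o , Wb) = W , w , (λ q → contradiction (trans (sym Wb) q) λ ()) , vanish
        where
        vanish : ∀ e → e ∈ B → e ≢ b → W e ≡ 𝟘
        vanish e e∈B e≢b with e ≟ b | any? (e ≟_) B | o e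
        ... | yes q | _ | _ = contradiction q e≢b
        ... | no _ | no q | _ = contradiction e∈B q
        ... | no _ | yes _ | inj₁ r = r
        ... | no _ | yes _ | inj₂ r = r

module _ {E : Set} {𝒜 ℬ : Pred (SignVec E) 0ℓ} where

  covectorFamily-cong : (∀ W → 𝒜 W → ℬ W) → (∀ W → ℬ W → 𝒜 W) → IsCovectorFamily 𝒜 → IsCovectorFamily ℬ
  covectorFamily-cong to from isA = record
    { resp = λ {X} {Y} eq x → to Y (resp eq (from X x))
    ; _∈? = λ W → map′ (to W) (from W) (W ∈?)
    ; null = to _ null
    ; negate = λ {X} x → to (-ᵥ X) (negate (from X x))
    ; compose = λ {X} {Y} x y → to (X ▹ᵥ Y) (compose (from X x) (from Y y))
    ; eliminate = λ {X} {Y} x y e op →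
        let (Z , z , rest) = eliminate (from X x) (from Y y) e op in Z , to Z z , rest
    }
    where open IsCovectorFamily isA

module ExtendCube (n : ℕ) (K : OrientedMatroid (Cube n)) (isCube : IsOrientedCube n K) where

  open D₁-finite n
  open IsOrientedCube isCube
  private module K = OrientedMatroid K

  𝓛 : Pred (SignVec (Cube n)) 0ℓ
  𝓛 = Perp K.Circuit

  private
    cubeCovectors : IsCovectorFamily 𝓛
    cubeCovectors = Duality.covectors _≟ᵥ_ (vertices n) vertices-complete K

    module 𝓛 = IsCovectorFamily cubeCovectors

  covector-consistent : ∀ {Z} → 𝓛 Z → Consistent Z
  covector-consistent {Z} = consistent (λ v i B B≢∅ disjoint → rectangles v ⁅ i ⁆ B (i , Subset.x∈⁅x⁆ i) B≢∅ disjoint) {Z}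

  facet-covector : ∀ i s → 𝓛 (facetVec i s)
  facet-covector i s = proj₁ (facets i (opposite s) (facetVec i s) (real-facet i s)
    ( (λ {v} q r → opposite-≢ s (trans (sym r) (facetVec-supp i s v q)))
    , (λ {v} q r → contradiction (trans (sym (facetVec-on i s v (same (lookup v i) s q))) r) λ ())))
    where
    same : ∀ t s → t ≢ opposite s → t ≡ s
    same Sign.+ Sign.+ _ = refl
    same Sign.+ Sign.- q = contradiction refl q
    same Sign.- Sign.+ q = contradiction refl q
    same Sign.- Sign.- _ = refl

  EdgesAt : Fin n → SignVec (D₁ n) → Set
  EdgesAt i W = ∀ v → Adm (W (inj₂ i)) (W (inj₁ (v ⁺ i))) (W (inj₁ (v ⁻ i)))

  -- The covectors after the directions in a list have been added; the others
  -- are loops.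
  Stage : List (Fin n) → Pred (SignVec (D₁ n)) 0ℓ
  Stage is W = 𝓛 (W ∘ inj₁) × (∀ j → j ∈ is → EdgesAt j W) × (∀ j → ¬ j ∈ is → W (inj₂ j) ≡ 𝟘)

  private
    stage-[] : IsCovectorFamily (Stage [])
    stage-[] = record
      { resp = λ {X} {Y} eq (x , _ , z) → 𝓛.resp {X ∘ inj₁} {Y ∘ inj₁} (eq ∘ inj₁) x , (λ j ()) , λ j q → trans (sym (eq (inj₂ j))) (z j q)
      ; _∈? = λ W → map′ (λ (x , z) → x , (λ j ()) , λ j _ → z j) (λ (x , _ , z) → x , λ j → z j λ ())
          (((W ∘ inj₁) 𝓛.∈?) ×-dec Fin.all? (λ j → W (inj₂ j) ≟ₛ 𝟘))
      ; null = 𝓛.null , (λ j ()) , λ j _ → refl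
      ; negate = λ {X} (x , _ , z) → 𝓛.negate {X ∘ inj₁} x , (λ j ()) , λ j q → cong neg (z j q)
      ; compose = λ {X} {Y} (x , _ , z) (y , _ , z′) → 𝓛.compose {X ∘ inj₁} {Y ∘ inj₁} x y , (λ j ()) , λ j q → cong₂ _▹_ (z j q) (z′ j q)
      ; eliminate = λ {X} {Y} → eliminate X Y
      }
      where
      eliminate : ∀ X Y → Stage [] X → Stage [] Y → ∀ e → Opposed (X e) (Y e) →
                  ∃ λ Z → Stage [] Z × Z e ≡ 𝟘 × (∀ h → ¬ Opposed (X h) (Y h) → Z h ≡ X h ▹ Y h)
      eliminate X Y (x , _ , z) (y , _ , z′) (inj₂ j) op = contradiction (z j λ ()) (proj₁ op)
      eliminate X Y (x , _ , z) (y , _ , z′) (inj₁ v) op with 𝓛.eliminate {X ∘ inj₁} {Y ∘ inj₁} x y v op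
      ... | Z , z∈ , Zv , off = extend Z , (z∈ , (λ j ()) , λ j _ → refl) , Zv ,
        Sum.[_,_] off (λ j _ → sym (cong₂ _▹_ (z j λ ()) (z′ j λ ())))

    module _ (i : Fin n) (is : List (Fin n)) (i∉is : ¬ i ∈ is) (covectors : IsCovectorFamily (Stage is)) where

      -- A facet in direction `i` is constant along the edges of the directions added before, so
      -- that 𝟘 is an admissible sign for them.
      facet-stage : ∀ s → Stage is (extend (facetVec i s))
      facet-stage s = facet-covector i s , on-edges , λ j _ → refl
        where
        on-edges : ∀ j → j ∈ is → EdgesAt j (extend (facetVec i s))
        on-edges j j∈is v = ≡⇒adm-𝟘 _ _ (cong (λ t → if does (t Sign.≟ s) then ⊕ else 𝟘)
          (trans (Vec.lookup∘update′ i≢j v Sign.+) (sym (Vec.lookup∘update′ i≢j v Sign.-))))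
          where
          i≢j : i ≢ j
          i≢j refl = i∉is j∈is

      plus : ∀ (v : Cube n) → lookup (v ⁺ i) i ≡ Sign.+
      plus v = Vec.lookup∘update i v Sign.+

      minus : ∀ (v : Cube n) → lookup (v ⁻ i) i ≡ Sign.-
      minus v = Vec.lookup∘update i v Sign.-

      classify : ∀ h → h ≢ inj₂ i → (∃ λ w → h ≡ inj₁ (w ⁺ i)) ⊎ (∃ λ w → h ≡ inj₁ (w ⁻ i)) ⊎
                 (extend {G = Fin n} (facetVec i Sign.+) h ≡ 𝟘 × extend {G = Fin n} (facetVec i Sign.-) h ≡ 𝟘)
      classify (inj₁ v) _ with lookup v i in eq
      ... | Sign.+ = inj₁ (v , cong inj₁ (sym (at-sign v i eq)))
      ... | Sign.- = inj₂ (inj₁ (v , cong inj₁ (sym (at-sign v i eq))))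
      classify (inj₂ j) _ = inj₂ (inj₂ (refl , refl))

      module Ext = Extension _≟ᴰ_ elements complete covectors (inj₂ i)
        (λ (_ , _ , z) → z i i∉is) ∃-vertex? (λ v → inj₁ (v ⁺ i)) (λ v → inj₁ (v ⁻ i)) (λ _ ()) (λ _ ())
        (λ {W} (w , _) → covector-consistent {W ∘ inj₁} w i)
        (extend (facetVec i Sign.+)) (extend (facetVec i Sign.-)) (facet-stage Sign.+) (facet-stage Sign.-)
        (λ v → facetVec-on i Sign.+ (v ⁺ i) (plus v))
        (λ v → facetVec-off i Sign.+ (v ⁻ i) (λ q → contradiction (trans (sym (minus v)) q) λ ()))
        (λ v → facetVec-off i Sign.- (v ⁺ i) (λ q → contradiction (trans (sym (plus v)) q) λ ()))
        (λ v → facetVec-on i Sign.- (v ⁻ i) (minus v))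
        classify

      open Finite _≟ᴰ_ elements complete

      unchanged : ∀ (W : SignVec (D₁ n)) j → j ≢ i → (W [ inj₂ i ≔ 𝟘 ]) (inj₂ j) ≡ W (inj₂ j)
      unchanged W j q = ≔-other W (inj₂ i) 𝟘 (q ∘ Sum.inj₂-injective)

      extended⇒stage : ∀ W → Ext.Extended W → Stage (i ∷ is) W
      extended⇒stage W ((x , on-edges , z) , adm) = x , edges′ , zeros
        where
        edges′ : ∀ j → j ∈ i ∷ is → EdgesAt j W
        edges′ j (here refl)  = adm
        edges′ j (there j∈is) v = subst (λ y → Adm y (W (inj₁ (v ⁺ j))) (W (inj₁ (v ⁻ j))))
          (unchanged W j (λ { refl → i∉is j∈is })) (on-edges j j∈is v)
        zeros : ∀ j → ¬ j ∈ i ∷ is → W (inj₂ j) ≡ 𝟘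
        zeros j j∉ = trans (sym (unchanged W j (j∉ ∘ here))) (z j (j∉ ∘ there))

      stage⇒extended : ∀ W → Stage (i ∷ is) W → Ext.Extended W
      stage⇒extended W (x , on-edges , z) = (x , edges′ , zeros) , on-edges i (here refl)
        where
        edges′ : ∀ j → j ∈ is → EdgesAt j (W [ inj₂ i ≔ 𝟘 ])
        edges′ j j∈is v = subst (λ y → Adm y (W (inj₁ (v ⁺ j))) (W (inj₁ (v ⁻ j))))
          (sym (unchanged W j (λ { refl → i∉is j∈is }))) (on-edges j (there j∈is) v)
        zeros : ∀ j → ¬ j ∈ is → (W [ inj₂ i ≔ 𝟘 ]) (inj₂ j) ≡ 𝟘
        zeros j j∉is = byCases (j Fin.≟ i)
          where
          byCases : Dec (j ≡ i) → (W [ inj₂ i ≔ 𝟘 ]) (inj₂ j) ≡ 𝟘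
          byCases (yes refl) = ≔-same W (inj₂ i) 𝟘
          byCases (no q) = trans (unchanged W j q) (z j λ { (here r) → q r ; (there r) → j∉is r })

      stage-∷ : IsCovectorFamily (Stage (i ∷ is))
      stage-∷ = covectorFamily-cong extended⇒stage stage⇒extended Ext.extended

    stage : ∀ is → Unique is → IsCovectorFamily (Stage is)
    stage [] _ = stage-[]
    stage (i ∷ is) (i∉is ∷ unique) = stage-∷ i is (λ i∈is → All.lookup i∉is i∈is refl) (stage is unique)

    adjointCovectors : IsCovectorFamily (Stage (allFin n))
    adjointCovectors = stage (allFin n) (Unique.allFin⁺ n)

    to-stage : ∀ {W} → 𝓛 (W ∘ inj₁) → Edges W → Stage (allFin n) W
    to-stage w on-edges = w , (λ j _ → on-edges j) , λ j j∉ → contradiction (Membership.∈-allFin j) j∉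

    stage-edges : ∀ {W} → Stage (allFin n) W → Edges W
    stage-edges (_ , on-edges , _) j = on-edges j (Membership.∈-allFin j)

    module D = Duality _≟ᴰ_ elements complete

  M : OrientedMatroid (D₁ n)
  M = D.fromCovectors adjointCovectors

  private module M = OrientedMatroid M

  side-stage : ∀ i s → Stage (allFin n) (side i s)
  side-stage i s = to-stage {side i s}
    (𝓛.resp {facetVec i s} {side i s ∘ inj₁} (λ v → sym (side-cube i s v)) (facet-covector i s)) on-edges
    where
    on-edges : Edges (side i s)
    on-edges j v = byCases (j Fin.≟ i) s refl
      where
      byCases : Dec (j ≡ i) → ∀ t → s ≡ t → Adm (side i s (inj₂ j)) (side i s (inj₁ (v ⁺ j))) (side i s (inj₁ (v ⁻ j)))
      byCases (no j≢i) _ _ = subst (λ y → Adm y (side i s (inj₁ (v ⁺ j))) (side i s (inj₁ (v ⁻ j)))) (sym (side-other i s j≢i))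
        (≡⇒adm-𝟘 (side i s (inj₁ (v ⁺ j))) (side i s (inj₁ (v ⁻ j))) (begin
          side i s (inj₁ (v ⁺ j)) ≡⟨ side-cube i s (v ⁺ j) ⟩
          facetVec i s (v ⁺ j)    ≡⟨ cong (λ t → if does (t Sign.≟ s) then ⊕ else 𝟘)
            (trans (Vec.lookup∘update′ (j≢i ∘ sym) v Sign.+) (sym (Vec.lookup∘update′ (j≢i ∘ sym) v Sign.-))) ⟩
          facetVec i s (v ⁻ j)    ≡⟨ side-cube i s (v ⁻ j) ⟨
          side i s (inj₁ (v ⁻ j)) ∎))
        where open ≡-Reasoning
      byCases (yes refl) Sign.+ refl = inj₂ (trans (side-self j Sign.+)
        (sym (cong₂ (λ x y → x ▹ neg y) (side-on j Sign.+ (v ⁺ j) (Vec.lookup∘update j v Sign.+))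
          (side-off j Sign.+ (v ⁻ j) (λ q → contradiction (trans (sym (Vec.lookup∘update j v Sign.-)) q) λ ())))))
      byCases (yes refl) Sign.- refl = inj₂ (trans (side-self j Sign.-)
        (sym (cong₂ (λ x y → x ▹ neg y) (side-off j Sign.- (v ⁺ j) (λ q → contradiction (trans (sym (Vec.lookup∘update j v Sign.+)) q) λ ()))
          (side-on j Sign.- (v ⁻ j) (Vec.lookup∘update j v Sign.-)))))

  side-perp : ∀ i s → Perp M.Circuit (side i s)
  side-perp i s = D.covector⇒perp adjointCovectors {side i s} (side-stage i s)

  private
    v₀ : Cube n
    v₀ = Vec.replicate n Sign.+

  -- On the cube, a covector inside the support is a multiple of the facet vector, and a single edge
  -- in direction `i` shows that this multiple and the sign at Y_i vanish together.
  side-cocircuit : ∀ i s → M.Cocircuit (side i s)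
  side-cocircuit i s = side-perp i s ,
      (inj₂ i , λ q → toSgn≢𝟘 s (trans (sym (side-self i s)) q)) , minimal
    where
    minimal : ∀ Y → Perp M.Circuit Y → NonZero Y → supp Y ⊆ supp (side i s) → supp (side i s) ⊆ supp Y
    minimal Y y′ Y≢0 Y⊆ {h} = full h
      where
      yₛ : Stage (allFin n) Y
      yₛ = D.perp⇒covector adjointCovectors {Y} y′
      like : ∃ λ y → ∀ v → Y (inj₁ v) ≡ y · facetVec i s v
      like = like-facet {Z = Y ∘ inj₁} (covector-consistent {Y ∘ inj₁} (proj₁ yₛ)) i s
        λ v q → decidable-stable (Y (inj₁ v) ≟ₛ 𝟘) λ r → Y⊆ {inj₁ v} r (side-off i s v q)
      y = proj₁ like
      at-infinity : ∀ t → s ≡ t → ∀ η → Adm η (y · facetVec i s (v₀ ⁺ i)) (y · facetVec i s (v₀ ⁻ i)) →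
                    (η ≡ 𝟘 → y ≡ 𝟘) × (y ≡ 𝟘 → η ≡ 𝟘)
      at-infinity Sign.+ refl η = one-sided η y _ _ (facetVec-on i s (v₀ ⁺ i) (Vec.lookup∘update i v₀ Sign.+))
          (facetVec-off i s (v₀ ⁻ i) (λ q → contradiction (trans (sym (Vec.lookup∘update i v₀ Sign.-)) q) λ ()))
        where
        one-sided : ∀ η y f g → f ≡ ⊕ → g ≡ 𝟘 → Adm η (y · f) (y · g) → (η ≡ 𝟘 → y ≡ 𝟘) × (y ≡ 𝟘 → η ≡ 𝟘)
        one-sided = by-signs
      at-infinity Sign.- refl η = one-sided η y _ _ (facetVec-off i s (v₀ ⁺ i) (λ q → contradiction (trans (sym (Vec.lookup∘update i v₀ Sign.+)) q) λ ()))
          (facetVec-on i s (v₀ ⁻ i) (Vec.lookup∘update i v₀ Sign.-))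
        where
        one-sided : ∀ η y f g → f ≡ 𝟘 → g ≡ ⊕ → Adm η (y · f) (y · g) → (η ≡ 𝟘 → y ≡ 𝟘) × (y ≡ 𝟘 → η ≡ 𝟘)
        one-sided = by-signs
      infinity : (Y (inj₂ i) ≡ 𝟘 → y ≡ 𝟘) × (y ≡ 𝟘 → Y (inj₂ i) ≡ 𝟘)
      infinity = at-infinity s refl (Y (inj₂ i))
        (subst₂ (Adm (Y (inj₂ i))) (proj₂ like (v₀ ⁺ i)) (proj₂ like (v₀ ⁻ i)) (stage-edges {Y} yₛ i v₀))
      y≢𝟘 : y ≢ 𝟘
      y≢𝟘 q = absurd (proj₁ Y≢0) (proj₂ Y≢0)
        where
        absurd : ∀ h → Y h ≢ 𝟘 → Absurd
        absurd (inj₁ v) Yv = Yv (trans (proj₂ like v) (cong (_· facetVec i s v) q))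
        absurd (inj₂ j) Yj = byCases (j Fin.≟ i)
          where
          byCases : Dec (j ≡ i) → Absurd
          byCases (yes refl) = Yj (proj₂ infinity q)
          byCases (no j≢i)   = Y⊆ {inj₂ j} Yj (side-other i s j≢i)
      full : ∀ h → side i s h ≢ 𝟘 → Y h ≢ 𝟘
      full (inj₁ v) q r = ≢𝟘-· y (facetVec i s v) y≢𝟘 (q ∘ trans (side-cube i s v)) (trans (sym (proj₂ like v)) r)
      full (inj₂ j) q r = byCases (j Fin.≟ i)
        where
        byCases : Dec (j ≡ i) → Absurd
        byCases (yes refl) = y≢𝟘 (proj₁ infinity r)
        byCases (no j≢i)   = q (side-other i s j≢i)

  module _ (k₀ : Fin n) where

    -- The vertex `v₀` and its n neighbours are independent; the direction `k₀` supplies a facet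
    -- vector nonzero at `v₀`, so that `v₀` is not a loop. Conversely, a covector vanishing at `v₀`
    -- and at all Y_i is constant along edges and hence null, so that these n + 1 elements span.
    rank : M.HasRank (suc n)
    rank = lower , upper
      where
      open Rank _≟ᴰ_ elements complete M
      base : List (D₁ n)
      base = inj₁ v₀ ∷ []
      base-independent : M.Independent base
      base-independent X x X⊆ = contradiction Xv₀ (subst (λ h → X h ≢ 𝟘) here-only (proj₂ (M.nonZero {X} x)))
        where
        in-base : ∀ h → X h ≢ 𝟘 → h ≡ inj₁ v₀
        in-base h q with X⊆ {h} q
        ... | here r = r
        here-only = in-base (proj₁ (M.nonZero {X} x)) (proj₂ (M.nonZero {X} x))
        F = side k₀ (lookup v₀ k₀)
        only : ∀ h → X h · F h ≢ 𝟘 → h ≡ inj₁ v₀ ⊎ h ≡ inj₁ v₀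
        only h q = inj₁ (in-base h (λ r → q (cong (_· F h) r)))
        Xv₀ : X (inj₁ v₀) ≡ 𝟘
        Xv₀ = ·-self-opposed (X (inj₁ v₀)) (F (inj₁ v₀))
          (λ q → contradiction (trans (sym (side-on k₀ (lookup v₀ k₀) v₀ refl)) q) λ ())
          (two-point {X = X} {F} (side-perp k₀ (lookup v₀ k₀) X x) (inj₁ v₀) (inj₁ v₀) only)
      lower : ∃ λ B → Unique B × M.Independent B × length B ≡ suc n
      lower with flag-independent (towards v₀) (away v₀) (λ j → side-perp j (opposite (lookup v₀ j))) (away-diagonal v₀)
        (λ j k k≢j → away-zero v₀ _ (Vec.lookup∘update′ (k≢j ∘ sym) v₀ _)) base
        (λ { j _ (here refl) → away-zero v₀ v₀ refl }) ([] ∷ []) base-independent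
      ... | B , unique , independent , len = B , unique , independent , trans len (ℕ.+-comm n 1)
      S : List (D₁ n)
      S = inj₁ v₀ ∷ map inj₂ (allFin n)
      spanning : ∀ W → Perp M.Circuit W → (∀ s → s ∈ S → W s ≡ 𝟘) → ∀ h → W h ≡ 𝟘
      spanning W w vanish = Sum.[_,_] on-cube directions
        where
        directions : ∀ j → W (inj₂ j) ≡ 𝟘
        directions j = vanish (inj₂ j) (there (Membership.∈-map⁺ inj₂ (Membership.∈-allFin j)))
        on-edges : Edges W
        on-edges = stage-edges {W} (D.perp⇒covector adjointCovectors {W} w)
        on-cube : ∀ v → W (inj₁ v) ≡ 𝟘
        on-cube v = path (λ u → W (inj₁ u) ≡ 𝟘) {v₀} {v}
          (λ u k _ → trans (level-step (W ∘ inj₁) u (lookup v k)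
            (adm-𝟘⇒≡ (W (inj₁ (u ⁺ k))) (W (inj₁ (u ⁻ k)))
              (subst (λ y → Adm y (W (inj₁ (u ⁺ k))) (W (inj₁ (u ⁻ k)))) (directions k) (on-edges k u)))))
          (vanish (inj₁ v₀) (here refl))
      upper : ∀ B → Unique B → M.Independent B → length B ≤ suc n
      upper B unique independent = subst (length B ≤_)
        (cong suc (trans (List.length-map inj₂ (allFin n)) (List.length-tabulate id)))
        (rank-bound _≟ᴰ_ elements complete M S spanning B unique independent)

    isAdjoint : IsAdjoint n M
    isAdjoint = record { rank = rank ; cocircuits = Sum.[ (λ i → side-cocircuit i Sign.+) , (λ i → side-cocircuit i Sign.-) ] }

  private
    extend-perp : ∀ X → Perp 𝓛 X → Perp (Stage (allFin n)) (extend X)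
    extend-perp X x W (w , _) = Sum.map
      (λ z → Sum.[_,_] z λ j → ·-zeroʳ (W (inj₂ j)))
      (λ ((e , p) , (f , m)) → (inj₁ e , p) , (inj₁ f , m)) (x (W ∘ inj₁) w)

    -- Every covector of the cube extends to a covector of the adjoint by the signs its edges admit,
    -- and `X` does not see the added signs.
    perp-of-extension : ∀ X → (∀ j → X (inj₂ j) ≡ 𝟘) → Perp (Stage (allFin n)) X → Perp 𝓛 (X ∘ inj₁)
    perp-of-extension X X₂ x Z z = ⊥-sym (X ∘ inj₁) Z
      (⊥-restrict {X = X} {W} X₂ (⊥-sym W X (x W (to-stage {W} z (λ i v → proj₂ (dir i) v)))))
      where
      dir : ∀ i → ∃ λ y → ∀ v → Adm y (Z (v ⁺ i)) (Z (v ⁻ i))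
      dir = direction {Z = Z} (covector-consistent {Z} z)
      W : SignVec (D₁ n)
      W = [ Z , proj₁ ∘ dir ]′

  -- Vectors of the adjoint supported on the cube are the vectors of the cube extended by 𝟘;
  -- shrinking a support does not leave this class, so that the minimal ones correspond as well.
  restrict-≋ : restrict M ≋ K
  restrict-≋ = (λ {X} → to X) , (λ {X} → from X)
    where
    module DK = Duality _≟ᵥ_ (vertices n) vertices-complete
    to : ∀ X → M.Circuit (extend X) → K.Circuit X
    to X (x , X≢0 , minimal) = DK.minimal⇒circuit K {X}
      (perp-of-extension (extend X) (λ _ → refl) x , nonzero X≢0 , λ Y y (e , Ye) Y⊆X {v} →
        minimal (extend Y) (extend-perp Y y) (inj₁ e , Ye) (λ {h} → Sum.[_,_] {C = λ h → extend Y h ≢ 𝟘 → extend X h ≢ 𝟘} (λ w → Y⊆X {w}) (λ _ q → q) h) {inj₁ v})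
      where
      nonzero : NonZero (extend {G = Fin n} X) → NonZero X
      nonzero (inj₁ v , q) = v , q
      nonzero (inj₂ _ , q) = contradiction refl q
    from : ∀ X → K.Circuit X → M.Circuit (extend X)
    from X x′ with DK.circuit⇒minimal K {X} x′
    ... | x , (e , Xe) , minimal = extend-perp X x , (inj₁ e , Xe) , minimal′
      where
      minimal′ : ∀ Y → Perp (Stage (allFin n)) Y → NonZero Y → supp Y ⊆ supp (extend X) → supp (extend X) ⊆ supp Y
      minimal′ Y y Y≢0 Y⊆X {h} = Sum.[_,_] {C = λ h → extend X h ≢ 𝟘 → Y h ≢ 𝟘} (λ v → minimal (Y ∘ inj₁) (perp-of-extension Y Y₂ y) (restricted Y≢0) (λ {w} → Y⊆X {inj₁ w}) {v})
          (λ _ q → contradiction refl q) h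
        where
        Y₂ : ∀ j → Y (inj₂ j) ≡ 𝟘
        Y₂ j = decidable-stable (Y (inj₂ j) ≟ₛ 𝟘) λ q → Y⊆X {inj₂ j} q refl
        restricted : NonZero Y → NonZero (Y ∘ inj₁)
        restricted (inj₁ v , q) = v , q
        restricted (inj₂ j , q) = contradiction (Y₂ j) q

-- The bijection

≋-sym : ∀ {E} {M N : OrientedMatroid E} → M ≋ N → N ≋ M
≋-sym (to , from) = (λ {X} → from {X}) , (λ {X} → to {X})

≋-trans : ∀ {E} {M N P : OrientedMatroid E} → M ≋ N → N ≋ P → M ≋ P
≋-trans (to , from) (to′ , from′) = (λ {X} → to′ {X} ∘ to {X}) , (λ {X} → from {X} ∘ from′ {X})

restrict-cong : ∀ {F G} {M N : OrientedMatroid (F ⊎ G)} → M ≋ N → restrict M ≋ restrict N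
restrict-cong (to , from) = (λ {X} → to {extend X}) , (λ {X} → from {extend X})

theorem3p1 : ∀ (n : ℕ) → 2 ≤ n →
    Σ (∀ M → IsAdjoint n M → IsOrientedCube n (restrict M)) λ wd →
    IsBijection (_≈ₐ_ {n}) (_≈꜀_ {n}) (λ (M , adj) → (restrict M , wd M adj))
theorem3p1 n@(suc _) 2≤n = AdjointRestriction.isOrientedCube n , record
  { isInjection = record
    { isCongruent = record
      { cong = λ {M} {N} → restrict-cong {M = proj₁ M} {proj₁ N}
      ; isEquivalence₁ = record
        { refl = id , id
        ; sym = λ {M} {N} → ≋-sym {M = proj₁ M} {proj₁ N}
        ; trans = λ {M} {N} {P} → ≋-trans {M = proj₁ M} {proj₁ N} {proj₁ P} }
      ; isEquivalence₂ = record
        { refl = id , id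
        ; sym = λ {M} {N} → ≋-sym {M = proj₁ M} {proj₁ N}
        ; trans = λ {M} {N} {P} → ≋-trans {M = proj₁ M} {proj₁ N} {proj₁ P} }
      }
    ; injective = λ {M} {N} eq →
        (λ {X} → restrict-reflects-⊆ {M = proj₁ M} {proj₁ N} (proj₂ M) (proj₂ N) eq {X}) ,
        (λ {X} → restrict-reflects-⊆ {M = proj₁ N} {proj₁ M} (proj₂ N) (proj₂ M)
                   (≋-sym {M = restrict (proj₁ M)} {restrict (proj₁ N)} eq) {X})
    }
  ; surjective = λ (K , isCube) →
      let open ExtendCube n K isCube
      -- The direction `Fin.zero` serves in the rank count as the witness that `v₀` is not a loop.
      in (M , isAdjoint Fin.zero) , λ {N} eq →
        ≋-trans {M = restrict (proj₁ N)} {restrict M} {K} (restrict-cong {M = proj₁ N} {M} eq) restrict-≋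
  }
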